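{- There exists an absolute constant $M>0$ such that whenever $p$ is a prime, $G$ is a proper multiplicative subgroup of $\mathbb{F}_p^*$ with $|G|>M$, and $\lambda\in\mathbb{F}_p^*$, there are no sets $A,B,C\subset\mathbb{F}_p^*$ with $|A|,|B|,|C|\ge 2$ such that $ABC=(G-\lambda)\setminus\{0\}$.
   Context: $ABC=\{abc:a\in A,b\in B,c\in C\}$ and $G-\lambda=\{g-\lambda:g\in G\}$. -}

module Defs where

open import Data.Nat using (ℕ; zero; suc; _+_; _*_; _∸_; _%_)
open import Data.Nat.DivMod using (m%n<n)
open import Data.Fin using (Fin; toℕ; fromℕ<)
open import Data.Fin.Subset using (Subset; _∈_; _∉_)
open import Data.Product using (Σ; ∃; _×_; _,_)
open import Relation.Binary.PropositionalEquality using (_≡_; _≢_)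
open import Function.Bundles using (_⇔_)

-- Elements of 𝔽_p are represented by Fin p (residues 0,…,p-1).

mulF : ∀ {p} → Fin p → Fin p → Fin p
mulF {suc n} a b = fromℕ< (m%n<n (toℕ a * toℕ b) (suc n))

subF : ∀ {p} → Fin p → Fin p → Fin p
subF {suc n} a b = fromℕ< (m%n<n (toℕ a + (suc n ∸ toℕ b)) (suc n))

NonZeroF : ∀ {p} → Fin p → Set
NonZeroF x = toℕ x ≢ 0

IsOne : ∀ {p} → Fin p → Set
IsOne x = toℕ x ≡ 1

InUnits : ∀ {p} → Subset p → Set
InUnits {p} S = (x : Fin p) → x ∈ S → NonZeroF x

IsMulSubgroup : ∀ {p} → Subset p → Set
IsMulSubgroup {p} G =
  InUnits G
  × (∃ λ e → e ∈ G × IsOne e)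
  × ((g h : Fin p) → g ∈ G → h ∈ G → mulF g h ∈ G)
  × ((g : Fin p) → g ∈ G → ∃ λ h → h ∈ G × IsOne (mulF g h))

IsProperInUnits : ∀ {p} → Subset p → Set
IsProperInUnits {p} G = ∃ λ (x : Fin p) → NonZeroF x × x ∉ G

InProd3 : ∀ {p} → Subset p → Subset p → Subset p → Fin p → Set
InProd3 {p} A B C x =
  ∃ λ (a : Fin p) → ∃ λ (b : Fin p) → ∃ λ (c : Fin p) →
    a ∈ A × b ∈ B × c ∈ C × x ≡ mulF (mulF a b) c

InShiftNZ : ∀ {p} → Subset p → Fin p → Fin p → Set
InShiftNZ {p} G l x = (∃ λ (g : Fin p) → g ∈ G × x ≡ subF g l) × NonZeroF x

ProdEqShift : ∀ {p} → Subset p → Subset p → Subset p → Subset p → Fin p → Set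
ProdEqShift {p} A B C G l = (x : Fin p) → InProd3 A B C x ⇔ InShiftNZ G l x

{-# OPTIONS --safe #-}

-- Let N = |G| and p − 1 = d N, and let X Y = (G − λ) \ {0} with |X| = k.  After scaling X by 1/λ,
-- every y in Y satisfies (1 + a y)^N = η := λ^(−N) for all k nodes a in X; if λ lies in G, so does
-- y = 0.  This gives n points with n k ≥ N.  The polynomial f = Σ c_i (1 + a_i X)^(N+k−1) − η of
-- Stepanov's method (Hanson–Petridis) vanishes to order k at these points, so n k ≤ N + k − 1 and f
-- is nearly a k-th power: f = P^k q with P = ∏ (X − y) and deg q < k.  Comparing the Taylor
-- coefficients of f of orders k, k + 1, k + 2 at the points with those of P^k q gives two differential
-- relations for P.  Eliminating P leaves a polynomial relation of degree O(k) between q and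
-- E = ∏ (1 + a_i X) which holds at n points, hence identically once n is large compared with k.  At a
-- root of E which is not a root of q it reads (k − 1)((3k + 2) N + 2k² − k − 2) = 0 in 𝔽_p, which is
-- impossible for k² = O(N) unless k = d = 2; in that case f is evaluated at the poles −1/a.
--
-- Hence |A|, |B|, |C| are all of order at least √N, and the bound n k ≤ N + k − 1 makes |AB|, |BC| and
-- |AC| of order at most √N.  This contradicts |ABC|² ≤ |AB| |BC| |AC|.

module Submission where

open import Defs
open import Level using (0ℓ)
open import Algebra.Bundles using (CommutativeRing)
open import Algebra.Structures using (IsCommutativeRing)
open import Algebra.Solver.Ring.AlmostCommutativeRing
  using (fromCommutativeRing; _-Raw-AlmostCommutative⟶_)
import Algebra.Solver.Ring
import Algebra.Properties.Ring
import Algebra.Properties.AbelianGroup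
open import Data.Nat using (ℕ; _<_; _≤_)
open import Data.Nat.Base as ℕ using (zero; suc; z≤n; s≤s; _∸_; _%_; _/_)
import Data.Nat.Properties as ℕₚ
open import Data.Nat.Coprimality using (prime⇒coprime; coprime-Bézout)
open import Data.Nat.DivMod
  using (m%n<n; m%n≤m; n%n≡0; m<n⇒m%n≡m; m≡m%n+[m/n]*n; [m+kn]%n≡m%n; %-distribˡ-+; %-distribˡ-*)
open import Data.Nat.GCD using (module Bézout)
open import Data.Nat.Primality using (Prime; prime⇒nonTrivial; ¬prime[0])
open import Data.Nat.Solver using (module +-*-Solver)
open import Data.Integer.Base as ℤ using (ℤ; -[1+_]) renaming (+_ to pos)
import Data.Integer.Properties as ℤₚ
open import Data.Maybe.Base using (Maybe; just; nothing)
open import Data.Product using (∃; _×_)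
open import Data.Product.Base using (_,_; proj₁; proj₂)
open import Data.Sum.Base using (_⊎_; inj₁; inj₂)
open import Data.Empty using (⊥; ⊥-elim)
open import Data.List.Base
  using (List; []; _∷_; _++_; [_]; length; map; filter; deduplicate; cartesianProduct; cartesianProductWith; allFin)
open import Data.List.Properties using (length-++; length-map; length-tabulate)
import Data.List.Extrema
open import Data.List.Membership.Propositional using (_∈_; _∉_; find)
import Data.List.Membership.DecPropositional as DecMembership
open import Data.List.Membership.Propositional.Properties
  using ( ∈-∃++; ∈-++⁻; ∈-++⁺ˡ; ∈-++⁺ʳ; ∈-map⁺; ∈-map⁻; ∈-filter⁺; ∈-filter⁻; ∈-deduplicate⁺; ∈-deduplicate⁻
        ; ∈-cartesianProduct⁺; ∈-cartesianProduct⁻; ∈-cartesianProductWith⁺; ∈-cartesianProductWith⁻; ∈-allFin)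
open import Data.List.Relation.Binary.Permutation.Propositional using (_↭_; ↭-refl; ↭-sym; ↭-trans; prep; swap)
open import Data.List.Relation.Binary.Permutation.Propositional.Properties using (shift)
open import Data.List.Relation.Unary.Any using (here; there)
open import Data.List.Relation.Unary.All as All using (All; []; _∷_)
open import Data.List.Relation.Unary.All.Properties using (¬All⇒Any¬; ¬Any⇒All¬) renaming (map⁺ to All-map⁺)
open import Data.List.Relation.Unary.AllPairs using ([]; _∷_)
open import Data.List.Relation.Unary.Unique.Propositional using (Unique)
import Data.List.Relation.Unary.Unique.Propositional.Properties as Uniqueₚ
import Data.List.Relation.Unary.Unique.DecPropositional.Properties
open import Function.Bundles using (Equivalence)
open import Relation.Nullary using (¬_; Dec; yes; no; ¬?)
open import Relation.Unary using (Decidable)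
open import Relation.Binary.Definitions using (DecidableEquality)
open import Relation.Binary.PropositionalEquality as ≡ using (_≡_; _≢_; module ≡-Reasoning)
import Relation.Binary.Reasoning.Setoid

-- The degree bound alone gives no contradiction: n k lies between N and N + k - 1, and q absorbs
-- the slack. The two relations at a root of P prescribe P′′/P′ and P′′′/P′, each in terms of q.
-- They are compared through divisibility: the first says that a certain polynomial W is divisible
-- by P, W = P T, and at a root of P this gives T = W′/P′, where the second relation applies. A root
-- of E is the place to evaluate the outcome because all terms but one carry a factor E.
--
-- Why k = d = 2 survives: since d N = -1 in 𝔽_p, multiplying (3k + 2) N + 2k² - k - 2 by d gives
-- the natural number d (2k² - k - 2) - (3k + 2). It is below p, and for k, d ≥ 2 it is zero only if
-- k = d = 2. That case ends in the integers 252, 220, 5 and 853, which must be nonzero in 𝔽_p.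
--
-- The binary argument excludes a factor X only when 16 |X|² ≤ N. Two factors of size about √N
-- escape it, and the third set is what closes this gap.

-- A ring solver with integer coefficients

module IntegerSolver (R : CommutativeRing 0ℓ 0ℓ) where
  open CommutativeRing R
  open Algebra.Properties.Ring ring using (-‿distribˡ-*; -‿distribʳ-*; -0#≈0#)
  open Algebra.Properties.AbelianGroup +-abelianGroup using (⁻¹-involutive; ⁻¹-∙-comm)
  open import Relation.Binary.Reasoning.Setoid setoid

  -- The separate clause for one avoids `1# + 0#`: the integer one of the solver is then `1#`
  -- definitionally, and solver calls on goals containing `1#` close with `refl`.
  ι : ℕ → Carrier
  ι zero          = 0#
  ι (suc zero)    = 1#
  ι (suc (suc n)) = 1# + ι (suc n)

  ι-suc : ∀ n → ι (suc n) ≈ 1# + ι n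
  ι-suc zero    = sym (+-identityʳ 1#)
  ι-suc (suc n) = refl

  ι-+ : ∀ m n → ι (m ℕ.+ n) ≈ ι m + ι n
  ι-+ zero    n = sym (+-identityˡ (ι n))
  ι-+ (suc m) n = begin
    ι (suc (m ℕ.+ n))   ≈⟨ ι-suc (m ℕ.+ n) ⟩
    1# + ι (m ℕ.+ n)    ≈⟨ +-congˡ (ι-+ m n) ⟩
    1# + (ι m + ι n)    ≈⟨ +-assoc 1# (ι m) (ι n) ⟨
    1# + ι m + ι n      ≈⟨ +-congʳ (ι-suc m) ⟨
    ι (suc m) + ι n     ∎

  ι-* : ∀ m n → ι (m ℕ.* n) ≈ ι m * ι n
  ι-* zero    n = sym (zeroˡ (ι n))
  ι-* (suc m) n = begin
    ι (n ℕ.+ m ℕ.* n)     ≈⟨ ι-+ n (m ℕ.* n) ⟩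
    ι n + ι (m ℕ.* n)     ≈⟨ +-cong (sym (*-identityˡ (ι n))) (ι-* m n) ⟩
    1# * ι n + ι m * ι n  ≈⟨ distribʳ (ι n) 1# (ι m) ⟨
    (1# + ι m) * ι n      ≈⟨ *-congʳ (ι-suc m) ⟨
    ι (suc m) * ι n       ∎

  ⟦_⟧ᶻ : ℤ → Carrier
  ⟦ pos n ⟧ᶻ      = ι n
  ⟦ -[1+ n ] ⟧ᶻ = - ι (suc n)

  private
    cancel : ∀ x y z → (x + y) + - (x + z) ≈ y + - z
    cancel x y z = begin
      (x + y) + - (x + z)       ≈⟨ +-cong (+-comm x y) (sym (⁻¹-∙-comm x z)) ⟩
      (y + x) + (- x + - z)     ≈⟨ +-assoc y x _ ⟩
      y + (x + (- x + - z))     ≈⟨ +-congˡ (+-assoc x (- x) (- z)) ⟨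
      y + ((x + - x) + - z)     ≈⟨ +-congˡ (+-congʳ (-‿inverseʳ x)) ⟩
      y + (0# + - z)            ≈⟨ +-congˡ (+-identityˡ (- z)) ⟩
      y + - z                   ∎

    neg-homo : ∀ i → ⟦ ℤ.- i ⟧ᶻ ≈ - ⟦ i ⟧ᶻ
    neg-homo (pos zero)  = sym -0#≈0#
    neg-homo (pos (suc n)) = refl
    neg-homo -[1+ n ]  = sym (⁻¹-involutive (ι (suc n)))

    ⊖-homo : ∀ m n → ⟦ m ℤ.⊖ n ⟧ᶻ ≈ ι m + - ι n
    ⊖-homo m zero = sym (trans (+-congˡ -0#≈0#) (+-identityʳ (ι m)))
    ⊖-homo zero (suc n) = sym (+-identityˡ _)
    ⊖-homo (suc m) (suc n) = begin
      ⟦ suc m ℤ.⊖ suc n ⟧ᶻ       ≡⟨ ≡.cong ⟦_⟧ᶻ (ℤₚ.[1+m]⊖[1+n]≡m⊖n m n) ⟩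
      ⟦ m ℤ.⊖ n ⟧ᶻ               ≈⟨ ⊖-homo m n ⟩
      ι m + - ι n                ≈⟨ cancel 1# (ι m) (ι n) ⟨
      (1# + ι m) + - (1# + ι n)  ≈⟨ +-cong (sym (ι-suc m)) (-‿cong (sym (ι-suc n))) ⟩
      ι (suc m) + - ι (suc n)    ∎

    +-homoᶻ : ∀ i j → ⟦ i ℤ.+ j ⟧ᶻ ≈ ⟦ i ⟧ᶻ + ⟦ j ⟧ᶻ
    +-homoᶻ (pos m)    (pos n)    = ι-+ m n
    +-homoᶻ (pos m)    -[1+ n ] = ⊖-homo m (suc n)
    +-homoᶻ -[1+ m ] (pos n)    = trans (⊖-homo n (suc m)) (+-comm _ _)
    +-homoᶻ -[1+ m ] -[1+ n ] = begin
      - ι (suc (suc (m ℕ.+ n)))     ≡⟨ ≡.cong (λ k → - ι (suc k)) (≡.sym (ℕₚ-+-suc m n)) ⟩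
      - ι (suc m ℕ.+ suc n)         ≈⟨ -‿cong (ι-+ (suc m) (suc n)) ⟩
      - (ι (suc m) + ι (suc n))     ≈⟨ ⁻¹-∙-comm _ _ ⟨
      - ι (suc m) + - ι (suc n)     ∎
      where
      open import Data.Nat.Properties using () renaming (+-suc to ℕₚ-+-suc)

    *-neg : ∀ i n → ⟦ i ℤ.* -[1+ n ] ⟧ᶻ ≈ - ⟦ i ℤ.* pos (suc n) ⟧ᶻ
    *-neg i n = trans (reflexive (≡.cong ⟦_⟧ᶻ (≡.sym (ℤₚ.neg-distribʳ-* i (pos (suc n))))))
                      (neg-homo (i ℤ.* pos (suc n)))

    *-pos : ∀ i n → ⟦ i ℤ.* pos n ⟧ᶻ ≈ ⟦ i ⟧ᶻ * ι n
    *-pos (pos m) n = trans (reflexive (≡.cong ⟦_⟧ᶻ (≡.sym (ℤₚ.pos-* m n)))) (ι-* m n)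
    *-pos -[1+ m ] n = begin
      ⟦ -[1+ m ] ℤ.* pos n ⟧ᶻ        ≡⟨ ≡.cong ⟦_⟧ᶻ (≡.sym (ℤₚ.neg-distribˡ-* (pos (suc m)) (pos n))) ⟩
      ⟦ ℤ.- (pos (suc m) ℤ.* pos n) ⟧ᶻ   ≈⟨ neg-homo (pos (suc m) ℤ.* pos n) ⟩
      - ⟦ pos (suc m) ℤ.* pos n ⟧ᶻ       ≡⟨ ≡.cong (λ z → - ⟦ z ⟧ᶻ) (≡.sym (ℤₚ.pos-* (suc m) n)) ⟩
      - ι (suc m ℕ.* n)            ≈⟨ -‿cong (ι-* (suc m) n) ⟩
      - (ι (suc m) * ι n)          ≈⟨ -‿distribˡ-* _ _ ⟩
      - ι (suc m) * ι n            ∎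

    *-homoᶻ : ∀ i j → ⟦ i ℤ.* j ⟧ᶻ ≈ ⟦ i ⟧ᶻ * ⟦ j ⟧ᶻ
    *-homoᶻ i (pos n)    = *-pos i n
    *-homoᶻ i -[1+ n ] = begin
      ⟦ i ℤ.* -[1+ n ] ⟧ᶻ      ≈⟨ *-neg i n ⟩
      - ⟦ i ℤ.* pos (suc n) ⟧ᶻ     ≈⟨ -‿cong (*-pos i (suc n)) ⟩
      - (⟦ i ⟧ᶻ * ι (suc n))   ≈⟨ -‿distribʳ-* _ _ ⟩
      ⟦ i ⟧ᶻ * - ι (suc n)     ∎

    morphism : ℤ.+-*-rawRing -Raw-AlmostCommutative⟶ fromCommutativeRing R
    morphism = record
      { ⟦_⟧ = ⟦_⟧ᶻ ; +-homo = +-homoᶻ ; *-homo = *-homoᶻ ; -‿homo = neg-homo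
      ; 0-homo = refl ; 1-homo = refl }

    dec : ∀ i j → Maybe (⟦ i ⟧ᶻ ≈ ⟦ j ⟧ᶻ)
    dec i j with i ℤₚ.≟ j
    ... | yes ≡.refl = just refl
    ... | no _       = nothing

  open Algebra.Solver.Ring ℤ.+-*-rawRing (fromCommutativeRing R) morphism dec public
    using (solve; _:=_; con; _:+_; _:*_; _:-_; :-_; Polynomial)

-- Ring identities behind Horner forms

module HornerIdentities (R : CommutativeRing 0ℓ 0ℓ) where
  open CommutativeRing R
  open IntegerSolver R

  horner-0 : ∀ c x → c + x * 0# ≈ c
  horner-0 = solve 2 (λ c x → c :+ x :* con (pos 0) := c) refl

  0-horner : ∀ c x → x * 0# + c ≈ c
  0-horner = solve 2 (λ c x → x :* con (pos 0) :+ c := c) refl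

  horner-+ : ∀ c d x f g → (c + x * f) + (d + x * g) ≈ (c + d) + x * (f + g)
  horner-+ = solve 5 (λ c d x f g → (c :+ x :* f) :+ (d :+ x :* g) := (c :+ d) :+ x :* (f :+ g)) refl

  horner-scale : ∀ c d x g → c * (d + x * g) ≈ c * d + x * (c * g)
  horner-scale = solve 4 (λ c d x g → c :* (d :+ x :* g) := c :* d :+ x :* (c :* g)) refl

  horner-* : ∀ c x f g → (c + x * f) * g ≈ c * g + x * (f * g)
  horner-* = solve 4 (λ c x f g → (c :+ x :* f) :* g := c :* g :+ x :* (f :* g)) refl

  horner-÷ : ∀ c x h γ d → c + x * ((x + - d) * h + γ) ≈ (x + - d) * (x * h + γ) + (c + d * γ)
  horner-÷ = solve 5 (λ c x h γ d → c :+ x :* ((x :- d) :* h :+ γ)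
                        := (x :- d) :* (x :* h :+ γ) :+ (c :+ d :* γ)) refl

  *-distribʳ-- : ∀ x d f → (x + - d) * f ≈ x * f + - (d * f)
  *-distribʳ-- = solve 3 (λ x d f → (x :- d) :* f := x :* f :- d :* f) refl

  *-interchange : ∀ f g u v → (f * g) * (u * v) ≈ (f * u) * (g * v)
  *-interchange = solve 4 (λ f g u v → (f :* g) :* (u :* v) := (f :* u) :* (g :* v)) refl

  scale-step : ∀ c u v x U V → c * ((u + x * U) + - (v + x * V)) ≈ c * (u + - v) + x * (c * (U + - V))
  scale-step = solve 6 (λ c u v x U V → c :* ((u :+ x :* U) :- (v :+ x :* V))
                          := c :* (u :- v) :+ x :* (c :* (U :- V))) refl

  leibniz-step : ∀ n f x g → n * f + ((f + x * g) + x * (n * g)) ≈ (1# + n) * (f + x * g)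
  leibniz-step = solve 4 (λ n f x g → n :* f :+ ((f :+ x :* g) :+ x :* (n :* g))
                            := (con (pos 1) :+ n) :* (f :+ x :* g)) refl

  scale-swap : ∀ a n u v → a * (n * u + - (n * v)) ≈ n * (a * (u + - v))
  scale-swap = solve 4 (λ a n u v → a :* (n :* u :- n :* v) := n :* (a :* (u :- v))) refl

record Field : Set₁ where
  infix  8 -_
  infixl 7 _*_
  infixl 6 _+_
  field
    Carrier : Set
    _+_ _*_ : Carrier → Carrier → Carrier
    -_      : Carrier → Carrier
    0# 1#   : Carrier
    _⁻¹     : Carrier → Carrier
    isCommutativeRing : IsCommutativeRing _≡_ _+_ _*_ -_ 0# 1#
    *-inverseʳ : ∀ x → x ≢ 0# → x * x ⁻¹ ≡ 1#
    1≢0        : 1# ≢ 0#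
    _≟_        : DecidableEquality Carrier

  commutativeRing : CommutativeRing 0ℓ 0ℓ
  commutativeRing = record { isCommutativeRing = isCommutativeRing }

open ≡ using (refl; sym; trans; cong; cong₂; subst; subst₂; isEquivalence)

-- Counting with lists without repetitions

module _ {A : Set} where

  private
    ∈-delete : ∀ {x y : A} ys zs → x ≢ y → y ∈ ys ++ [ x ] ++ zs → y ∈ ys ++ zs
    ∈-delete ys zs x≢y y∈ with ∈-++⁻ ys y∈
    ... | inj₁ y∈ys             = ∈-++⁺ˡ y∈ys
    ... | inj₂ (here refl)      = ⊥-elim (x≢y refl)
    ... | inj₂ (there y∈zs)     = ∈-++⁺ʳ ys y∈zs

    length-insert : ∀ (x : A) ys zs → length (ys ++ [ x ] ++ zs) ≡ suc (length (ys ++ zs))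
    length-insert x []       zs = refl
    length-insert x (_ ∷ ys) zs = cong suc (length-insert x ys zs)

  length-⊆ : ∀ {xs ys : List A} → Unique xs → (∀ {x} → x ∈ xs → x ∈ ys) → length xs ≤ length ys
  length-⊆ {[]}     []       _  = z≤n
  length-⊆ {x ∷ xs} (x∉ ∷ u) ⊆ys with ∈-∃++ (⊆ys (here refl))
  ... | as , bs , refl = subst (suc (length xs) ≤_) (sym (length-insert x as bs))
    (s≤s (length-⊆ u (λ y∈ → ∈-delete as bs (All.lookup x∉ y∈) (⊆ys (there y∈)))))

  ⊆⇒↭ : ∀ {xs ys : List A} → Unique xs → (∀ {x} → x ∈ xs → x ∈ ys) → length ys ≤ length xs → xs ↭ ys
  ⊆⇒↭ {[]} {[]} _ _ _ = ↭-refl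
  ⊆⇒↭ {x ∷ xs} (x∉ ∷ u) ⊆ys l≤ with ∈-∃++ (⊆ys (here refl))
  ... | as , bs , refl = ↭-trans
    (prep x (⊆⇒↭ u (λ y∈ → ∈-delete as bs (All.lookup x∉ y∈) (⊆ys (there y∈)))
      (ℕₚ.≤-pred (subst (_≤ suc (length xs)) (length-insert x as bs) l≤))))
    (↭-sym (shift x as bs))

map-unique : ∀ {A B : Set} {f : A → B} {xs} → (∀ {x y} → x ∈ xs → y ∈ xs → f x ≡ f y → x ≡ y) → Unique xs → Unique (map f xs)
map-unique inj []       = []
map-unique inj (x∉ ∷ u) =
  All-map⁺ (All.tabulate (λ y∈ eq → All.lookup x∉ y∈ (inj (here refl) (there y∈) eq)))
  ∷ map-unique (λ x∈ y∈ → inj (there x∈) (there y∈)) u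

length-cartesianProductWith : ∀ {A B C : Set} (f : A → B → C) xs ys →
  length (cartesianProductWith f xs ys) ≡ length xs ℕ.* length ys
length-cartesianProductWith f []       ys = refl
length-cartesianProductWith f (x ∷ xs) ys = trans (length-++ (map (f x) ys))
  (cong₂ ℕ._+_ (length-map (f x) ys) (length-cartesianProductWith f xs ys))

length-filter-¬ : ∀ {A : Set} {P : A → Set} (P? : Decidable P) xs →
  length xs ≡ length (filter P? xs) ℕ.+ length (filter (λ x → ¬? (P? x)) xs)
length-filter-¬ P? [] = refl
length-filter-¬ P? (x ∷ xs) with P? x
... | yes _ = cong suc (length-filter-¬ P? xs)
... | no _  = trans (cong suc (length-filter-¬ P? xs)) (sym (ℕₚ.+-suc _ _))

-- Collisions and product sets

module Collisions {A B : Set} (_≟_ : DecidableEquality B) (key : A → B) where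

  same : Decidable (λ v → key (proj₁ v) ≡ key (proj₂ v))
  same v = key (proj₁ v) ≟ key (proj₂ v)

  collisions : List A → List (A × A)
  collisions xs = filter same (cartesianProduct xs xs)

  private
    am-gm : ∀ θ f → 2 ℕ.* θ ℕ.* f ≤ f ℕ.* f ℕ.+ θ ℕ.* θ
    am-gm θ f with ℕₚ.≤-total θ f
    ... | inj₁ θ≤f = go (ℕₚ.m≤n⇒∃[o]m+o≡n θ≤f)
      where
      go : ∃ (λ o → θ ℕ.+ o ≡ f) → 2 ℕ.* θ ℕ.* f ≤ f ℕ.* f ℕ.+ θ ℕ.* θ
      go (o , refl) = subst (2 ℕ.* θ ℕ.* (θ ℕ.+ o) ≤_)
        (solve 2 (λ θ o → con 2 :* θ :* (θ :+ o) :+ o :* o := (θ :+ o) :* (θ :+ o) :+ θ :* θ) refl θ o)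
        (ℕₚ.m≤m+n _ (o ℕ.* o))
        where open +-*-Solver
    ... | inj₂ f≤θ = go (ℕₚ.m≤n⇒∃[o]m+o≡n f≤θ)
      where
      go : ∃ (λ o → f ℕ.+ o ≡ θ) → 2 ℕ.* θ ℕ.* f ≤ f ℕ.* f ℕ.+ θ ℕ.* θ
      go (o , refl) = subst (2 ℕ.* (f ℕ.+ o) ℕ.* f ≤_)
        (solve 2 (λ f o → con 2 :* (f :+ o) :* f :+ o :* o := f :* f :+ (f :+ o) :* (f :+ o)) refl f o)
        (ℕₚ.m≤m+n _ (o ℕ.* o))
        where open +-*-Solver

  -- A fibre of `key` with f elements contributes f² collisions, and 2θf ≤ f² + θ². Summing over the
  -- values in `us` gives the Cauchy-Schwarz inequality with a free parameter θ in place of a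
  -- quotient.
  collisions-≥ : ∀ θ us xs → Unique xs → (∀ {x} → x ∈ xs → key x ∈ us) →
                 2 ℕ.* θ ℕ.* length xs ≤ length (collisions xs) ℕ.+ θ ℕ.* θ ℕ.* length us
  collisions-≥ θ [] []       _ _ = subst (_≤ θ ℕ.* θ ℕ.* 0) (sym (ℕₚ.*-zeroʳ (2 ℕ.* θ))) z≤n
  collisions-≥ θ [] (x ∷ xs) _ k∈ with k∈ (here refl)
  ... | ()
  collisions-≥ θ (u ∷ us) xs unique k∈ = begin
    2 ℕ.* θ ℕ.* length xs                          ≡⟨ cong (2 ℕ.* θ ℕ.*_) (length-filter-¬ is-u xs) ⟩
    2 ℕ.* θ ℕ.* (length ys ℕ.+ length zs)          ≡⟨ ℕₚ.*-distribˡ-+ (2 ℕ.* θ) (length ys) (length zs) ⟩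
    2 ℕ.* θ ℕ.* length ys ℕ.+ 2 ℕ.* θ ℕ.* length zs ≤⟨ ℕₚ.+-mono-≤ (am-gm θ (length ys)) (collisions-≥ θ us zs zs-unique zs-keys) ⟩
    (length ys ℕ.* length ys ℕ.+ θ ℕ.* θ) ℕ.+ (length (collisions zs) ℕ.+ θ ℕ.* θ ℕ.* length us)
      ≡⟨ solve 4 (λ y t c u → (y :+ t) :+ (c :+ t :* u) := (y :+ c) :+ t :* (con 1 :+ u)) refl
           (length ys ℕ.* length ys) (θ ℕ.* θ) (length (collisions zs)) (length us) ⟩
    (length ys ℕ.* length ys ℕ.+ length (collisions zs)) ℕ.+ θ ℕ.* θ ℕ.* suc (length us)
      ≡⟨ cong (λ l → l ℕ.+ length (collisions zs) ℕ.+ θ ℕ.* θ ℕ.* suc (length us)) (length-cartesianProductWith _,_ ys ys) ⟨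
    (length (cartesianProduct ys ys) ℕ.+ length (collisions zs)) ℕ.+ θ ℕ.* θ ℕ.* suc (length us)
      ≡⟨ cong (ℕ._+ θ ℕ.* θ ℕ.* suc (length us)) (length-++ (cartesianProduct ys ys)) ⟨
    length (cartesianProduct ys ys ++ collisions zs) ℕ.+ θ ℕ.* θ ℕ.* suc (length us)
      ≤⟨ ℕₚ.+-monoˡ-≤ _ (length-⊆ both-unique both-⊆) ⟩
    length (collisions xs) ℕ.+ θ ℕ.* θ ℕ.* suc (length us) ∎
    where
    open +-*-Solver
    open ℕₚ.≤-Reasoning
    is-u : Decidable (λ x → key x ≡ u)
    is-u x = key x ≟ u
    not-u : Decidable (λ x → ¬ key x ≡ u)
    not-u x = ¬? (is-u x)
    ys zs : List A
    ys = filter is-u xs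
    zs = filter not-u xs
    zs-unique : Unique zs
    zs-unique = Uniqueₚ.filter⁺ not-u unique
    zs-keys : ∀ {x} → x ∈ zs → key x ∈ us
    zs-keys x∈ with k∈ (proj₁ (∈-filter⁻ not-u x∈))
    ... | here eq   = ⊥-elim (proj₂ (∈-filter⁻ not-u {xs = xs} x∈) eq)
    ... | there key∈ = key∈
    both-unique : Unique (cartesianProduct ys ys ++ collisions zs)
    both-unique = Uniqueₚ.++⁺ (Uniqueₚ.cartesianProduct⁺ (Uniqueₚ.filter⁺ is-u unique) (Uniqueₚ.filter⁺ is-u unique))
      (Uniqueₚ.filter⁺ same (Uniqueₚ.cartesianProduct⁺ zs-unique zs-unique))
      (λ { {x , y} (p , q) → proj₂ (∈-filter⁻ not-u {xs = xs} (proj₁ (∈-cartesianProduct⁻ zs zs (proj₁ (∈-filter⁻ same {xs = cartesianProduct zs zs} q)))))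
                      (proj₂ (∈-filter⁻ is-u {xs = xs} (proj₁ (∈-cartesianProduct⁻ ys ys p)))) })
    both-⊆ : ∀ {v} → v ∈ cartesianProduct ys ys ++ collisions zs → v ∈ collisions xs
    both-⊆ {x , y} v∈ with ∈-++⁻ (cartesianProduct ys ys) v∈
    ... | inj₁ p = let x∈ , y∈ = ∈-cartesianProduct⁻ ys ys p
                       x∈xs , kx = ∈-filter⁻ is-u {xs = xs} x∈
                       y∈xs , ky = ∈-filter⁻ is-u {xs = xs} y∈
                   in ∈-filter⁺ same (∈-cartesianProduct⁺ x∈xs y∈xs) (trans kx (sym ky))
    ... | inj₂ q = let p , eq = ∈-filter⁻ same {xs = cartesianProduct zs zs} q
                       x∈ , y∈ = ∈-cartesianProduct⁻ zs zs p
                   in ∈-filter⁺ same (∈-cartesianProduct⁺ (proj₁ (∈-filter⁻ not-u {xs = xs} x∈)) (proj₁ (∈-filter⁻ not-u {xs = xs} y∈))) eq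

digits-injective : ∀ q u v u′ v′ → v < q → v′ < q → u ℕ.* q ℕ.+ v ≡ u′ ℕ.* q ℕ.+ v′ → u ≡ u′ × v ≡ v′
digits-injective zero u v u′ v′ () _ _
digits-injective q@(suc _) u v u′ v′ v<q v′<q eq = u≡u′ , v≡v′
  where
  remainder : ∀ u v → v < q → (u ℕ.* q ℕ.+ v) % q ≡ v
  remainder u v v<q = trans (cong (_% q) (ℕₚ.+-comm (u ℕ.* q) v)) (trans ([m+kn]%n≡m%n v u q) (m<n⇒m%n≡m v<q))
  v≡v′ : v ≡ v′
  v≡v′ = trans (sym (remainder u v v<q)) (trans (cong (_% q) eq) (remainder u′ v′ v′<q))
  u≡u′ : u ≡ u′
  u≡u′ = ℕₚ.*-cancelʳ-≡ u u′ q (ℕₚ.+-cancelʳ-≡ v (u ℕ.* q) (u′ ℕ.* q) (trans eq (cong (u′ ℕ.* q ℕ.+_) (sym v≡v′))))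

-- The product set of three sets is bounded by the pairwise product sets (a Loomis–Whitney
-- inequality).  Representing each product by its triple of least weight makes the
-- representation of each pairwise product unique.
module ProductSets {A : Set} (_≟_ : DecidableEquality A) (_·_ : A → A → A)
  (assoc : ∀ x y z → (x · y) · z ≡ x · (y · z)) (comm : ∀ x y → x · y ≡ y · x)
  (p : ℕ) (code : A → ℕ) (code<p : ∀ x → code x < p) (code-injective : ∀ {x y} → code x ≡ code y → x ≡ y) where

  private
    Triple : Set
    Triple = A × A × A

    prod : Triple → A
    prod (a , b , c) = (a · b) · c

    -- The lexicographic order of the codes, written additively: when two entries are replaced and
    -- the third is kept, its term cancels and minimality compares the two entries alone.
    weight : Triple → ℕ
    weight (a , b , c) = code a ℕ.* (p ℕ.* p) ℕ.+ (code b ℕ.* p ℕ.+ code c)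

    0<p : A → 0 < p
    0<p x = ℕₚ.≤-<-trans z≤n (code<p x)

    code<p² : ∀ x → code x < p ℕ.* p
    code<p² x = ℕₚ.<-≤-trans (code<p x) (subst (_≤ p ℕ.* p) (ℕₚ.*-identityʳ p) (ℕₚ.*-monoʳ-≤ p (0<p x)))

    open Data.List.Extrema ℕₚ.≤-totalOrder using (argmin; argmin-sel; f[argmin]≤f[xs]; f[argmin]≤f[⊤])

  module _ (as bs cs : List A) where

    private
      triples : List Triple
      triples = cartesianProduct as (cartesianProduct bs cs)

      lightest : A → List Triple → Triple
      lightest x []       = x , x , x
      lightest x (t ∷ ts) = argmin weight t ts

      lightest-∈ : ∀ x {t} ts → t ∈ ts → lightest x ts ∈ ts
      lightest-∈ x (t ∷ ts) _ with argmin-sel weight t ts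
      ... | inj₁ eq = here eq
      ... | inj₂ ∈ts = there ∈ts

      lightest-≤ : ∀ x {t} ts → t ∈ ts → weight (lightest x ts) ≤ weight t
      lightest-≤ x (t ∷ ts) (here refl) = f[argmin]≤f[⊤] {f = weight} t ts
      lightest-≤ x (t ∷ ts) (there t∈)  = All.lookup (f[argmin]≤f[xs] {f = weight} t ts) t∈

      representatives : A → List Triple
      representatives x = filter (λ t → prod t ≟ x) triples

      rep : A → Triple
      rep x = lightest x (representatives x)

      α β γ : A → A
      α x = proj₁ (rep x)
      β x = proj₁ (proj₂ (rep x))
      γ x = proj₂ (proj₂ (rep x))

      Factored : A → Set
      Factored x = ∃ λ t → t ∈ triples × prod t ≡ x

      rep-∈ : ∀ {x} → Factored x → rep x ∈ triples × prod (rep x) ≡ x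
      rep-∈ {x} (t , t∈ , eq) = ∈-filter⁻ (λ t → prod t ≟ x) {xs = triples}
        (lightest-∈ x (representatives x) (∈-filter⁺ (λ t → prod t ≟ x) t∈ eq))

      rep-≤ : ∀ {x} → Factored x → ∀ {a b c} → a ∈ as → b ∈ bs → c ∈ cs → (a · b) · c ≡ x → weight (rep x) ≤ weight (a , b , c)
      rep-≤ {x} _ a∈ b∈ c∈ eq = lightest-≤ x (representatives x)
        (∈-filter⁺ (λ t → prod t ≟ x) (∈-cartesianProduct⁺ a∈ (∈-cartesianProduct⁺ b∈ c∈)) eq)

      α∈ : ∀ {x} → Factored x → α x ∈ as
      α∈ F = proj₁ (∈-cartesianProduct⁻ as (cartesianProduct bs cs) (proj₁ (rep-∈ F)))
      β∈ : ∀ {x} → Factored x → β x ∈ bs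
      β∈ F = proj₁ (∈-cartesianProduct⁻ bs cs (proj₂ (∈-cartesianProduct⁻ as (cartesianProduct bs cs) (proj₁ (rep-∈ F)))))
      γ∈ : ∀ {x} → Factored x → γ x ∈ cs
      γ∈ F = proj₂ (∈-cartesianProduct⁻ bs cs (proj₂ (∈-cartesianProduct⁻ as (cartesianProduct bs cs) (proj₁ (rep-∈ F)))))

      αβγ : ∀ {x} → Factored x → (α x · β x) · γ x ≡ x
      αβγ F = proj₂ (rep-∈ F)

      swap₂₃ : ∀ x y z → (x · y) · z ≡ (x · z) · y
      swap₂₃ x y z = trans (assoc x y z) (trans (cong (x ·_) (comm y z)) (sym (assoc x z y)))

      -- The triple `α y , β y , γ x` is another representation of x, so the least weight of `rep x`
      -- applies. Exchanging x and y makes this an equality, from which `αβ-unique` reads off the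
      -- digits; the other two pairs are treated alike.
      αβ-≤ : ∀ {x y} → Factored x → Factored y → α x · β x ≡ α y · β y →
             code (α x) ℕ.* (p ℕ.* p) ℕ.+ code (β x) ℕ.* p ≤ code (α y) ℕ.* (p ℕ.* p) ℕ.+ code (β y) ℕ.* p
      αβ-≤ {x} {y} F G eq = ℕₚ.+-cancelʳ-≤ (code (γ x)) _ _ (subst₂ _≤_
        (sym (ℕₚ.+-assoc (code (α x) ℕ.* (p ℕ.* p)) (code (β x) ℕ.* p) (code (γ x))))
        (sym (ℕₚ.+-assoc (code (α y) ℕ.* (p ℕ.* p)) (code (β y) ℕ.* p) (code (γ x))))
        (rep-≤ F (α∈ G) (β∈ G) (γ∈ F) (trans (cong (_· γ x) (sym eq)) (αβγ F))))

      αγ-≤ : ∀ {x y} → Factored x → Factored y → α x · γ x ≡ α y · γ y →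
             code (α x) ℕ.* (p ℕ.* p) ℕ.+ code (γ x) ≤ code (α y) ℕ.* (p ℕ.* p) ℕ.+ code (γ y)
      αγ-≤ {x} {y} F G eq = ℕₚ.+-cancelˡ-≤ (code (β x) ℕ.* p) _ _ (subst₂ _≤_
        (left-comm (code (α x) ℕ.* (p ℕ.* p)) (code (β x) ℕ.* p) (code (γ x)))
        (left-comm (code (α y) ℕ.* (p ℕ.* p)) (code (β x) ℕ.* p) (code (γ y)))
        (rep-≤ F (α∈ G) (β∈ F) (γ∈ G) (trans (swap₂₃ _ _ _) (trans (cong (_· β x) (sym eq)) (trans (swap₂₃ _ _ _) (αβγ F))))))
        where
        left-comm : ∀ u v w → u ℕ.+ (v ℕ.+ w) ≡ v ℕ.+ (u ℕ.+ w)
        left-comm = solve 3 (λ u v w → u :+ (v :+ w) := v :+ (u :+ w)) refl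
          where open +-*-Solver

      βγ-≤ : ∀ {x y} → Factored x → Factored y → β x · γ x ≡ β y · γ y →
             code (β x) ℕ.* p ℕ.+ code (γ x) ≤ code (β y) ℕ.* p ℕ.+ code (γ y)
      βγ-≤ {x} {y} F G eq = ℕₚ.+-cancelˡ-≤ (code (α x) ℕ.* (p ℕ.* p)) _ _
        (rep-≤ F (α∈ F) (β∈ G) (γ∈ G) (trans (assoc _ _ _) (trans (cong (α x ·_) (sym eq)) (trans (sym (assoc _ _ _)) (αβγ F)))))

      αβ-unique : ∀ {x y} → Factored x → Factored y → α x · β x ≡ α y · β y → α x ≡ α y × β x ≡ β y
      αβ-unique {x} {y} F G eq =
        let e , e′ = digits-injective (p ℕ.* p) (code (α x)) (code (β x) ℕ.* p) (code (α y)) (code (β y) ℕ.* p)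
                       (ℕₚ.*-monoˡ-< p {{ℕ.>-nonZero (0<p x)}} (code<p (β x))) (ℕₚ.*-monoˡ-< p {{ℕ.>-nonZero (0<p x)}} (code<p (β y)))
                       (ℕₚ.≤-antisym (αβ-≤ F G eq) (αβ-≤ G F (sym eq)))
        in code-injective e , code-injective (ℕₚ.*-cancelʳ-≡ (code (β x)) (code (β y)) p {{ℕ.>-nonZero (0<p x)}} e′)

      αγ-unique : ∀ {x y} → Factored x → Factored y → α x · γ x ≡ α y · γ y → α x ≡ α y × γ x ≡ γ y
      αγ-unique {x} {y} F G eq =
        let e , e′ = digits-injective (p ℕ.* p) (code (α x)) (code (γ x)) (code (α y)) (code (γ y)) (code<p² (γ x)) (code<p² (γ y))
                       (ℕₚ.≤-antisym (αγ-≤ F G eq) (αγ-≤ G F (sym eq)))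
        in code-injective e , code-injective e′

      βγ-unique : ∀ {x y} → Factored x → Factored y → β x · γ x ≡ β y · γ y → β x ≡ β y × γ x ≡ γ y
      βγ-unique {x} {y} F G eq =
        let e , e′ = digits-injective p (code (β x)) (code (γ x)) (code (β y)) (code (γ y)) (code<p (γ x)) (code<p (γ y))
                       (ℕₚ.≤-antisym (βγ-≤ F G eq) (βγ-≤ G F (sym eq)))
        in code-injective e , code-injective e′

    -- A collision (x, y) of α · β is sent to (α x · γ x, β y · γ y). Uniqueness of the
    -- representations recovers α x, γ x, β y and γ y, and the collision supplies β x = β y and α y
    -- = α x. So the collisions embed in AC × BC, while `collisions-≥` counts them from below.
    triple-product-bound : ∀ θ {abs bcs acs xs : List A} →
      (∀ {a b} → a ∈ as → b ∈ bs → a · b ∈ abs) →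
      (∀ {b c} → b ∈ bs → c ∈ cs → b · c ∈ bcs) →
      (∀ {a c} → a ∈ as → c ∈ cs → a · c ∈ acs) →
      Unique xs → (∀ {x} → x ∈ xs → ∃ λ a → ∃ λ b → ∃ λ c → a ∈ as × b ∈ bs × c ∈ cs × (a · b) · c ≡ x) →
      2 ℕ.* θ ℕ.* length xs ≤ length acs ℕ.* length bcs ℕ.+ θ ℕ.* θ ℕ.* length abs
    triple-product-bound θ {abs} {bcs} {acs} {xs} ab∈ bc∈ ac∈ unique factor = ℕₚ.≤-trans
      (collisions-≥ θ abs xs unique (λ x∈ → ab∈ (α∈ (F x∈)) (β∈ (F x∈))))
      (ℕₚ.+-monoˡ-≤ (θ ℕ.* θ ℕ.* length abs) (subst₂ _≤_ (length-map φ (collisions xs)) (length-cartesianProductWith _,_ acs bcs)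
        (length-⊆ (map-unique φ-injective (Uniqueₚ.filter⁺ same (Uniqueₚ.cartesianProduct⁺ unique unique))) φ-⊆)))
      where
      open Collisions _≟_ (λ x → α x · β x)
      F : ∀ {x} → x ∈ xs → Factored x
      F x∈ = let a , b , c , a∈ , b∈ , c∈ , eq = factor x∈ in
        (a , b , c) , ∈-cartesianProduct⁺ a∈ (∈-cartesianProduct⁺ b∈ c∈) , eq
      φ : A × A → A × A
      φ (x , y) = (α x · γ x) , (β y · γ y)
      parts : ∀ {v} → v ∈ collisions xs → (proj₁ v ∈ xs × proj₂ v ∈ xs) × α (proj₁ v) · β (proj₁ v) ≡ α (proj₂ v) · β (proj₂ v)
      parts v∈ = let v∈′ , eq = ∈-filter⁻ same {xs = cartesianProduct xs xs} v∈ in ∈-cartesianProduct⁻ xs xs v∈′ , eq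
      φ-⊆ : ∀ {w} → w ∈ map φ (collisions xs) → w ∈ cartesianProduct acs bcs
      φ-⊆ w∈ with ∈-map⁻ φ w∈
      ... | (x , y) , v∈ , refl = let (x∈ , y∈) , _ = parts v∈ in
        ∈-cartesianProduct⁺ (ac∈ (α∈ (F x∈)) (γ∈ (F x∈))) (bc∈ (β∈ (F y∈)) (γ∈ (F y∈)))
      φ-injective : ∀ {v w} → v ∈ collisions xs → w ∈ collisions xs → φ v ≡ φ w → v ≡ w
      φ-injective {x , y} {x′ , y′} v∈ w∈ eq =
        let (x∈ , y∈) , xy = parts v∈
            (x′∈ , y′∈) , xy′ = parts w∈
            a≡ , c≡ = αγ-unique (F x∈) (F x′∈) (cong proj₁ eq)
            b≡ , d≡ = βγ-unique (F y∈) (F y′∈) (cong proj₂ eq)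
            ax , bx = αβ-unique (F x∈) (F y∈) xy
            ax′ , bx′ = αβ-unique (F x′∈) (F y′∈) xy′
            same-value = λ {u u′} (G : Factored u) (G′ : Factored u′) (e₁ : α u ≡ α u′) (e₂ : β u ≡ β u′) (e₃ : γ u ≡ γ u′) →
              trans (sym (αβγ G)) (trans (cong₂ _·_ (cong₂ _·_ e₁ e₂) e₃) (αβγ G′))
        in cong₂ _,_
             (same-value (F x∈) (F x′∈) a≡ (trans bx (trans b≡ (sym bx′))) c≡)
             (same-value (F y∈) (F y′∈) (trans (sym ax) (trans a≡ ax′)) b≡ d≡)

-- Numerical inequalities

module _ where
  open +-*-Solver

  -- For k = j + 2 and d = i + 2, s is 2k² - k - 2 and 8 + 3j is 3k + 2. The identity exhibits d s -
  -- (3k + 2) as a natural number whose summands all vanish only for i = j = 0.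
  multiple-of-index : ∀ i j → let s = 4 ℕ.+ 7 ℕ.* j ℕ.+ 2 ℕ.* (j ℕ.* j) in
    (2 ℕ.+ i) ℕ.* s ≡ 11 ℕ.* j ℕ.+ 4 ℕ.* (j ℕ.* j) ℕ.+ i ℕ.* s ℕ.+ (8 ℕ.+ 3 ℕ.* j)
  multiple-of-index = solve 2 (λ i j → let s = con 4 :+ con 7 :* j :+ con 2 :* (j :* j) in
    (con 2 :+ i) :* s := con 11 :* j :+ con 4 :* (j :* j) :+ i :* s :+ (con 8 :+ con 3 :* j)) refl

  numeric-bound : ∀ j → 4 ℕ.+ 7 ℕ.* j ℕ.+ 2 ℕ.* (j ℕ.* j) ≤ 16 ℕ.* ((2 ℕ.+ j) ℕ.* (2 ℕ.+ j))
  numeric-bound j = subst (4 ℕ.+ 7 ℕ.* j ℕ.+ 2 ℕ.* (j ℕ.* j) ≤_)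
    (solve 1 (λ j → (con 4 :+ con 7 :* j :+ con 2 :* (j :* j)) :+ (con 60 :+ con 57 :* j :+ con 14 :* (j :* j))
       := con 16 :* ((con 2 :+ j) :* (con 2 :+ j))) refl j)
    (ℕₚ.m≤m+n _ (60 ℕ.+ 57 ℕ.* j ℕ.+ 14 ℕ.* (j ℕ.* j)))

  -- The left side is the number of coefficients allowed to the eliminant `Z`, the right side a
  -- lower bound for the number of points when 16k² ≤ N.
  length-bound : ∀ j → let k = 2 ℕ.+ j in suc k ℕ.+ k ℕ.+ (suc k ℕ.+ k) ≤ 16 ℕ.* k
  length-bound j = let k = 2 ℕ.+ j in subst (suc k ℕ.+ k ℕ.+ (suc k ℕ.+ k) ≤_)
    (solve 1 (λ j → let k = con 2 :+ j in (con 1 :+ k :+ k :+ (con 1 :+ k :+ k)) :+ (con 12 :* j :+ con 22) := con 16 :* k) refl j)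
    (ℕₚ.m≤m+n _ (12 ℕ.* j ℕ.+ 22))

  isqrt : ∀ n → ∃ λ r → r ℕ.* r ≤ n × n < suc r ℕ.* suc r
  isqrt zero = 0 , z≤n , s≤s z≤n
  isqrt (suc n) = let r , lo , hi = isqrt n in go r lo hi (suc n ℕₚ.<? suc r ℕ.* suc r)
    where
    go : ∀ r → r ℕ.* r ≤ n → n < suc r ℕ.* suc r → Dec (suc n < suc r ℕ.* suc r) → ∃ λ r → r ℕ.* r ≤ suc n × suc n < suc r ℕ.* suc r
    go r lo hi (yes lt) = r , ℕₚ.m≤n⇒m≤1+n lo , lt
    go r lo hi (no ¬lt) = suc r , ℕₚ.≮⇒≥ ¬lt , ℕₚ.≤-<-trans hi (ℕₚ.*-mono-< (ℕₚ.n<1+n (suc r)) (ℕₚ.n<1+n (suc r)))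

  -- With R = r + 1 just above √N, the lower bound on x gives R ≤ 4x; then y > 4R would force R² ≤
  -- 4Rx < N.
  small-product : ∀ N′ r x y → let N = 3 ℕ.+ N′ in r ℕ.* r ≤ N → N < suc r ℕ.* suc r → N < 16 ℕ.* (x ℕ.* x) → y ℕ.* x ≤ N′ ℕ.+ (2 ℕ.+ x) →
                  y ≤ 4 ℕ.* suc r
  small-product N′ r x y r²≤N N<R² N<16x² yx≤ = ℕₚ.≮⇒≥ λ 4R<y → ℕₚ.<⇒≱ N<R² (begin
    suc r ℕ.* suc r                 ≤⟨ ℕₚ.*-monoʳ-≤ (suc r) R≤4x ⟩
    suc r ℕ.* (4 ℕ.* x)             ≡⟨ solve 2 (λ r x → (con 1 :+ r) :* (con 4 :* x) := con 4 :* (con 1 :+ r) :* x) refl r x ⟩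
    4 ℕ.* suc r ℕ.* x               ≤⟨ ℕₚ.+-cancelˡ-≤ x _ _ (begin
      x ℕ.+ 4 ℕ.* suc r ℕ.* x         ≤⟨ ℕₚ.*-monoˡ-≤ x 4R<y ⟩
      y ℕ.* x                         ≤⟨ yx≤ ⟩
      N′ ℕ.+ (2 ℕ.+ x)                ≡⟨ solve 2 (λ n x → n :+ (con 2 :+ x) := x :+ (con 2 :+ n)) refl N′ x ⟩
      x ℕ.+ (2 ℕ.+ N′)                ∎) ⟩
    2 ℕ.+ N′                        ≤⟨ ℕₚ.n≤1+n _ ⟩
    3 ℕ.+ N′                        ∎)
    where
    open ℕₚ.≤-Reasoning
    R≤4x : suc r ≤ 4 ℕ.* x
    R≤4x = ℕₚ.≰⇒> λ 4x≤r → ℕₚ.<⇒≱ N<16x² (ℕₚ.≤-trans (ℕₚ.≤-reflexive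
      (solve 1 (λ x → con 16 :* (x :* x) := con 4 :* x :* (con 4 :* x)) refl x)) (ℕₚ.≤-trans (ℕₚ.*-mono-≤ 4x≤r 4x≤r) r²≤N))

  -- The main term on the left is 16R² with R = r + 1. Allowing 2R² for the terms of lower order
  -- leaves 18R² = 2 (3R)², and 3R ≤ 4r turns this into 32r² ≤ 32N.
  numeric-gap : ∀ c r N → suc (c ℕ.* 4) ≤ 2 ℕ.* suc r → 33 ≤ suc r → 3 ≤ r → r ℕ.* r ≤ N →
                2 ℕ.* 16 ℕ.+ (4 ℕ.* suc r ℕ.* (4 ℕ.* suc r) ℕ.+ c ℕ.* (4 ℕ.* suc r)) < 2 ℕ.* 16 ℕ.* N
  numeric-gap c r N small 33≤R 3≤r r²≤N = begin-strict
    2 ℕ.* 16 ℕ.+ (4 ℕ.* R ℕ.* (4 ℕ.* R) ℕ.+ c ℕ.* (4 ℕ.* R))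
      <⟨ ℕₚ.n<1+n _ ⟩
    33 ℕ.+ (4 ℕ.* R ℕ.* (4 ℕ.* R) ℕ.+ c ℕ.* (4 ℕ.* R))
      ≤⟨ ℕₚ.+-monoˡ-≤ _ 33≤R ⟩
    R ℕ.+ (4 ℕ.* R ℕ.* (4 ℕ.* R) ℕ.+ c ℕ.* (4 ℕ.* R))
      ≡⟨ solve 2 (λ R c → R :+ (con 4 :* R :* (con 4 :* R) :+ c :* (con 4 :* R)) := con 16 :* (R :* R) :+ (con 1 :+ c :* con 4) :* R) refl R c ⟩
    16 ℕ.* (R ℕ.* R) ℕ.+ suc (c ℕ.* 4) ℕ.* R
      ≤⟨ ℕₚ.+-monoʳ-≤ (16 ℕ.* (R ℕ.* R)) (ℕₚ.*-monoˡ-≤ R small) ⟩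
    16 ℕ.* (R ℕ.* R) ℕ.+ 2 ℕ.* R ℕ.* R
      ≡⟨ solve 1 (λ R → con 16 :* (R :* R) :+ con 2 :* R :* R := con 2 :* ((con 3 :* R) :* (con 3 :* R))) refl R ⟩
    2 ℕ.* ((3 ℕ.* R) ℕ.* (3 ℕ.* R))
      ≤⟨ ℕₚ.*-monoʳ-≤ 2 (ℕₚ.*-mono-≤ 3R≤4r 3R≤4r) ⟩
    2 ℕ.* ((4 ℕ.* r) ℕ.* (4 ℕ.* r))
      ≡⟨ solve 1 (λ r → con 2 :* ((con 4 :* r) :* (con 4 :* r)) := con 2 :* con 16 :* (r :* r)) refl r ⟩
    2 ℕ.* 16 ℕ.* (r ℕ.* r)
      ≤⟨ ℕₚ.*-monoʳ-≤ (2 ℕ.* 16) r²≤N ⟩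
    2 ℕ.* 16 ℕ.* N ∎
    where
    open ℕₚ.≤-Reasoning
    R : ℕ
    R = suc r
    3R≤4r : 3 ℕ.* R ≤ 4 ℕ.* r
    3R≤4r = ℕₚ.≤-trans (ℕₚ.≤-reflexive (ℕₚ.*-suc 3 r)) (ℕₚ.+-monoˡ-≤ (3 ℕ.* r) 3≤r)

  product-count : ∀ θ K N M {ac bc ab} → N ≤ suc M → 2 ℕ.* θ ℕ.* M ≤ ac ℕ.* bc ℕ.+ θ ℕ.* θ ℕ.* ab →
                  ac ≤ K → bc ≤ K → ab ≤ K → 2 ℕ.* θ ℕ.+ (K ℕ.* K ℕ.+ θ ℕ.* θ ℕ.* K) < 2 ℕ.* θ ℕ.* N → ⊥
  product-count θ K N M {ac} {bc} {ab} N≤ bound ac≤ bc≤ ab≤ gap = ℕₚ.<⇒≱ gap (begin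
    2 ℕ.* θ ℕ.* N                                        ≤⟨ ℕₚ.*-monoʳ-≤ (2 ℕ.* θ) N≤ ⟩
    2 ℕ.* θ ℕ.* suc M                                    ≡⟨ ℕₚ.*-suc (2 ℕ.* θ) M ⟩
    2 ℕ.* θ ℕ.+ 2 ℕ.* θ ℕ.* M                            ≤⟨ ℕₚ.+-monoʳ-≤ (2 ℕ.* θ) bound ⟩
    2 ℕ.* θ ℕ.+ (ac ℕ.* bc ℕ.+ θ ℕ.* θ ℕ.* ab)           ≤⟨ ℕₚ.+-monoʳ-≤ (2 ℕ.* θ) (ℕₚ.+-mono-≤ (ℕₚ.*-mono-≤ ac≤ bc≤) (ℕₚ.*-monoʳ-≤ (θ ℕ.* θ) ab≤)) ⟩
    2 ℕ.* θ ℕ.+ (K ℕ.* K ℕ.+ θ ℕ.* θ ℕ.* K)              ∎)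
    where open ℕₚ.≤-Reasoning

-- Fields and polynomials as sequences of derivatives

module Theory (F : Field) where
  open Field F public
  open IsCommutativeRing isCommutativeRing public
    using (+-identityˡ; +-identityʳ; +-assoc; +-comm; *-assoc; *-comm
          ; *-identityˡ; *-identityʳ; zeroˡ; zeroʳ; distribˡ; distribʳ)
    renaming (-‿inverseʳ to +-inverseʳ)
  module S = IntegerSolver commutativeRing
  open S public using (ι; ι-suc; ι-+; ι-*; solve; con; _:=_; _:+_; _:*_; _:-_; :-_; Polynomial)

  infix 9 #_
  #_ : ∀ {n} → ℕ → Polynomial n
  # k = con (pos k)

  infixl 6 _-_
  _-_ : Carrier → Carrier → Carrier
  x - y = x + - y

  infixr 8 _^_
  _^_ : Carrier → ℕ → Carrier
  x ^ zero  = 1#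
  x ^ suc n = x * x ^ n

  *-cancelˡ : ∀ {x y z} → x ≢ 0# → x * y ≡ x * z → y ≡ z
  *-cancelˡ {x} {y} {z} x≢0 eq = begin
    y                  ≡⟨ unit y ⟨
    (x ⁻¹) * (x * y)   ≡⟨ cong ((x ⁻¹) *_) eq ⟩
    (x ⁻¹) * (x * z)   ≡⟨ unit z ⟩
    z                  ∎
    where
    open ≡-Reasoning
    unit : ∀ u → (x ⁻¹) * (x * u) ≡ u
    unit u = begin
      (x ⁻¹) * (x * u)   ≡⟨ *-assoc _ _ _ ⟨
      (x ⁻¹) * x * u     ≡⟨ cong (_* u) (trans (*-comm _ _) (*-inverseʳ x x≢0)) ⟩
      1# * u             ≡⟨ *-identityˡ u ⟩
      u                  ∎

  *-≡0 : ∀ {x y} → x ≢ 0# → x * y ≡ 0# → y ≡ 0#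
  *-≡0 x≢0 eq = *-cancelˡ x≢0 (trans eq (sym (zeroʳ _)))

  *-≢0 : ∀ {x y} → x ≢ 0# → y ≢ 0# → x * y ≢ 0#
  *-≢0 x≢0 y≢0 eq = y≢0 (*-≡0 x≢0 eq)

  *-≢0ˡ : ∀ {x y} → x * y ≢ 0# → x ≢ 0#
  *-≢0ˡ {y = y} xy≢0 refl = xy≢0 (zeroˡ y)

  *-≢0ʳ : ∀ {x y} → x * y ≢ 0# → y ≢ 0#
  *-≢0ʳ {x} xy≢0 refl = xy≢0 (zeroʳ x)

  ^-≢0 : ∀ {x} n → x ≢ 0# → x ^ n ≢ 0#
  ^-≢0 zero    x≢0 = 1≢0
  ^-≢0 (suc n) x≢0 = *-≢0 x≢0 (^-≢0 n x≢0)

  x-y≡0⇒x≡y : ∀ {x y} → x - y ≡ 0# → x ≡ y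
  x-y≡0⇒x≡y {x} {y} eq = begin
    x            ≡⟨ solve 2 (λ x y → x := (x :- y) :+ y) refl x y ⟩
    (x - y) + y  ≡⟨ cong (_+ y) eq ⟩
    0# + y       ≡⟨ +-identityˡ y ⟩
    y            ∎
    where open ≡-Reasoning

  x≢y⇒x-y≢0 : ∀ {x y} → x ≢ y → x - y ≢ 0#
  x≢y⇒x-y≢0 x≢y eq = x≢y (x-y≡0⇒x≡y eq)

  x≡y⇒x-y≡0 : ∀ {x y} → x ≡ y → x - y ≡ 0#
  x≡y⇒x-y≡0 {x} refl = +-inverseʳ x

  ^-+ : ∀ x m n → x ^ (m ℕ.+ n) ≡ x ^ m * x ^ n
  ^-+ x zero    n = sym (*-identityˡ _)
  ^-+ x (suc m) n = trans (cong (x *_) (^-+ x m n)) (sym (*-assoc _ _ _))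

  ^-* : ∀ x m n → x ^ (m ℕ.* n) ≡ (x ^ n) ^ m
  ^-* x zero    n = refl
  ^-* x (suc m) n = trans (^-+ x n (m ℕ.* n)) (cong (x ^ n *_) (^-* x m n))

  1^ : ∀ n → 1# ^ n ≡ 1#
  1^ zero    = refl
  1^ (suc n) = trans (*-identityˡ _) (1^ n)

  *-^ : ∀ x y n → (x * y) ^ n ≡ x ^ n * y ^ n
  *-^ x y zero    = sym (*-identityˡ _)
  *-^ x y (suc n) = trans (cong ((x * y) *_) (*-^ x y n))
    (solve 4 (λ x y u v → (x :* y) :* (u :* v) := (x :* u) :* (y :* v)) refl x y (x ^ n) (y ^ n))

  -- A polynomial over a field is represented by all its iterated derivatives as functions:
  -- f j x is the value at x of the j-th derivative of f.  The Leibniz rule then holds by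
  -- definition, and so does the derivation property of D.
  Jet : Set
  Jet = ℕ → Carrier → Carrier

  infix  4 _≈_
  infixl 6 _⊕_
  infixl 7 _⊗_

  record _≈_ (f g : Jet) : Set where
    constructor jet
    field at : ∀ j x → f j x ≡ g j x
  open _≈_ public

  D : Jet → Jet
  D f j = f (suc j)

  _⊕_ _⊗_ : Jet → Jet → Jet
  (f ⊕ g) j x = f j x + g j x
  (f ⊗ g) zero    x = f 0 x * g 0 x
  (f ⊗ g) (suc j) x = (D f ⊗ g) j x + (f ⊗ D g) j x

  ⊖_ : Jet → Jet
  (⊖ f) j x = - f j x

  C : Carrier → Jet
  C c zero    x = c
  C c (suc j) x = 0#

  X : Jet
  X zero          x = x
  X (suc zero)    x = 1#
  X (suc (suc j)) x = 0#

  ⊗-cong : ∀ {f f′ g g′} → f ≈ f′ → g ≈ g′ → f ⊗ g ≈ f′ ⊗ g′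
  ⊗-cong p q = jet (go p q)
    where
    go : ∀ {f f′ g g′} → f ≈ f′ → g ≈ g′ → ∀ j x → (f ⊗ g) j x ≡ (f′ ⊗ g′) j x
    go p q zero    x = cong₂ _*_ (at p 0 x) (at q 0 x)
    go p q (suc j) x = cong₂ _+_ (go (jet λ i → at p (suc i)) q j x) (go p (jet λ i → at q (suc i)) j x)

  D-C : ∀ c → D (C c) ≈ C 0#
  D-C c = jet λ { zero _ → refl ; (suc _) _ → refl }

  D-X : D X ≈ C 1#
  D-X = jet λ { zero _ → refl ; (suc _) _ → refl }

  C0 : ∀ j x → C 0# j x ≡ 0#
  C0 zero    x = refl
  C0 (suc j) x = refl

  private
    comm : ∀ f g j x → (f ⊗ g) j x ≡ (g ⊗ f) j x
    comm f g zero    x = *-comm _ _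
    comm f g (suc j) x = trans (cong₂ _+_ (comm (D f) g j x) (comm f (D g) j x)) (+-comm _ _)

    distʳ : ∀ h f g j x → ((f ⊕ g) ⊗ h) j x ≡ (f ⊗ h) j x + (g ⊗ h) j x
    distʳ h f g zero    x = distribʳ _ _ _
    distʳ h f g (suc j) x = trans
      (cong₂ _+_ (distʳ h (D f) (D g) j x) (distʳ (D h) f g j x))
      (solve 4 (λ a b c d → (a :+ b) :+ (c :+ d) := (a :+ c) :+ (b :+ d)) refl _ _ _ _)

    distˡ : ∀ h f g j x → (h ⊗ (f ⊕ g)) j x ≡ (h ⊗ f) j x + (h ⊗ g) j x
    distˡ h f g j x = trans (comm h (f ⊕ g) j x)
      (trans (distʳ h f g j x) (cong₂ _+_ (comm f h j x) (comm g h j x)))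

    assoc : ∀ f g h j x → ((f ⊗ g) ⊗ h) j x ≡ (f ⊗ (g ⊗ h)) j x
    assoc f g h zero    x = *-assoc _ _ _
    assoc f g h (suc j) x = begin
      ((D f ⊗ g ⊕ f ⊗ D g) ⊗ h) j x + ((f ⊗ g) ⊗ D h) j x
        ≡⟨ cong₂ _+_ (distʳ h (D f ⊗ g) (f ⊗ D g) j x) (assoc f g (D h) j x) ⟩
      (((D f ⊗ g) ⊗ h) j x + ((f ⊗ D g) ⊗ h) j x) + (f ⊗ (g ⊗ D h)) j x
        ≡⟨ cong (_+ (f ⊗ (g ⊗ D h)) j x) (cong₂ _+_ (assoc (D f) g h j x) (assoc f (D g) h j x)) ⟩
      ((D f ⊗ (g ⊗ h)) j x + (f ⊗ (D g ⊗ h)) j x) + (f ⊗ (g ⊗ D h)) j x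
        ≡⟨ +-assoc _ _ _ ⟩
      (D f ⊗ (g ⊗ h)) j x + ((f ⊗ (D g ⊗ h)) j x + (f ⊗ (g ⊗ D h)) j x)
        ≡⟨ cong ((D f ⊗ (g ⊗ h)) j x +_) (distˡ f (D g ⊗ h) (g ⊗ D h) j x) ⟨
      (D f ⊗ (g ⊗ h)) j x + (f ⊗ D (g ⊗ h)) j x ∎
      where open ≡-Reasoning

    C0⊗ : ∀ f j x → (C 0# ⊗ f) j x ≡ 0#
    C0⊗ f zero    x = zeroˡ _
    C0⊗ f (suc j) x = trans
      (cong₂ _+_ (trans (at (⊗-cong {D (C 0#)} {C 0#} {f} {f} (D-C 0#) (jet λ _ _ → refl)) j x) (C0⊗ f j x)) (C0⊗ (D f) j x))
      (+-identityˡ _)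

  C⊗ : ∀ c f j x → (C c ⊗ f) j x ≡ c * f j x
  C⊗ c f zero    x = refl
  C⊗ c f (suc j) x = trans
    (cong₂ _+_ (trans (at (⊗-cong {D (C c)} {C 0#} {f} {f} (D-C c) (jet λ _ _ → refl)) j x) (C0⊗ f j x)) (C⊗ c (D f) j x))
    (+-identityˡ _)

  -- With this ring structure the identities proved by the solver for arbitrary commutative rings
  -- hold for polynomials together with all their derivatives.
  jetRing : CommutativeRing 0ℓ 0ℓ
  jetRing = record
    { Carrier = Jet ; _≈_ = _≈_ ; _+_ = _⊕_ ; _*_ = _⊗_ ; -_ = ⊖_ ; 0# = C 0# ; 1# = C 1#
    ; isCommutativeRing = record
      { isRing = record
        { +-isAbelianGroup = record
          { isGroup = record
            { isMonoid = record
              { isSemigroup = record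
                { isMagma = record
                  { isEquivalence = record
                    { refl = jet λ _ _ → refl ; sym = λ p → jet λ j x → sym (at p j x)
                    ; trans = λ p q → jet λ j x → trans (at p j x) (at q j x) }
                  ; ∙-cong = λ p q → jet λ j x → cong₂ _+_ (at p j x) (at q j x) }
                ; assoc = λ f g h → jet λ j x → +-assoc _ _ _ }
              ; identity = (λ f → jet λ j x → trans (cong (_+ f j x) (C0 j x)) (+-identityˡ _))
                         , (λ f → jet λ j x → trans (cong (λ z → f j x + z) (C0 j x)) (+-identityʳ _)) }
            ; inverse = (λ f → jet λ j x → trans (+-comm _ _) (trans (+-inverseʳ _) (sym (C0 j x))))
                      , (λ f → jet λ j x → trans (+-inverseʳ _) (sym (C0 j x)))
            ; ⁻¹-cong = λ p → jet λ j x → cong -_ (at p j x) }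
          ; comm = λ f g → jet λ j x → +-comm _ _ }
        ; *-cong = ⊗-cong
        ; *-assoc = λ f g h → jet (assoc f g h)
        ; *-identity = (λ f → jet λ j x → trans (C⊗ 1# f j x) (*-identityˡ _))
                     , (λ f → jet λ j x → trans (comm f (C 1#) j x) (trans (C⊗ 1# f j x) (*-identityˡ _)))
        ; distrib = (λ h f g → jet (distˡ h f g)) , (λ h f g → jet (distʳ h f g)) }
      ; *-comm = λ f g → jet (comm f g) } }

  open CommutativeRing jetRing public
    using () renaming (refl to ≈-refl; sym to ≈-sym; trans to ≈-trans; +-cong to ⊕-cong
             ; +-identityˡ to ⊕-identityˡ; +-identityʳ to ⊕-identityʳ; zeroˡ to ⊗-zeroˡ; zeroʳ to ⊗-zeroʳ
             ; *-identityˡ to ⊗-identityˡ; *-assoc to ⊗-assoc; -‿cong to ⊖-cong; -‿inverseʳ to ⊖-inverseʳ; *-comm to ⊗-comm)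
  open HornerIdentities jetRing public

  D-cong : ∀ {f g} → f ≈ g → D f ≈ D g
  D-cong p = jet λ j → at p (suc j)

  C-cong : ∀ {c d} → c ≡ d → C c ≈ C d
  C-cong refl = ≈-refl

  C-+ : ∀ c d → C c ⊕ C d ≈ C (c + d)
  C-+ c d = jet λ { zero x → refl ; (suc j) x → +-identityˡ _ }

  C-* : ∀ c d → C c ⊗ C d ≈ C (c * d)
  C-* c d = jet λ { zero x → refl ; (suc j) x → trans (C⊗ c (C d) (suc j) x) (zeroʳ _) }

  D-C⊗ : ∀ c f → D (C c ⊗ f) ≈ C c ⊗ D f
  D-C⊗ c f = ≈-trans (⊕-cong (≈-trans (⊗-cong (D-C c) (≈-refl {f})) (⊗-zeroˡ f)) ≈-refl) (⊕-identityˡ (C c ⊗ D f))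

  -- Degree bounds, division and roots

  infixl 6 _⊝_
  _⊝_ : Jet → Jet → Jet
  f ⊝ g = f ⊕ ⊖ g

  -- Len n f says that f is a polynomial of degree less than n, in Horner form.
  data Len : ℕ → Jet → Set where
    nil  : ∀ {f} → f ≈ C 0# → Len 0 f
    cons : ∀ {n f} c g → Len n g → f ≈ C c ⊕ X ⊗ g → Len (suc n) f

  Len-≈ : ∀ {n f g} → f ≈ g → Len n f → Len n g
  Len-≈ p (nil q)        = nil (≈-trans (≈-sym p) q)
  Len-≈ p (cons c h l q) = cons c h l (≈-trans (≈-sym p) q)

  Len-0 : ∀ n {f} → f ≈ C 0# → Len n f
  Len-0 zero    p = nil p
  Len-0 (suc n) p = cons 0# (C 0#) (Len-0 n ≈-refl) (≈-trans p (≈-sym (horner-0 (C 0#) X)))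

  Len-suc : ∀ {n f} → Len n f → Len (suc n) f
  Len-suc (nil p)        = Len-0 1 p
  Len-suc (cons c g l p) = cons c g (Len-suc l) p

  Len-≤ : ∀ {m n f} → m ≤ n → Len m f → Len n f
  Len-≤ {n = n} z≤n (nil p)      = Len-0 n p
  Len-≤ (s≤s m≤n) (cons c g l p) = cons c g (Len-≤ m≤n l) p

  Len-⊕ : ∀ {n f g} → Len n f → Len n g → Len n (f ⊕ g)
  Len-⊕ (nil p) (nil q) = nil (≈-trans (⊕-cong p q) (⊕-identityˡ (C 0#)))
  Len-⊕ (cons c f l p) (cons d g m q) = cons (c + d) (f ⊕ g) (Len-⊕ l m)
    (≈-trans (⊕-cong p q) (≈-trans (horner-+ (C c) (C d) X f g) (⊕-cong (C-+ c d) ≈-refl)))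

  Len-C : ∀ c → Len 1 (C c)
  Len-C c = cons c (C 0#) (nil ≈-refl) (≈-sym (horner-0 (C c) X))

  Len-X⊗ : ∀ {n f} → Len n f → Len (suc n) (X ⊗ f)
  Len-X⊗ {f = f} l = cons 0# f l (≈-sym (⊕-identityˡ (X ⊗ f)))

  Len-C⊗ : ∀ {n f} c → Len n f → Len n (C c ⊗ f)
  Len-C⊗ {f = f} c (nil p) = nil (≈-trans (⊗-cong ≈-refl p) (⊗-zeroʳ (C c)))
  Len-C⊗ c (cons d g l p) = cons (c * d) (C c ⊗ g) (Len-C⊗ c l)
    (≈-trans (⊗-cong ≈-refl p) (≈-trans (horner-scale (C c) (C d) X g) (⊕-cong (C-* c d) ≈-refl)))

  Len-⊖ : ∀ {n f} → Len n f → Len n (⊖ f)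
  Len-⊖ {f = f} l = Len-≈ (jet λ j x → trans (C⊗ (- 1#) f j x)
      (solve 1 (λ y → :- # 1 :* y := :- y) refl (f j x))) (Len-C⊗ (- 1#) l)

  Len-⊝ : ∀ {n f g} → Len n f → Len n g → Len n (f ⊝ g)
  Len-⊝ l m = Len-⊕ l (Len-⊖ m)

  -- One more than the sharp bound.
  Len-⊗ : ∀ {m n f g} → Len m f → Len n g → Len (m ℕ.+ n) (f ⊗ g)
  Len-⊗ {n = n} {g = g} (nil p) m = Len-0 n (≈-trans (⊗-cong p ≈-refl) (⊗-zeroˡ g))
  Len-⊗ {suc m} {n} {g = g} (cons c f l p) k = Len-≈
    (≈-sym (≈-trans (⊗-cong p ≈-refl) (horner-* (C c) X f g)))
    (Len-⊕ (Len-≤ (ℕₚ.m≤n+m n (suc m)) (Len-C⊗ c k)) (Len-X⊗ (Len-⊗ l k)))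

  D-X⊗ : ∀ f → D (X ⊗ f) ≈ f ⊕ X ⊗ D f
  D-X⊗ f = ⊕-cong (≈-trans (⊗-cong D-X ≈-refl) (⊗-identityˡ f)) ≈-refl

  X⊗-suc : ∀ f j x → (X ⊗ f) (suc j) x ≡ x * f (suc j) x + ι (suc j) * f j x
  X⊗-suc f zero x = +-comm _ _
  X⊗-suc f (suc j) x = begin
    (X ⊗ f) (suc (suc j)) x
      ≡⟨ at (D-X⊗ f) (suc j) x ⟩
    f (suc j) x + (X ⊗ D f) (suc j) x
      ≡⟨ cong (λ z → f (suc j) x + z) (X⊗-suc (D f) j x) ⟩
    f (suc j) x + (x * f (suc (suc j)) x + ι (suc j) * f (suc j) x)
      ≡⟨ solve 4 (λ a b c d → a :+ (b :* c :+ d :* a)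
                       := b :* c :+ (# 1 :+ d) :* a) refl _ _ _ _ ⟩
    x * f (suc (suc j)) x + (1# + ι (suc j)) * f (suc j) x ∎
    where open ≡-Reasoning

  Len-D : ∀ {n f} → Len n f → Len (ℕ.pred n) (D f)
  Len-D (nil p) = nil (≈-trans (D-cong p) (D-C 0#))
  Len-D {suc n} (cons c g l p) =
    Len-≈ {f = g ⊕ X ⊗ D g}
      (≈-sym (≈-trans (D-cong p) (≈-trans (⊕-cong (D-C c) (D-X⊗ g)) (⊕-identityˡ _))))
      (Len-⊕ l (Len-X⊗D l))
    where
    Len-X⊗D : ∀ {n} → Len n g → Len n (X ⊗ D g)
    Len-X⊗D (nil p) = nil (≈-trans (⊗-cong {X} ≈-refl (≈-trans (D-cong p) (D-C 0#))) (⊗-zeroʳ X))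
    Len-X⊗D l@(cons _ _ _ _) = Len-X⊗ (Len-D l)

  X- : Carrier → Jet
  X- d = X ⊝ C d

  divide : ∀ {n f} d → Len n f → ∃ λ g → Len (ℕ.pred n) g × f ≈ X- d ⊗ g ⊕ C (f 0 d)
  divide d (nil p) = C 0# , nil ≈-refl , ≈-trans p
    (≈-trans (≈-sym (0-horner (C 0#) (X- d))) (⊕-cong ≈-refl (C-cong (sym (at p 0 d)))))
  -- A constant is treated apart so that the quotient gets length 0; the general clause would give
  -- length 1.
  divide d (cons c g (nil q) p) = C 0# , nil ≈-refl , ≈-trans p (≈-trans f≈c
    (≈-trans (C-cong (sym (trans (at p 0 d) (at f≈c 0 d)))) (≈-sym (0-horner (C _) (X- d)))))
    where
    f≈c : C c ⊕ X ⊗ g ≈ C c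
    f≈c = ≈-trans (⊕-cong ≈-refl (⊗-cong ≈-refl q)) (horner-0 (C c) X)
  divide d (cons c g l@(cons _ _ _ _) p) with divide d l
  ... | h , lh , q = X ⊗ h ⊕ C (g 0 d) , Len-⊕ (Len-X⊗ lh) (Len-≤ (s≤s z≤n) (Len-C (g 0 d)))
      , ≈-trans p (≈-trans (⊕-cong ≈-refl (⊗-cong ≈-refl q)) (≈-trans
        (horner-÷ (C c) X h (C (g 0 d)) (C d))
        (⊕-cong ≈-refl (≈-trans (≈-trans (⊕-cong ≈-refl (C-* d (g 0 d))) (C-+ c _)) (C-cong (sym (at p 0 d)))))))

  divide-root : ∀ {n f} d → Len n f → f 0 d ≡ 0# → ∃ λ g → Len (ℕ.pred n) g × f ≈ X- d ⊗ g
  divide-root d l eq with divide d l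
  ... | g , lg , p = g , lg , ≈-trans p (≈-trans (⊕-cong ≈-refl (C-cong eq))
     (⊕-identityʳ (X- d ⊗ g)))

  X-⊗-suc : ∀ d f j x → (X- d ⊗ f) (suc j) x ≡ (x - d) * f (suc j) x + ι (suc j) * f j x
  X-⊗-suc d f j x = begin
    (X- d ⊗ f) (suc j) x
      ≡⟨ at (*-distribʳ-- X (C d) f) (suc j) x ⟩
    (X ⊗ f) (suc j) x - (C d ⊗ f) (suc j) x
      ≡⟨ cong₂ _-_ (X⊗-suc f j x) (C⊗ d f (suc j) x) ⟩
    (x * f (suc j) x + ι (suc j) * f j x) - d * f (suc j) x
      ≡⟨ solve 5 (λ x a b c d → (x :* a :+ b :* c) :- d :* a
                       := (x :- d) :* a :+ b :* c) refl x _ _ _ d ⟩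
    (x - d) * f (suc j) x + ι (suc j) * f j x ∎
    where open ≡-Reasoning

  rootProduct : List Carrier → Jet
  rootProduct []       = C 1#
  rootProduct (d ∷ ds) = X- d ⊗ rootProduct ds

  Root : Jet → Carrier → Set
  Root f d = f 0 d ≡ 0#

  Root-÷ : ∀ {f g d e} → f ≈ X- d ⊗ g → d ≢ e → Root f e → Root g e
  Root-÷ p d≢e r = *-≡0 (x≢y⇒x-y≢0 (λ e≡d → d≢e (sym e≡d))) (trans (sym (at p 0 _)) r)

  divide-roots : ∀ {n f} ds → Unique ds → Len n f → All (Root f) ds →
                 ∃ λ g → Len (n ℕ.∸ length ds) g × f ≈ rootProduct ds ⊗ g
  divide-roots {f = f} [] [] l [] = f , l , ≈-sym (⊗-identityˡ f)
  divide-roots {n} {f} (d ∷ ds) (d∉ ∷ u) l (r ∷ rs) with divide-root d l r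
  ... | g , lg , p with divide-roots ds u lg (All.zipWith (λ { (d≢e , s) → Root-÷ {f} {g} p d≢e s }) (d∉ , rs))
  ... | h , lh , q = h , subst (λ k → Len k h) (pred-∸ n (length ds)) lh
      , ≈-trans p (≈-trans (⊗-cong ≈-refl q) (≈-sym (⊗-assoc _ _ _)))
    where
    pred-∸ : ∀ n k → ℕ.pred n ℕ.∸ k ≡ n ℕ.∸ suc k
    pred-∸ zero    k = ℕₚ.0∸n≡0 k
    pred-∸ (suc n) k = refl

  ≈0-of-roots : ∀ {n f} ds → Unique ds → Len n f → All (Root f) ds → n ≤ length ds → f ≈ C 0#
  ≈0-of-roots {n} ds u l rs n≤ with divide-roots ds u l rs
  ... | g , lg , p with subst (λ k → Len k g) (ℕₚ.m≤n⇒m∸n≡0 n≤) lg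
  ... | nil q = ≈-trans p (≈-trans (⊗-cong ≈-refl q)
      (⊗-zeroʳ (rootProduct ds)))

  -- Powers and multiple roots

  infixr 8 _^^_
  _^^_ : Jet → ℕ → Jet
  f ^^ zero  = C 1#
  f ^^ suc k = f ⊗ f ^^ k

  ^^-cong : ∀ {f g} k → f ≈ g → f ^^ k ≈ g ^^ k
  ^^-cong zero    p = ≈-refl
  ^^-cong (suc k) p = ⊗-cong p (^^-cong k p)

  ^^-⊗ : ∀ f g k → (f ⊗ g) ^^ k ≈ f ^^ k ⊗ g ^^ k
  ^^-⊗ f g zero    = ≈-sym (⊗-identityˡ (C 1#))
  ^^-⊗ f g (suc k) = ≈-trans (⊗-cong (≈-refl {f ⊗ g}) (^^-⊗ f g k))
    (*-interchange f g (f ^^ k) (g ^^ k))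

  Vanish : ℕ → Jet → Carrier → Set
  Vanish k f d = ∀ j → j < k → f j d ≡ 0#

  Vanish-÷ : ∀ {f g d e} k → f ≈ X- d ⊗ g → d ≢ e → Vanish k f e → Vanish k g e
  Vanish-÷ {f} {g} {d} {e} k p d≢e v zero    j<k = Root-÷ {g = g} p d≢e (v 0 j<k)
  Vanish-÷ {f} {g} {d} {e} k p d≢e v (suc j) j<k =
    *-≡0 (x≢y⇒x-y≢0 (λ e≡d → d≢e (sym e≡d))) (begin
      (e - d) * g (suc j) e
        ≡⟨ solve 3 (λ a b c → a :* b := (a :* b :+ c :* # 0)) refl (e - d) (g (suc j) e) (ι (suc j)) ⟩
      (e - d) * g (suc j) e + ι (suc j) * 0#
        ≡⟨ cong (λ z → (e - d) * g (suc j) e + ι (suc j) * z) (Vanish-÷ {f} {g} k p d≢e v j (ℕₚ.<-trans (ℕₚ.n<1+n j) j<k)) ⟨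
      (e - d) * g (suc j) e + ι (suc j) * g j e   ≡⟨ X-⊗-suc d g j e ⟨
      (X- d ⊗ g) (suc j) e                         ≡⟨ at p (suc j) e ⟨
      f (suc j) e                                  ≡⟨ v (suc j) j<k ⟩
      0#                                           ∎)
    where open ≡-Reasoning

  -- At d the derivative of order j + 1 of (X - d) g is (j + 1) times that of order j of g. One
  -- order is lost, and j + 1 must be invertible: vanishing derivatives detect multiplicity only
  -- below the characteristic.
  Vanish-÷ᵈ : ∀ {f g d} k → (∀ j → j ≤ k → ι (suc j) ≢ 0#) → f ≈ X- d ⊗ g → Vanish (suc k) f d → Vanish k g d
  Vanish-÷ᵈ {f} {g} {d} k char p v j j<k = *-≡0 (char j (ℕₚ.<⇒≤ j<k)) (begin
    ι (suc j) * g j d                            ≡⟨ solve 3 (λ d a b → b := (d :- d) :* a :+ b) refl d (g (suc j) d) (ι (suc j) * g j d) ⟩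
    (d - d) * g (suc j) d + ι (suc j) * g j d    ≡⟨ X-⊗-suc d g j d ⟨
    (X- d ⊗ g) (suc j) d                         ≡⟨ at p (suc j) d ⟨
    f (suc j) d                                  ≡⟨ v (suc j) (s≤s j<k) ⟩
    0#                                           ∎)
    where open ≡-Reasoning

  pred-∸ : ∀ n k → ℕ.pred n ℕ.∸ k ≡ n ℕ.∸ suc k
  pred-∸ zero    k = ℕₚ.0∸n≡0 k
  pred-∸ (suc n) k = refl

  -- The last component records that the quotient still vanishes to the same order at the other
  -- points, so that the division can be repeated there.
  divide-multiple-root : ∀ {n f} d k → (∀ j → j ≤ k → ι (suc j) ≢ 0#) → Len n f → Vanish k f d →
    ∃ λ g → Len (n ℕ.∸ k) g × f ≈ X- d ^^ k ⊗ g × (∀ e m → d ≢ e → Vanish m f e → Vanish m g e)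
  divide-multiple-root {f = f} d zero char l v =
    f , l , ≈-sym (⊗-identityˡ f) , λ _ _ _ w → w
  divide-multiple-root {n} {f} d (suc k) char l v =
    let g , lg , p     = divide-root d l (v 0 (s≤s z≤n))
        char′          = λ j j≤k → char j (ℕₚ.m≤n⇒m≤1+n j≤k)
        h , lh , q , w = divide-multiple-root {f = g} d k char′ lg (Vanish-÷ᵈ {f} {g} {d} k char′ p v)
    in  h , subst (λ k → Len k h) (pred-∸ n k) lh
      , ≈-trans p (≈-trans (⊗-cong (≈-refl {X- d}) q) (≈-sym (⊗-assoc (X- d) (X- d ^^ k) h)))
      , λ e m d≢e ve → w e m d≢e (Vanish-÷ {f} {g} {d} {e} m p d≢e ve)

  1^^ : ∀ k → C 1# ^^ k ≈ C 1#
  1^^ zero    = ≈-refl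
  1^^ (suc k) = ≈-trans (⊗-cong (≈-refl {C 1#}) (1^^ k)) (⊗-identityˡ (C 1#))

  divide-multiple-roots : ∀ {n f} ds k → Unique ds → (∀ j → j ≤ k → ι (suc j) ≢ 0#) → Len n f →
    All (Vanish k f) ds → ∃ λ g → Len (n ℕ.∸ length ds ℕ.* k) g × f ≈ rootProduct ds ^^ k ⊗ g
  divide-multiple-roots {f = f} [] k [] char l [] =
    f , l , ≈-trans (≈-sym (⊗-identityˡ f)) (⊗-cong (≈-sym (1^^ k)) (≈-refl {f}))
  divide-multiple-roots {n} {f} (d ∷ ds) k (d∉ ∷ u) char l (v ∷ vs) =
    let g , lg , p , w = divide-multiple-root {n} {f} d k char l v
        h , lh , q     = divide-multiple-roots {f = g} ds k u char lg
                           (All.zipWith (λ {e} (d≢e , ve) → w e k d≢e ve) (d∉ , vs))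
    in  h , subst (λ k → Len k h) (ℕₚ.∸-+-assoc n k (length ds ℕ.* k)) lh
      , ≈-trans p (≈-trans (⊗-cong (≈-refl {X- d ^^ k}) q)
          (≈-trans (≈-sym (⊗-assoc (X- d ^^ k) (rootProduct ds ^^ k) h))
            (⊗-cong (≈-sym (^^-⊗ (X- d) (rootProduct ds) k)) (≈-refl {h}))))

  -- The polynomial of Stepanov's method

  -- For distinct a₁,…,a_k there are unique c_i with Σ c_i a_i^j = 0 for 0 < j < k and Σ c_i = 1;
  -- phi as j m is Σ c_i a_i^j (1 + a_i X)^m, defined by recursion on the nodes.
  phi : List Carrier → ℕ → ℕ → Jet
  phi []       j       m       = C 0#
  phi (a ∷ as) zero    zero    = C 1#
  phi (a ∷ as) zero    (suc m) = phi (a ∷ as) 0 m ⊕ X ⊗ (C a ⊗ (phi (a ∷ as) 0 m ⊝ phi as 0 m))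
  phi (a ∷ as) (suc j) m       = C a ⊗ (phi (a ∷ as) j m ⊝ phi as j m)

  -- Under the sum Σ c_i a_i^j (1 + a_i X)^m one factor 1 + a_i X is expanded. The recursion in j
  -- rests on c_i a_i = a (c_i - c′_i), where the c′_i belong to the nodes without a; it replaces
  -- division by differences of nodes.
  phi-suc : ∀ as j m → phi as j (suc m) ≈ phi as j m ⊕ X ⊗ phi as (suc j) m
  phi-suc []       j       m = ≈-sym (horner-0 (C 0#) X)
  phi-suc (a ∷ as) zero    m = ≈-refl
  phi-suc (a ∷ as) (suc j) m = ≈-trans
    (⊗-cong (≈-refl {C a}) (⊕-cong (phi-suc (a ∷ as) j m) (⊖-cong (phi-suc as j m))))
    (scale-step (C a) (phi (a ∷ as) j m) (phi as j m) X (phi (a ∷ as) (suc j) m) (phi as (suc j) m))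

  D-phi-0 : ∀ as j → D (phi as j 0) ≈ C 0#
  D-phi-0 []       j       = D-C 0#
  D-phi-0 (a ∷ as) zero    = D-C 1#
  D-phi-0 (a ∷ as) (suc j) = ≈-trans (D-C⊗ a (phi (a ∷ as) j 0 ⊝ phi as j 0))
    (≈-trans (⊗-cong (≈-refl {C a}) (≈-trans (⊕-cong (D-phi-0 (a ∷ as) j) (⊖-cong (D-phi-0 as j)))
                                             (⊖-inverseʳ (C 0#))))
             (⊗-zeroʳ (C a)))

  D-phi : ∀ as j m → D (phi as j (suc m)) ≈ C (ι (suc m)) ⊗ phi as (suc j) m
  D-phi []       j       m       = ≈-trans (D-C 0#) (≈-sym (⊗-zeroʳ (C (ι (suc m)))))
  D-phi (a ∷ as) zero    zero    = ≈-trans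
    (⊕-cong (D-C 1#) (≈-trans (D-X⊗ φ₁) (⊕-cong (≈-refl {φ₁}) (≈-trans (⊗-cong (≈-refl {X}) (D-phi-0 (a ∷ as) 1)) (⊗-zeroʳ X)))))
    (≈-trans (⊕-identityˡ (φ₁ ⊕ C 0#)) (≈-trans (⊕-identityʳ φ₁) (≈-sym (⊗-identityˡ φ₁))))
    where φ₁ = phi (a ∷ as) 1 0
  D-phi (a ∷ as) zero    (suc m) = ≈-trans
    (⊕-cong (D-phi (a ∷ as) 0 m)
      (≈-trans (D-X⊗ (phi (a ∷ as) 1 (suc m)))
        (⊕-cong (phi-suc (a ∷ as) 1 m) (⊗-cong (≈-refl {X}) (D-phi (a ∷ as) 1 m)))))
    (≈-trans (leibniz-step (C (ι (suc m))) (phi (a ∷ as) 1 m) X (phi (a ∷ as) 2 m))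
      (⊗-cong (C-+ 1# (ι (suc m))) (≈-sym (phi-suc (a ∷ as) 1 m))))
  D-phi (a ∷ as) (suc j) m       = ≈-trans (D-C⊗ a (phi (a ∷ as) j (suc m) ⊝ phi as j (suc m)))
    (≈-trans (⊗-cong (≈-refl {C a}) (⊕-cong (D-phi (a ∷ as) j m) (⊖-cong (D-phi as j m))))
      (scale-swap (C a) (C (ι (suc m))) (phi (a ∷ as) (suc j) m) (phi as (suc j) m)))

  Len-phi : ∀ as m → Len (suc m) (phi as 0 m)
  Len-phi []       m       = Len-0 (suc m) ≈-refl
  Len-phi (a ∷ as) zero    = Len-C 1#
  Len-phi (a ∷ as) (suc m) = Len-⊕ (Len-suc (Len-phi (a ∷ as) m))
    (Len-X⊗ (Len-C⊗ a (Len-⊝ (Len-phi (a ∷ as) m) (Len-phi as m))))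

  -- The product (i + 1)(i + 2) ⋯ (i + r), which r derivatives bring down from an exponent i + r.
  rise : ℕ → ℕ → Carrier
  rise i zero    = 1#
  rise i (suc r) = ι (suc (i ℕ.+ r)) * rise i r

  phi-jet : ∀ as j i r x → phi as j (i ℕ.+ r) r x ≡ rise i r * phi as (j ℕ.+ r) i 0 x
  phi-jet as j i zero x rewrite ℕₚ.+-identityʳ i | ℕₚ.+-identityʳ j = sym (*-identityˡ _)
  phi-jet as j i (suc r) x rewrite ℕₚ.+-suc i r | ℕₚ.+-suc j r = begin
    phi as j (suc (i ℕ.+ r)) (suc r) x
      ≡⟨ at (D-phi as j (i ℕ.+ r)) r x ⟩
    (C (ι (suc (i ℕ.+ r))) ⊗ phi as (suc j) (i ℕ.+ r)) r x
      ≡⟨ C⊗ (ι (suc (i ℕ.+ r))) (phi as (suc j) (i ℕ.+ r)) r x ⟩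
    ι (suc (i ℕ.+ r)) * phi as (suc j) (i ℕ.+ r) r x
      ≡⟨ cong (ι (suc (i ℕ.+ r)) *_) (phi-jet as (suc j) i r x) ⟩
    ι (suc (i ℕ.+ r)) * (rise i r * phi as (suc j ℕ.+ r) i 0 x)
      ≡⟨ *-assoc _ _ _ ⟨
    ι (suc (i ℕ.+ r)) * rise i r * phi as (suc (j ℕ.+ r)) i 0 x ∎
    where open ≡-Reasoning

  val : List Carrier → ℕ → ℕ → Carrier → Carrier
  val as j m x = phi as j m 0 x

  lin : Carrier → Carrier → Carrier
  lin x a = 1# + a * x

  -- The recurrence of divided differences: c_i is the product of the a_j/(a_j - a_i), and ab/(b -
  -- a_i) - ab/(a - a_i) = (a - b) ab/((a - a_i)(b - a_i)). It reduces statements about several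
  -- nodes to single nodes.
  val-swap : ∀ a b as m x →
    (a - b) * val (a ∷ b ∷ as) 0 m x ≡ a * val (b ∷ as) 0 m x - b * val (a ∷ as) 0 m x
  val-swap a b as zero x =
    solve 2 (λ a b → (a :- b) :* # 1 := a :* # 1 :- b :* # 1) refl a b
  val-swap a b as (suc m) x = begin
    (a - b) * (s + x * (a * (s - t)))
      ≡⟨ solve 5 (λ a b s t x → (a :- b) :* (s :+ x :* (a :* (s :- t)))
            := ((a :- b) :* s) :* (# 1 :+ x :* a) :- (a :- b) :* x :* a :* t) refl a b s t x ⟩
    ((a - b) * s) * (1# + x * a) - (a - b) * x * a * t
      ≡⟨ cong (λ z → z * (1# + x * a) - (a - b) * x * a * t) (val-swap a b as m x) ⟩
    (a * t - b * u) * (1# + x * a) - (a - b) * x * a * t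
      ≡⟨ solve 6 (λ a b t u v x →
            (a :* t :- b :* u) :* (# 1 :+ x :* a) :- (a :- b) :* x :* a :* t
            := a :* (t :+ x :* (b :* (t :- v))) :- b :* (u :+ x :* (a :* (u :- v)))) refl a b t u v x ⟩
    a * (t + x * (b * (t - v))) - b * (u + x * (a * (u - v))) ∎
    where
    open ≡-Reasoning
    s = val (a ∷ b ∷ as) 0 m x
    t = val (b ∷ as) 0 m x
    u = val (a ∷ as) 0 m x
    v = val as 0 m x

  val-singleton : ∀ a n i x → val (a ∷ []) 0 (n ℕ.+ i) x ≡ lin x a ^ n * val (a ∷ []) 0 i x
  val-singleton a zero    i x = sym (*-identityˡ _)
  val-singleton a (suc n) i x = begin
    w + x * (a * (w - 0#))
      ≡⟨ solve 3 (λ a w x → w :+ x :* (a :* (w :- # 0))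
            := (# 1 :+ a :* x) :* w) refl a w x ⟩
    lin x a * w
      ≡⟨ cong (lin x a *_) (val-singleton a n i x) ⟩
    lin x a * (lin x a ^ n * val (a ∷ []) 0 i x)
      ≡⟨ *-assoc _ _ _ ⟨
    lin x a * lin x a ^ n * val (a ∷ []) 0 i x ∎
    where
    open ≡-Reasoning
    w = val (a ∷ []) 0 (n ℕ.+ i) x

  module Periodic (N : ℕ) (η x : Carrier) where

    Good : Carrier → Set
    Good a = lin x a ^ N ≡ η

    -- For one node this is the hypothesis (1 + a x)^N = η; `val-swap` carries it to more nodes,
    -- where a - b is cancelled.
    val-period₀ : ∀ a as → Unique (a ∷ as) → All Good (a ∷ as) → ∀ i →
                  val (a ∷ as) 0 (N ℕ.+ i) x ≡ η * val (a ∷ as) 0 i x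
    val-period₀ a [] _ (g ∷ []) i = trans (val-singleton a N i x) (cong (_* val (a ∷ []) 0 i x) g)
    val-period₀ a (b ∷ as) ((a≢b ∷ a∉) ∷ (b∉ ∷ u)) (ga ∷ gb ∷ gs) i = *-cancelˡ (x≢y⇒x-y≢0 a≢b) (begin
      (a - b) * val (a ∷ b ∷ as) 0 (N ℕ.+ i) x
        ≡⟨ val-swap a b as (N ℕ.+ i) x ⟩
      a * val (b ∷ as) 0 (N ℕ.+ i) x - b * val (a ∷ as) 0 (N ℕ.+ i) x
        ≡⟨ cong₂ (λ u v → a * u - b * v) (val-period₀ b as (b∉ ∷ u) (gb ∷ gs) i)
                                          (val-period₀ a as (a∉ ∷ u) (ga ∷ gs) i) ⟩
      a * (η * t) - b * (η * v)
        ≡⟨ solve 5 (λ a b e t v → a :* (e :* t) :- b :* (e :* v) := e :* (a :* t :- b :* v)) refl a b η t v ⟩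
      η * (a * t - b * v)
        ≡⟨ cong (η *_) (val-swap a b as i x) ⟨
      η * ((a - b) * s)
        ≡⟨ solve 3 (λ c e s → e :* (c :* s) := c :* (e :* s)) refl (a - b) η s ⟩
      (a - b) * (η * s) ∎)
      where
      open ≡-Reasoning
      s = val (a ∷ b ∷ as) 0 i x
      t = val (b ∷ as) 0 i x
      v = val (a ∷ as) 0 i x

    val-period : ∀ as → Unique as → All Good as → ∀ j i → val as j (N ℕ.+ i) x ≡ η * val as j i x
    val-period []       _        _        j       i = sym (zeroʳ η)
    val-period (a ∷ as) u        gs       zero    i = val-period₀ a as u gs i
    val-period (a ∷ as) (a∉ ∷ u) (g ∷ gs) (suc j) i = trans
      (cong₂ (λ s t → a * (s - t)) (val-period (a ∷ as) (a∉ ∷ u) (g ∷ gs) j i) (val-period as u gs j i))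
      (solve 4 (λ a e s t → a :* (e :* s :- e :* t) := e :* (a :* (s :- t))) refl a η _ _)

  -- Expanding (1 + a_i x) to a power below k meets only Σ c_i = 1 and the sums Σ c_i a_i^j with 0 <
  -- j < k, which vanish.
  val≡1 : ∀ as i x → i < length as → val as 0 i x ≡ 1#
  val≡1 (a ∷ as) zero    x _ = refl
  val≡1 (a ∷ as) (suc i) x (s≤s i<k) = trans
    (cong₂ (λ s t → s + x * (a * (s - t))) (val≡1 (a ∷ as) i x (ℕₚ.m≤n⇒m≤1+n i<k)) (val≡1 as i x i<k))
    (solve 2 (λ x a → # 1 :+ x :* (a :* (# 1 :- # 1)) := # 1) refl x a)

  -- Moments and symmetric functions of the nodes

  -- The moments Σ c_i b_i^j attached to the nodes bs.
  moment : List Carrier → ℕ → Carrier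
  moment []       j       = 0#
  moment (b ∷ bs) zero    = 1#
  moment (b ∷ bs) (suc j) = b * (moment (b ∷ bs) j - moment bs j)

  moment-low : ∀ bs j → suc j < length bs → moment bs (suc j) ≡ 0#
  moment-low (b ∷ bs@(_ ∷ _)) zero    _ =
    solve 1 (λ b → b :* (# 1 :- # 1) := # 0) refl b
  moment-low (b ∷ bs) (suc j) (s≤s j<k) = trans
    (cong₂ (λ s t → b * (s - t)) (moment-low (b ∷ bs) j (ℕₚ.m≤n⇒m≤1+n j<k)) (moment-low bs j j<k))
    (solve 1 (λ b → b :* (# 0 :- # 0) := # 0) refl b)

  signedProduct : Carrier → List Carrier → Carrier
  signedProduct b []       = b
  signedProduct b (c ∷ cs) = - b * signedProduct c cs

  -- The complete homogeneous symmetric functions of degree 1 and 2.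
  h₁ h₂ : List Carrier → Carrier
  h₁ []       = 0#
  h₁ (b ∷ bs) = b + h₁ bs
  h₂ []       = 0#
  h₂ (b ∷ bs) = b * (b + h₁ bs) + h₂ bs

  -- Here `k` omits the first node, so the orders start at the number of nodes. With e replaced by
  -- -b e when a node b is added, the recursion for moments becomes h_r(b, bs) = b h_(r-1)(b, bs) +
  -- h_r(bs).
  moment-high : ∀ b bs → let k = length bs; e = signedProduct b bs in
      moment (b ∷ bs) (1 ℕ.+ k) ≡ e
    × moment (b ∷ bs) (2 ℕ.+ k) ≡ e * h₁ (b ∷ bs)
    × moment (b ∷ bs) (3 ℕ.+ k) ≡ e * h₂ (b ∷ bs)
  moment-high b [] =
      solve 1 (λ b → m₁ b := b) refl b
    , solve 1 (λ b → m₂ b := b :* (b :+ # 0)) refl b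
    , solve 1 (λ b → b :* (m₂ b :- # 0)
                   := b :* (b :* (b :+ # 0) :+ # 0)) refl b
    where
    m₁ m₂ : ∀ {n} → Polynomial n → Polynomial n
    m₁ b = b :* (# 1 :- # 0)
    m₂ b = b :* (m₁ b :- # 0)
  moment-high b (c ∷ cs) =
    let p₁ , p₂ , p₃ = moment-high c cs
        q₁ = trans (cong₂ (λ s t → b * (s - t)) (moment-low (b ∷ c ∷ cs) (length cs) ℕₚ.≤-refl) p₁)
               (solve 2 (λ b e → b :* (# 0 :- e) := :- b :* e) refl b _)
        q₂ = trans (cong₂ (λ s t → b * (s - t)) q₁ p₂)
               (solve 3 (λ b e h → b :* (:- b :* e :- e :* h)
                  := :- b :* e :* (b :+ h)) refl b (signedProduct c cs) (h₁ (c ∷ cs)))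
    in q₁ , q₂ , trans (cong₂ (λ s t → b * (s - t)) q₂ p₃)
         (solve 4 (λ b e h k → b :* (:- b :* e :* (b :+ h) :- e :* k)
                  := :- b :* e :* (b :* (b :+ h) :+ k)) refl b (signedProduct c cs) (h₁ (c ∷ cs)) (h₂ (c ∷ cs)))

  signedProduct-≢0 : ∀ b bs → All (_≢ 0#) (b ∷ bs) → signedProduct b bs ≢ 0#
  signedProduct-≢0 b []       (b≢0 ∷ [])      = b≢0
  signedProduct-≢0 b (c ∷ cs) (b≢0 ∷ cs≢0) =
    *-≢0 (λ -b≡0 → b≢0 (trans (solve 1 (λ b → b := :- (:- b)) refl b)
                          (trans (cong -_ -b≡0) (solve 0 (:- # 0 := # 0) refl))))
         (signedProduct-≢0 c cs cs≢0)

  -- The node as seen from x: with b = a/(1 + a x), 1 + a (x + u) = (1 + a x)(1 + b u).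
  node : Carrier → Carrier → Carrier
  node x a = a * lin x a ⁻¹

  lin*node : ∀ x a → lin x a ≢ 0# → lin x a * node x a ≡ a
  lin*node x a l≢0 = trans (solve 3 (λ l a i → l :* (a :* i) := a :* (l :* i)) refl (lin x a) a (lin x a ⁻¹))
    (trans (cong (a *_) (*-inverseʳ _ l≢0)) (trans (*-comm a 1#) (*-identityˡ a)))

  -- Put b_i = a_i/(1 + a_i x). Since b_j - b_i = (a_j - a_i)/((1 + a_i x)(1 + a_j x)), the
  -- coefficients belonging to the b_i are c_i (1 + a_i x)^(k-1). Taking (1 + a_i x)^N = η out of
  -- c_i a_i^j (1 + a_i x)^(N+k-1-j) leaves exactly these coefficients times b_i^j.
  val-moment : ∀ N η x as → Unique as → All (Periodic.Good N η x) as → All (λ a → lin x a ≢ 0#) as →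
    ∀ j i → suc (j ℕ.+ i) ≡ N ℕ.+ length as → val as j i x ≡ η * moment (map (node x) as) j
  val-moment N η x []       _ _  _  j i eq = sym (zeroʳ η)
  -- For j = 0 the exponent is N + k - 1: one period gives η, and the remaining exponent k - 1 is
  -- still in the range of `val≡1`.
  val-moment N η x (a ∷ as) u gs ls zero i eq = begin
    val (a ∷ as) 0 i x                    ≡⟨ cong (λ i → val (a ∷ as) 0 i x) i≡ ⟩
    val (a ∷ as) 0 (N ℕ.+ length as) x    ≡⟨ Periodic.val-period N η x (a ∷ as) u gs 0 (length as) ⟩
    η * val (a ∷ as) 0 (length as) x      ≡⟨ cong (η *_) (val≡1 (a ∷ as) (length as) x ℕₚ.≤-refl) ⟩
    η * 1#                                ∎
    where
    open ≡-Reasoning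
    i≡ : i ≡ N ℕ.+ length as
    i≡ = ℕₚ.suc-injective (trans eq (ℕₚ.+-suc N (length as)))
  val-moment N η x (a ∷ as) (a∉ ∷ u) (g ∷ gs) (l ∷ ls) (suc j) i eq = *-cancelˡ l (begin
    lin x a * (a * (s - t))
      ≡⟨ solve 4 (λ a x s t → (# 1 :+ a :* x) :* (a :* (s :- t))
            := a :* ((s :+ x :* (a :* (s :- t))) :- t)) refl a x s t ⟩
    a * ((s + x * (a * (s - t))) - t)
      ≡⟨ cong (λ z → a * (z - t)) (at (phi-suc (a ∷ as) j i) 0 x) ⟨
    a * (val (a ∷ as) j (suc i) x - t)
      ≡⟨ cong₂ (λ y z → a * (y - z))
           (val-moment N η x (a ∷ as) (a∉ ∷ u) (g ∷ gs) (l ∷ ls) j (suc i) (trans (cong suc (ℕₚ.+-suc j i)) eq))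
           (val-moment N η x as u gs ls j i (ℕₚ.suc-injective (trans eq (ℕₚ.+-suc N (length as))))) ⟩
    a * (η * m - η * m′)
      ≡⟨ cong (_* (η * m - η * m′)) (lin*node x a l) ⟨
    lin x a * node x a * (η * m - η * m′)
      ≡⟨ solve 5 (λ l b e m m′ → l :* b :* (e :* m :- e :* m′)
            := l :* (e :* (b :* (m :- m′)))) refl (lin x a) (node x a) η m m′ ⟩
    lin x a * (η * (node x a * (m - m′))) ∎)
    where
    open ≡-Reasoning
    s  = val (a ∷ as) j i x
    t  = val as j i x
    m  = moment (map (node x) (a ∷ as)) j
    m′ = moment (map (node x) as) j

  Lin : Carrier → Jet
  Lin a = C 1# ⊕ C a ⊗ X

  linProduct : List Carrier → Jet
  linProduct []       = C 1#
  linProduct (a ∷ as) = Lin a ⊗ linProduct as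

  Len-linProduct : ∀ as → Len (suc (length as)) (linProduct as)
  Len-linProduct []       = Len-C 1#
  Len-linProduct (a ∷ as) = Len-≈ (≈-sym (≈-trans (⊗-cong (⊕-cong ≈-refl (⊗-comm (C a) X)) (≈-refl {linProduct as}))
      (horner-* (C 1#) X (C a) (linProduct as))))
    (Len-⊕ (Len-suc (Len-C⊗ 1# (Len-linProduct as))) (Len-X⊗ (Len-C⊗ a (Len-linProduct as))))

  Lin-1 : ∀ a x → Lin a 1 x ≡ a
  Lin-1 a x = solve 2 (λ a x → # 0 :+ (# 0 :* x :+ a :* # 1) := a) refl a x

  Lin-2 : ∀ a x → Lin a 2 x ≡ 0#
  Lin-2 a x = solve 2 (λ a x → z :+ ((z :* x :+ z :* # 1) :+ (z :* # 1 :+ a :* z)) := z) refl a x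
    where
    z : ∀ {n} → Polynomial n
    z = # 0

  -- Around x, E is E(x) ∏ (1 + b_i u), so E′/E and E′′/(2E) are elementary symmetric functions of
  -- the b_i, namely h₁ and e₂ = h₁² - h₂.
  linProduct-jet : ∀ x as → All (λ a → lin x a ≢ 0#) as → let E = linProduct as; bs = map (node x) as in
      E 0 x ≢ 0#
    × E 1 x ≡ E 0 x * h₁ bs
    × E 2 x ≡ ι 2 * E 0 x * (h₁ bs * h₁ bs - h₂ bs)
  linProduct-jet x [] [] = 1≢0 , sym (zeroʳ 1#)
    , solve 0 (# 0 := # 2 :* # 1 :* (# 0 :* # 0 :- # 0)) refl
  linProduct-jet x (a ∷ as) (l ∷ ls) =
    let e≢0 , p₁ , p₂ = linProduct-jet x as ls in *-≢0 l e≢0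
      , trans (cong₂ (λ s t → s * e + lin x a * t) (Lin-1 a x) p₁) (trans
          (cong (λ s → s * e + lin x a * (e * h)) (sym (lin*node x a l)))
          (solve 4 (λ l b e h → (l :* b) :* e :+ l :* (e :* h) := l :* e :* (b :+ h)) refl (lin x a) b e h))
      , trans (cong₂ (λ s t → (s * e + t * linProduct as 1 x) + (t * linProduct as 1 x + lin x a * linProduct as 2 x))
                (Lin-2 a x) (trans (Lin-1 a x) (sym (lin*node x a l)))) (trans
          (cong₂ (λ s t → (0# * e + lin x a * b * s) + (lin x a * b * s + lin x a * t)) p₁ p₂)
          (solve 5 (λ l b e h k → (# 0 :* e :+ l :* b :* (e :* h)) :+ (l :* b :* (e :* h)
                 :+ l :* (# 2 :* e :* (h :* h :- k)))
               := # 2 :* (l :* e) :* ((b :+ h) :* (b :+ h) :- (b :* (b :+ h) :+ k)))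
             refl (lin x a) b e h k))
    where
    e = linProduct as 0 x
    b = node x a
    h = h₁ (map (node x) as)
    k = h₂ (map (node x) as)

  -- Elimination of the second-order data of P

  -- K, n₁ and n₂ stand for k, N - 1 and N - 2. For these values `coeffA` factors as (N - 1)(k -
  -- 1)((3k + 2) N + 2k² - k - 2).
  coeffC coeffA : Carrier → Carrier → Carrier → Carrier
  coeffC K n₁ n₂ = K * (K + 1#) * n₁ * (ι 3 * n₂ + ι 2 * K + ι 4)
  coeffA K n₁ n₂ = ι 2 * coeffC K n₁ n₂ - (K + ι 2) * n₁ * (ι 2 * K * (K + 1#) + n₁ * (ι 3 * K + 1#))

  quadratic : (K n₁ n₂ h k s t : Carrier) → Carrier
  quadratic K n₁ n₂ h k s t =
      coeffA K n₁ n₂ * (h * h) - coeffC K n₁ n₂ * (ι 2 * (h * h - k))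
    + ι 2 * n₁ * (K + 1#) * (K + ι 2) * (h * s)
    + (K - 1#) * (K + 1#) * (K + 1#) * (K + ι 2) * (s * s)
    - K * (K + 1#) * (K + 1#) * (K + ι 2) * t

  -- The long factor on the left is W′/(P′ E q) at a root of P. It is linear in r′, which the second
  -- relation removes; r is then expressed by the first relation. The factor K (K + 1)(K + 2) clears
  -- the denominators, and 2 (h² - k) stands for E′′/E.
  eliminate : ∀ K n₁ n₂ h k r r′ s t →
    (K + 1#) * (K * r + s) ≡ n₁ * h →
    (K + 1#) * (K + ι 2) * (K * (K - 1#) * (r * r) + K * r′ + ι 2 * K * r * s + t) ≡ ι 2 * n₁ * n₂ * k →
    K * (K + 1#) * (K + ι 2) *
      ((K + 1#) * (h * (ι 2 * K * r + ι 2 * s) + (ι 3 * K * r′ + (ι 2 * K + ι 4) * r * s + ι 2 * t))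
        - ι 2 * n₁ * (ι 2 * (h * h - k) + ι 2 * h * r + h * s))
    ≡ quadratic K n₁ n₂ h k s t
  eliminate K n₁ n₂ h k r r′ s t eq₁ eq₂ = begin
    K * (K + 1#) * (K + ι 2) *
      ((K + 1#) * (h * (ι 2 * K * r + ι 2 * s) + (ι 3 * K * r′ + (ι 2 * K + ι 4) * r * s + ι 2 * t))
        - ι 2 * n₁ * (ι 2 * (h * h - k) + ι 2 * h * r + h * s))
      ≡⟨ solve 8 (λ K n h k r r′ s t →
           K :* (K :+ # 1) :* (K :+ # 2) :*
             ((K :+ # 1) :* (h :* (# 2 :* K :* r :+ # 2 :* s) :+ (# 3 :* K :* r′ :+ (# 2 :* K :+ # 4) :* r :* s :+ # 2 :* t))
                :- # 2 :* n :* (# 2 :* (h :* h :- k) :+ # 2 :* h :* r :+ h :* s))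
           := # 3 :* K :* (K :+ # 1) :* ((K :+ # 1) :* (K :+ # 2) :* (K :* (K :- # 1) :* (r :* r) :+ K :* r′ :+ # 2 :* K :* r :* s :+ t))
              :+ (K :+ # 2) :* (reduced K n h k s t ((K :+ # 1) :* (K :* r :+ s)))) refl K n₁ h k r r′ s t ⟩
    ι 3 * K * (K + 1#) * ((K + 1#) * (K + ι 2) * (K * (K - 1#) * (r * r) + K * r′ + ι 2 * K * r * s + t))
        + (K + ι 2) * reducedF ((K + 1#) * (K * r + s))
      ≡⟨ cong₂ (λ u v → ι 3 * K * (K + 1#) * u + (K + ι 2) * reducedF v) eq₂ eq₁ ⟩
    ι 3 * K * (K + 1#) * (ι 2 * n₁ * n₂ * k) + (K + ι 2) * reducedF (n₁ * h)
      ≡⟨ solve 7 (λ K n m h k s t →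
           let c = K :* (K :+ # 1) :* n :* (# 3 :* m :+ # 2 :* K :+ # 4)
               a = # 2 :* c :- (K :+ # 2) :* n :* (# 2 :* K :* (K :+ # 1) :+ n :* (# 3 :* K :+ # 1))
           in # 3 :* K :* (K :+ # 1) :* (# 2 :* n :* m :* k) :+ (K :+ # 2) :* reduced K n h k s t (n :* h)
           := a :* (h :* h) :- c :* (# 2 :* (h :* h :- k)) :+ # 2 :* n :* (K :+ # 1) :* (K :+ # 2) :* (h :* s)
              :+ (K :- # 1) :* (K :+ # 1) :* (K :+ # 1) :* (K :+ # 2) :* (s :* s)
              :- K :* (K :+ # 1) :* (K :+ # 1) :* (K :+ # 2) :* t) refl K n₁ n₂ h k s t ⟩
    quadratic K n₁ n₂ h k s t ∎
    where
    open ≡-Reasoning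
    -- v stands for (K + 1) (K r + s)
    reduced : ∀ {n} (K n₁ h k s t v : Polynomial n) → Polynomial n
    reduced K n h k s t v =
      let w = v :- (K :+ # 1) :* s in
          # 2 :* K :* (K :+ # 1) :* h :* v :- # 3 :* (K :- # 1) :* (w :* w) :- # 6 :* K :* (K :+ # 1) :* w :* s
       :- K :* (K :+ # 1) :* (K :+ # 1) :* t :+ (K :+ # 1) :* (# 2 :* K :+ # 4) :* w :* s
       :- # 4 :* n :* K :* (K :+ # 1) :* (h :* h :- k) :- # 4 :* n :* h :* w :- # 2 :* n :* K :* (K :+ # 1) :* h :* s
    reducedF : Carrier → Carrier
    reducedF v =
      let w = v - (K + 1#) * s in
          ι 2 * K * (K + 1#) * h * v - ι 3 * (K - 1#) * (w * w) - ι 6 * K * (K + 1#) * w * s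
        - K * (K + 1#) * (K + 1#) * t + (K + 1#) * (ι 2 * K + ι 4) * w * s
        - ι 4 * n₁ * K * (K + 1#) * (h * h - k) - ι 4 * n₁ * h * w - ι 2 * n₁ * K * (K + 1#) * h * s

  -- Derivatives at the points

  rise-suc : ∀ i r → rise i (suc r) ≡ ι (suc i) * rise (suc i) r
  rise-suc i zero    rewrite ℕₚ.+-identityʳ i = refl
  rise-suc i (suc r) = begin
    ι (suc (i ℕ.+ suc r)) * rise i (suc r)
      ≡⟨ cong₂ _*_ (cong (λ n → ι (suc n)) (ℕₚ.+-suc i r)) (rise-suc i r) ⟩
    ι (suc (suc i ℕ.+ r)) * (ι (suc i) * rise (suc i) r)
      ≡⟨ solve 3 (λ a b c → a :* (b :* c) := b :* (a :* c)) refl _ _ _ ⟩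
    ι (suc i) * rise (suc i) (suc r) ∎
    where open ≡-Reasoning

  rise-≢0 : ∀ i r → (∀ j → j < i ℕ.+ r → ι (suc j) ≢ 0#) → rise i r ≢ 0#
  rise-≢0 i zero    char = 1≢0
  rise-≢0 i (suc r) char = *-≢0 (char (i ℕ.+ r) (ℕₚ.≤-reflexive (sym (ℕₚ.+-suc i r))))
    (rise-≢0 i r (λ j j< → char j (ℕₚ.<-trans j< (ℕₚ.≤-reflexive (sym (ℕₚ.+-suc i r))))))

  -- At y only those Leibniz terms survive in which all k factors X - y are differentiated;
  -- `rise r k` is (r + k)!/r!.
  power-root-jet : ∀ y k G r → (X- y ^^ k ⊗ G) (r ℕ.+ k) y ≡ rise r k * G r y
  power-root-jet y zero    G r rewrite ℕₚ.+-identityʳ r = at (⊗-identityˡ G) r y ■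
    where
    _■ : ∀ {u v} → u ≡ v → u ≡ 1# * v
    p ■ = trans p (sym (*-identityˡ _))
  power-root-jet y (suc k) G r rewrite ℕₚ.+-suc r k = begin
    ((X- y ⊗ X- y ^^ k) ⊗ G) (suc (r ℕ.+ k)) y
      ≡⟨ at (⊗-assoc (X- y) (X- y ^^ k) G) (suc (r ℕ.+ k)) y ⟩
    (X- y ⊗ H) (suc (r ℕ.+ k)) y
      ≡⟨ X-⊗-suc y H (r ℕ.+ k) y ⟩
    (y - y) * H (suc (r ℕ.+ k)) y + ι (suc (r ℕ.+ k)) * H (r ℕ.+ k) y
      ≡⟨ solve 3 (λ y a b → (y :- y) :* a :+ b := b) refl y (H (suc (r ℕ.+ k)) y) (ι (suc (r ℕ.+ k)) * H (r ℕ.+ k) y) ⟩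
    ι (suc (r ℕ.+ k)) * H (r ℕ.+ k) y
      ≡⟨ cong (ι (suc (r ℕ.+ k)) *_) (power-root-jet y k G r) ⟩
    ι (suc (r ℕ.+ k)) * (rise r k * G r y)
      ≡⟨ *-assoc _ _ _ ⟨
    rise r (suc k) * G r y ∎
    where
    open ≡-Reasoning
    H = X- y ^^ k ⊗ G

  power-jet : ∀ k R y r r′ → R 1 y ≡ R 0 y * r → R 2 y ≡ R 0 y * r′ →
      (R ^^ k) 1 y ≡ (R ^^ k) 0 y * (ι k * r)
    × (R ^^ k) 2 y ≡ (R ^^ k) 0 y * (ι k * (ι k - 1#) * (r * r) + ι k * r′)
  power-jet zero R y r r′ p₁ p₂ =
      solve 1 (λ r → # 0 := # 1 :* (# 0 :* r)) refl r
    , solve 2 (λ r s → # 0 := # 1 :* (# 0 :* (# 0 :- # 1) :* (r :* r)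
                                     :+ # 0 :* s)) refl r r′
  power-jet (suc k) R y r r′ p₁ p₂ =
    let q₁ , q₂ = power-jet k R y r r′ p₁ p₂ in
      trans (cong₂ (λ s t → s * u + z * t) p₁ q₁) (trans
        (solve 4 (λ z u K r → (z :* r) :* u :+ z :* (u :* (K :* r))
                      := z :* u :* ((# 1 :+ K) :* r)) refl z u (ι k) r)
        (cong (λ K → z * u * (K * r)) (sym (ι-suc k))))
    , trans (cong₂ (λ s t → (s * u + t * (R ^^ k) 1 y) + (t * (R ^^ k) 1 y + z * (R ^^ k) 2 y)) p₂ p₁) (trans
        (cong₂ (λ s t → (z * r′ * u + z * r * s) + (z * r * s + z * t)) q₁ q₂) (trans
        (solve 5 (λ z u K r s → (z :* s :* u :+ z :* r :* (u :* (K :* r)))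
              :+ (z :* r :* (u :* (K :* r)) :+ z :* (u :* (K :* (K :- # 1) :* (r :* r) :+ K :* s)))
            := z :* u :* ((# 1 :+ K) :* ((# 1 :+ K) :- # 1) :* (r :* r)
                                  :+ (# 1 :+ K) :* s)) refl z u (ι k) r r′)
        (cong (λ K → z * u * (K * (K - 1#) * (r * r) + K * r′)) (sym (ι-suc k)))))
    where
    z = R 0 y
    u = (R ^^ k) 0 y

  lin≢0 : ∀ N {η} x → η ≢ 0# → ∀ {a} → lin x a ^ suc N ≡ η → lin x a ≢ 0#
  lin≢0 N x η≢0 eq = *-≢0ˡ (λ e → η≢0 (trans (sym eq) e))

  -- If (1 + a x)^N = θ for all nodes a, the derivatives at x are moments of the nodes a / (1 + a x).
  module At (N′ : ℕ) (θ x : Carrier) (θ≢0 : θ ≢ 0#)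
            (a : Carrier) (as : List Carrier) (uniq : Unique (a ∷ as))
            (good : All (Periodic.Good (3 ℕ.+ N′) θ x) (a ∷ as)) where

    k = suc (length as)
    -- This is N + k - 1 for N = 3 + N′. Having N ≥ 3 keeps the exponent N - 3 nonnegative after k +
    -- 2 derivatives.
    m = N′ ℕ.+ (2 ℕ.+ k)
    bs = map (node x) as
    b  = node x a
    f  = phi (a ∷ as) 0 m

    lins : All (λ a → lin x a ≢ 0#) (a ∷ as)
    lins = All.map (lin≢0 (2 ℕ.+ N′) x θ≢0) good

    jet-moment : ∀ i r → i ℕ.+ r ≡ m → f r x ≡ rise i r * (θ * moment (b ∷ bs) r)
    jet-moment i r eq = begin
      phi (a ∷ as) 0 m r x              ≡⟨ cong (λ m → phi (a ∷ as) 0 m r x) (sym eq) ⟩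
      phi (a ∷ as) 0 (i ℕ.+ r) r x      ≡⟨ phi-jet (a ∷ as) 0 i r x ⟩
      rise i r * val (a ∷ as) r i x     ≡⟨ cong (rise i r *_) (val-moment (3 ℕ.+ N′) θ x (a ∷ as) uniq good lins r i count) ⟩
      rise i r * (θ * moment (b ∷ bs) r) ∎
      where
      open ≡-Reasoning
      count : suc (r ℕ.+ i) ≡ 3 ℕ.+ N′ ℕ.+ k
      count = cong suc (trans (ℕₚ.+-comm r i) (trans eq
        (trans (ℕₚ.+-suc N′ (suc k)) (cong suc (ℕₚ.+-suc N′ k)))))

    jet-0 : f 0 x ≡ θ
    jet-0 = trans (jet-moment m 0 (ℕₚ.+-identityʳ m))
      (solve 1 (λ t → # 1 :* (t :* # 1) := t) refl θ)

    jet-low : ∀ r → suc r < k → f (suc r) x ≡ 0#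
    jet-low r r<k = trans (jet-moment (m ℕ.∸ suc r) (suc r) (ℕₚ.m∸n+n≡m
        (ℕₚ.≤-trans (ℕₚ.<⇒≤ r<k) (ℕₚ.≤-trans (ℕₚ.m≤n+m k 2) (ℕₚ.m≤n+m (2 ℕ.+ k) N′)))))
      (trans (cong (λ z → rise (m ℕ.∸ suc r) (suc r) * (θ * z)) (moment-low (b ∷ bs) r (subst (λ l → suc r < suc l) (sym (length-map (node x) as)) r<k)))
        (solve 2 (λ c t → c :* (t :* # 0) := # 0) refl (rise (m ℕ.∸ suc r) (suc r)) θ))

    lead : Carrier
    lead = rise (2 ℕ.+ N′) k * (θ * signedProduct b bs)

    private
      high = moment-high b bs

      at-k : ∀ i → moment (b ∷ bs) (i ℕ.+ suc (length bs)) ≡ moment (b ∷ bs) (i ℕ.+ k)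
      at-k i = cong (λ l → moment (b ∷ bs) (i ℕ.+ suc l)) (length-map (node x) as)

    jet-k : f k x ≡ lead
    jet-k = trans (jet-moment (2 ℕ.+ N′) k (count 2))
      (cong (λ z → rise (2 ℕ.+ N′) k * (θ * z)) (trans (sym (at-k 0)) (proj₁ high)))
      where
      count : ∀ i → i ℕ.+ N′ ℕ.+ k ≡ N′ ℕ.+ (i ℕ.+ k)
      count i = trans (cong (ℕ._+ k) (ℕₚ.+-comm i N′)) (ℕₚ.+-assoc N′ i k)

    jet-suc-k : f (1 ℕ.+ k) x ≡ ι (2 ℕ.+ N′) * h₁ (b ∷ bs) * lead
    jet-suc-k = trans (jet-moment (1 ℕ.+ N′) (1 ℕ.+ k) (sym (ℕₚ.+-suc N′ (1 ℕ.+ k))))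
      (trans (cong₂ (λ y z → y * (θ * z)) (rise-suc (1 ℕ.+ N′) k) (trans (sym (at-k 1)) (proj₁ (proj₂ high))))
        (solve 5 (λ n c t e h → n :* c :* (t :* (e :* h)) := n :* h :* (c :* (t :* e))) refl
           (ι (2 ℕ.+ N′)) (rise (2 ℕ.+ N′) k) θ (signedProduct b bs) (h₁ (b ∷ bs))))

    jet-suc-suc-k : f (2 ℕ.+ k) x ≡ ι (2 ℕ.+ N′) * ι (1 ℕ.+ N′) * h₂ (b ∷ bs) * lead
    jet-suc-suc-k = trans (jet-moment N′ (2 ℕ.+ k) refl)
      (trans (cong₂ (λ y z → y * (θ * z)) (trans (rise-suc N′ (1 ℕ.+ k)) (cong (ι (1 ℕ.+ N′) *_) (rise-suc (1 ℕ.+ N′) k)))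
                (trans (sym (at-k 2)) (proj₂ (proj₂ high))))
        (solve 6 (λ n n′ c t e h → n′ :* (n :* c) :* (t :* (e :* h)) := n :* n′ :* h :* (c :* (t :* e))) refl
           (ι (2 ℕ.+ N′)) (ι (1 ℕ.+ N′)) (rise (2 ℕ.+ N′) k) θ (signedProduct b bs) (h₂ (b ∷ bs))))

    -- The derivative of order k is N (N + 1) ⋯ (N + k - 1) times θ and, up to sign, the product of
    -- the nodes. Its nonvanishing is what keeps f from being zero and makes the later quotients by
    -- values of R and q legitimate.
    lead≢0 : All (_≢ 0#) (a ∷ as) → (∀ j → j < m → ι (suc j) ≢ 0#) → lead ≢ 0#
    lead≢0 as≢0 char = *-≢0
      (rise-≢0 (2 ℕ.+ N′) k (λ j j< → char j (subst (j <_) (trans (cong (ℕ._+ k) (ℕₚ.+-comm 2 N′)) (ℕₚ.+-assoc N′ 2 k)) j<)))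
      (*-≢0 θ≢0 (signedProduct-≢0 b bs (nodes≢0 as≢0 lins)))
      where
      nodes≢0 : ∀ {as} → All (_≢ 0#) as → All (λ a → lin x a ≢ 0#) as → All (_≢ 0#) (map (node x) as)
      nodes≢0 []           []       = []
      nodes≢0 {a ∷ _} (a≢0 ∷ as≢0) (l ∷ ls) =
        (λ e → a≢0 (trans (sym (lin*node x a l)) (trans (cong (lin x a *_) e) (zeroʳ _)))) ∷ nodes≢0 as≢0 ls

  -- Points as roots of P, poles as roots of E

  rootProduct-root : ∀ {y ys} → y ∈ ys → Root (rootProduct ys) y
  rootProduct-root {y} {ys = _ ∷ ys} (here refl) = trans (cong (_* rootProduct ys 0 y) (+-inverseʳ y)) (zeroˡ _)
  rootProduct-root {y} {ys = d ∷ ys} (there y∈)  = trans (cong ((y - d) *_) (rootProduct-root y∈)) (zeroʳ _)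

  Len-rootProduct : ∀ ys → Len (suc (length ys)) (rootProduct ys)
  Len-rootProduct []       = Len-C 1#
  Len-rootProduct (d ∷ ys) = Len-≈ (≈-sym (*-distribʳ-- X (C d) (rootProduct ys)))
    (Len-⊝ (Len-X⊗ (Len-rootProduct ys)) (Len-suc (Len-C⊗ d (Len-rootProduct ys))))

  pole : Carrier → Carrier
  pole a = - (a ⁻¹)

  lin-pole : ∀ {a} → a ≢ 0# → lin (pole a) a ≡ 0#
  lin-pole {a} a≢0 = trans (solve 2 (λ a i → # 1 :+ a :* :- i := # 1 :- a :* i) refl a (a ⁻¹))
    (trans (cong (λ z → 1# - z) (*-inverseʳ a a≢0)) (+-inverseʳ 1#))

  lin-injective : ∀ {x a b} → lin x a ≡ 0# → lin x b ≡ 0# → a ≡ b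
  lin-injective {x} {a} {b} p q = x-y≡0⇒x≡y (*-≡0 x≢0 (trans
      (solve 3 (λ x a b → x :* (a :- b) := (# 1 :+ a :* x) :- (# 1 :+ b :* x)) refl x a b)
      (trans (cong₂ _-_ p q) (+-inverseʳ 0#))))
    where
    x≢0 : x ≢ 0#
    x≢0 refl = 1≢0 (trans (solve 1 (λ a → # 1 := # 1 :+ a :* # 0) refl a) p)

  poles-unique : ∀ {as} → Unique as → All (_≢ 0#) as → Unique (map pole as)
  poles-unique []        []           = []
  poles-unique {a ∷ as} (a∉ ∷ u) (a≢0 ∷ as≢0) =
    All-map⁺ (All.zipWith (λ { (a≢b , b≢0) eq →
      a≢b (lin-injective (lin-pole a≢0) (subst (λ x → lin x _ ≡ 0#) (sym eq) (lin-pole b≢0))) }) (a∉ , as≢0))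
    ∷ poles-unique u as≢0

  linProduct-≢0 : ∀ x as → All (λ a → lin x a ≢ 0#) as → linProduct as 0 x ≢ 0#
  linProduct-≢0 x as ls = proj₁ (linProduct-jet x as ls)

  linProduct-zero : ∀ x {a as} → a ∈ as → Unique as → lin x a ≡ 0# →
                    linProduct as 0 x ≡ 0# × linProduct as 1 x ≢ 0#
  linProduct-zero x {a} {_ ∷ as} (here refl) (a∉ ∷ u) l≡0 =
      trans (cong (_* linProduct as 0 x) l≡0) (zeroˡ _)
    , λ e → *-≢0 a≢0 (linProduct-≢0 x as (All.map (λ a≢b lb≡0 → a≢b (lin-injective l≡0 lb≡0)) a∉))
        (trans (sym (trans (cong₂ (λ s t → s * linProduct as 0 x + t * linProduct as 1 x) (Lin-1 a x) l≡0)
          (solve 3 (λ a e d → a :* e :+ # 0 :* d := a :* e) refl a (linProduct as 0 x) (linProduct as 1 x)))) e)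
    where
    a≢0 : a ≢ 0#
    a≢0 refl = 1≢0 (trans (solve 1 (λ x → # 1 := # 1 :+ # 0 :* x) refl x) l≡0)
  linProduct-zero x {a} {c ∷ as} (there a∈) (c∉ ∷ u) l≡0 =
    let e≡0 , d≢0 = linProduct-zero x a∈ u l≡0 in
      trans (cong (lin x c *_) e≡0) (zeroʳ _)
    , λ e → *-≢0 (λ lc≡0 → All.lookup c∉ a∈ (lin-injective lc≡0 l≡0)) d≢0
        (trans (sym (trans (cong (λ s → Lin c 1 x * s + lin x c * linProduct as 1 x) e≡0)
          (solve 2 (λ u v → u :* # 0 :+ v := v) refl (Lin c 1 x) (lin x c * linProduct as 1 x)))) e)

  infixr 7.5 _·_
  _·_ : Carrier → Jet → Jet
  (c · f) j x = c * f j x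

  Len-· : ∀ {n f} c → Len n f → Len n (c · f)
  Len-· {f = f} c l = Len-≈ (jet (C⊗ c f)) (Len-C⊗ c l)

  -- The factorization f = P^k q and its differential relations

  -- Data at a root y of P = (X - y) R: z = R(y), r = R′/R, r′ = R′′/R, s = q′/q, t = q′′/q, and h,
  -- κ are h₁, h₂ of the nodes a/(1 + a y). The last two equations compare f with P^k q in orders k
  -- + 1 and k + 2, relative to order k.
  record Relations (K n₁ n₂ : Carrier) (P q E : Jet) (y : Carrier) : Set where
    field
      z s t r r′ h κ : Carrier
      z≢0 : z ≢ 0#
      P₀ : P 0 y ≡ 0#
      P₁ : P 1 y ≡ z
      P₂ : P 2 y ≡ ι 2 * (z * r)
      P₃ : P 3 y ≡ ι 3 * (z * r′)
      q₁ : q 1 y ≡ q 0 y * s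
      q₂ : q 2 y ≡ q 0 y * t
      E₁ : E 1 y ≡ E 0 y * h
      E₂ : E 2 y ≡ ι 2 * E 0 y * (h * h - κ)
      eq₁ : (K + 1#) * (K * r + s) ≡ n₁ * h
      eq₂ : (K + 1#) * (K + ι 2) * (K * (K - 1#) * (r * r) + K * r′ + ι 2 * K * r * s + t) ≡ ι 2 * n₁ * n₂ * κ

  module Factorization (N′ : ℕ) (η : Carrier) (η≢0 : η ≢ 0#)
    (a : Carrier) (as : List Carrier) (uniq : Unique (a ∷ as)) (as≢0 : All (_≢ 0#) (a ∷ as))
    (ys : List Carrier) (uys : Unique ys)
    (good : All (λ y → All (Periodic.Good (3 ℕ.+ N′) η y) (a ∷ as)) ys)
    (char : ∀ j → j < N′ ℕ.+ (3 ℕ.+ length as) → ι (suc j) ≢ 0#) where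

    private
      k = suc (length as)
      m = N′ ℕ.+ (2 ℕ.+ k)
      n = length ys
      module A {y} (g : All (Periodic.Good (3 ℕ.+ N′) η y) (a ∷ as)) = At N′ η y η≢0 a as uniq g

    f P : Jet
    f = phi (a ∷ as) 0 m ⊝ C η
    P = rootProduct ys

    f-suc : ∀ j x → f (suc j) x ≡ phi (a ∷ as) 0 m (suc j) x
    f-suc j x = solve 1 (λ u → u :- # 0 := u) refl (phi (a ∷ as) 0 m (suc j) x)

    private
      vanish : ∀ {y} → All (Periodic.Good (3 ℕ.+ N′) η y) (a ∷ as) → Vanish k f y
      vanish g zero    _   = trans (cong (_- η) (A.jet-0 g)) (+-inverseʳ η)
      vanish {y} g (suc j) j<k = trans (f-suc j y) (A.jet-low g j j<k)

      k<m : suc k ≤ m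
      k<m = ℕₚ.≤-trans (ℕₚ.n≤1+n (suc k)) (ℕₚ.m≤n+m (2 ℕ.+ k) N′)

    factorization : ∃ λ q → Len (suc m ℕ.∸ n ℕ.* k) q × f ≈ P ^^ k ⊗ q
    factorization = divide-multiple-roots {f = f} ys k uys
      (λ j j≤k → char j (ℕₚ.<-≤-trans (s≤s j≤k) k<m))
      (Len-⊝ (Len-phi (a ∷ as) m) (Len-≤ (s≤s z≤n) (Len-C η))) (All.map vanish good)

    f≉0 : ∀ {y} → y ∈ ys → ¬ f ≈ C 0#
    f≉0 {y} y∈ f≈0 = A.lead≢0 (All.lookup good y∈) as≢0 char
      (trans (sym (A.jet-k (All.lookup good y∈))) (trans (sym (f-suc (length as) y)) (at f≈0 k y)))

    -- Otherwise the multiplicities exceed the degree, so q and hence f is zero, against the nonzero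
    -- derivative of order k at any one of the points.
    degree-bound : n ℕ.* k ≤ m
    degree-bound = go ys refl
      where
      go : ∀ zs → zs ≡ ys → length zs ℕ.* k ≤ m
      go []       eq = z≤n
      go (y ∷ zs) eq = ℕₚ.≮⇒≥ λ m<nk →
        let q , lq , fq = factorization
            q≈0 = Len-nil (subst (λ l → Len l q) (ℕₚ.m≤n⇒m∸n≡0 (subst (λ zs → m < length zs ℕ.* k) eq m<nk)) lq)
        in f≉0 (subst (y ∈_) eq (here refl))
             (≈-trans fq (≈-trans (⊗-cong (≈-refl {P ^^ k}) q≈0) (⊗-zeroʳ (P ^^ k))))
        where
        Len-nil : ∀ {q} → Len 0 q → q ≈ C 0#
        Len-nil (nil p) = p

    private
      q  = proj₁ factorization
      lq = proj₁ (proj₂ factorization)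
      fq = proj₂ (proj₂ factorization)
      K  = ι k
      n₁ = ι (2 ℕ.+ N′)
      n₂ = ι (1 ℕ.+ N′)
      E  = linProduct (a ∷ as)

    private
      quotient : ∀ u v → u ≢ 0# → v ≡ u * (v * u ⁻¹)
      quotient u v u≢0 = sym (trans (solve 3 (λ u v i → u :* (v :* i) := v :* (u :* i)) refl u v (u ⁻¹))
        (trans (cong (v *_) (*-inverseʳ u u≢0)) (trans (*-comm v 1#) (*-identityˡ v))))

      ι-suc′ : ∀ n → ι (suc n) ≡ ι n + 1#
      ι-suc′ n = trans (ι-suc n) (+-comm 1# (ι n))

    relations : ∀ {y} → y ∈ ys → Relations K n₁ n₂ P q E y
    relations {y} y∈ = record
      { z = R 0 y ; s = s ; t = t ; r = r ; r′ = r′ ; h = h ; κ = κ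
      ; z≢0 = z≢0 ; P₀ = rootProduct-root y∈
      ; P₁ = trans (P-suc 0) (*-identityˡ (R 0 y))
      ; P₂ = trans (P-suc 1) (cong (ι 2 *_) R₁)
      ; P₃ = trans (P-suc 2) (cong (ι 3 *_) R₂)
      ; q₁ = Q₁ ; q₂ = Q₂
      ; E₁ = proj₁ (proj₂ E-jet) ; E₂ = proj₂ (proj₂ E-jet)
      ; eq₁ = e₁ ; eq₂ = e₂ }
      where
      open ≡-Reasoning
      g = All.lookup good y∈
      module B = A g
      E-jet = linProduct-jet y (a ∷ as) B.lins
      division = divide-root y (Len-rootProduct ys) (rootProduct-root y∈)
      R = proj₁ division
      P≈ = proj₂ (proj₂ division)
      G = R ^^ k ⊗ q

      P-suc : ∀ j → P (suc j) y ≡ ι (suc j) * R j y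
      P-suc j = trans (at P≈ (suc j) y) (trans (X-⊗-suc y R j y)
        (solve 3 (λ y u v → (y :- y) :* u :+ v := v) refl y (R (suc j) y) (ι (suc j) * R j y)))

      -- Isolating (X - y)^k turns the derivatives of f of orders k, k + 1 and k + 2 at y into those
      -- of G = R^k q of orders 0, 1 and 2.
      f≈ : f ≈ X- y ^^ k ⊗ G
      f≈ = ≈-trans fq (≈-trans (⊗-cong (≈-trans (^^-cong k P≈) (^^-⊗ (X- y) R k)) (≈-refl {q}))
             (⊗-assoc (X- y ^^ k) (R ^^ k) q))

      f-G : ∀ r → phi (a ∷ as) 0 m (r ℕ.+ k) y ≡ rise r k * G r y
      f-G r = begin
        phi (a ∷ as) 0 m (r ℕ.+ k) y          ≡⟨ cong (λ l → phi (a ∷ as) 0 m l y) (ℕₚ.+-suc r (length as)) ⟩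
        phi (a ∷ as) 0 m (suc (r ℕ.+ length as)) y ≡⟨ f-suc (r ℕ.+ length as) y ⟨
        f (suc (r ℕ.+ length as)) y           ≡⟨ cong (λ l → f l y) (ℕₚ.+-suc r (length as)) ⟨
        f (r ℕ.+ k) y                         ≡⟨ at f≈ (r ℕ.+ k) y ⟩
        (X- y ^^ k ⊗ G) (r ℕ.+ k) y           ≡⟨ power-root-jet y k G r ⟩
        rise r k * G r y                      ∎

      ρ = rise 0 k

      -- Order k is the normalization: it gives G(y) ≠ 0, hence R(y) ≠ 0 and q(y) ≠ 0, and `lead`
      -- cancels from the two higher orders.
      ρG≡lead : ρ * G 0 y ≡ B.lead
      ρG≡lead = trans (sym (f-G 0)) B.jet-k
      ρG≢0 : ρ * G 0 y ≢ 0#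
      ρG≢0 e = B.lead≢0 as≢0 char (trans (sym ρG≡lead) e)
      G≢0 : G 0 y ≢ 0#
      G≢0 = *-≢0ʳ ρG≢0
      z≢0 : R 0 y ≢ 0#
      z≢0 = *-≢0ˡ (*-≢0ˡ G≢0)
      q≢0 : q 0 y ≢ 0#
      q≢0 = *-≢0ʳ G≢0

      r  = R 1 y * R 0 y ⁻¹
      r′ = R 2 y * R 0 y ⁻¹
      s  = q 1 y * q 0 y ⁻¹
      t  = q 2 y * q 0 y ⁻¹
      R₁ : R 1 y ≡ R 0 y * r
      R₁ = quotient (R 0 y) (R 1 y) z≢0
      R₂ : R 2 y ≡ R 0 y * r′
      R₂ = quotient (R 0 y) (R 2 y) z≢0
      Q₁ : q 1 y ≡ q 0 y * s
      Q₁ = quotient (q 0 y) (q 1 y) q≢0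
      Q₂ : q 2 y ≡ q 0 y * t
      Q₂ = quotient (q 0 y) (q 2 y) q≢0
      u = (R ^^ k) 0 y
      U = power-jet k R y r r′ R₁ R₂

      G₁ : G 1 y ≡ G 0 y * (K * r + s)
      G₁ = trans (cong₂ (λ v w → v * q 0 y + u * w) (proj₁ U) Q₁)
        (solve 4 (λ u q v s → u :* v :* q :+ u :* (q :* s) := u :* q :* (v :+ s)) refl u (q 0 y) (K * r) s)
      G₂ : G 2 y ≡ G 0 y * (K * (K - 1#) * (r * r) + K * r′ + ι 2 * K * r * s + t)
      G₂ = trans (cong₂ (λ v w → (v * q 0 y + (R ^^ k) 1 y * q 1 y) + ((R ^^ k) 1 y * q 1 y + u * w)) (proj₂ U) Q₂)
        (trans (cong₂ (λ v w → (u * (K * (K - 1#) * (r * r) + K * r′) * q 0 y + v * w) + (v * w + u * (q 0 y * t))) (proj₁ U) Q₁)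
        (solve 7 (λ u q K r r′ s t →
            (u :* (K :* (K :- # 1) :* (r :* r) :+ K :* r′) :* q :+ u :* (K :* r) :* (q :* s))
            :+ (u :* (K :* r) :* (q :* s) :+ u :* (q :* t))
            := u :* q :* (K :* (K :- # 1) :* (r :* r) :+ K :* r′ :+ # 2 :* K :* r :* s :+ t))
          refl u (q 0 y) K r r′ s t))

      rise-1 : rise 1 k ≡ (K + 1#) * ρ
      rise-1 = trans (sym (*-identityˡ _)) (trans (sym (rise-suc 0 k)) (cong (_* ρ) (ι-suc′ k)))
      rise-2 : ι 2 * rise 2 k ≡ (K + ι 2) * ((K + 1#) * ρ)
      rise-2 = trans (sym (rise-suc 1 k)) (cong₂ _*_
        (trans (ι-suc′ (suc k)) (trans (cong (_+ 1#) (ι-suc′ k)) (solve 1 (λ K → K :+ # 1 :+ # 1 := K :+ # 2) refl K))) rise-1)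

      h = h₁ (B.b ∷ B.bs)
      κ = h₂ (B.b ∷ B.bs)

      e₁ : (K + 1#) * (K * r + s) ≡ n₁ * h
      e₁ = *-cancelˡ ρG≢0 (begin
        ρ * G 0 y * ((K + 1#) * (K * r + s))
          ≡⟨ solve 4 (λ p g k v → p :* g :* (k :* v) := k :* p :* (g :* v)) refl ρ (G 0 y) (K + 1#) (K * r + s) ⟩
        (K + 1#) * ρ * (G 0 y * (K * r + s))
          ≡⟨ cong₂ _*_ (sym rise-1) (sym G₁) ⟩
        rise 1 k * G 1 y            ≡⟨ f-G 1 ⟨
        phi (a ∷ as) 0 m (1 ℕ.+ k) y ≡⟨ B.jet-suc-k ⟩
        n₁ * h * B.lead             ≡⟨ cong (n₁ * h *_) ρG≡lead ⟨
        n₁ * h * (ρ * G 0 y)        ≡⟨ *-comm _ _ ⟩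
        ρ * G 0 y * (n₁ * h)        ∎)

      v₂ = K * (K - 1#) * (r * r) + K * r′ + ι 2 * K * r * s + t

      e₂ : (K + 1#) * (K + ι 2) * v₂ ≡ ι 2 * n₁ * n₂ * κ
      e₂ = *-cancelˡ ρG≢0 (begin
        ρ * G 0 y * ((K + 1#) * (K + ι 2) * v₂)
          ≡⟨ solve 5 (λ p g k k′ v → p :* g :* (k :* k′ :* v) := k′ :* (k :* p) :* (g :* v)) refl ρ (G 0 y) (K + 1#) (K + ι 2) v₂ ⟩
        (K + ι 2) * ((K + 1#) * ρ) * (G 0 y * v₂)
          ≡⟨ cong₂ _*_ (sym rise-2) (sym G₂) ⟩
        ι 2 * rise 2 k * G 2 y        ≡⟨ *-assoc _ _ _ ⟩
        ι 2 * (rise 2 k * G 2 y)      ≡⟨ cong (ι 2 *_) (sym (f-G 2)) ⟩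
        ι 2 * phi (a ∷ as) 0 m (2 ℕ.+ k) y ≡⟨ cong (ι 2 *_) B.jet-suc-suc-k ⟩
        ι 2 * (n₁ * n₂ * κ * B.lead)  ≡⟨ cong (λ l → ι 2 * (n₁ * n₂ * κ * l)) ρG≡lead ⟨
        ι 2 * (n₁ * n₂ * κ * (ρ * G 0 y))
          ≡⟨ solve 5 (λ w m n k v → w :* (m :* n :* k :* v) := v :* (w :* m :* n :* k)) refl (ι 2) n₁ n₂ κ (ρ * G 0 y) ⟩
        ρ * G 0 y * (ι 2 * n₁ * n₂ * κ) ∎)

    -- At a root of P, where P′ = R and P′′ = 2R′, this is 2 E P′ q times the difference of the two
    -- sides of `eq₁`. So W vanishes at all the points and P divides it.
    W : Jet
    W = ((K + 1#) · (E ⊗ (K · (D (D P) ⊗ q) ⊕ ι 2 · (D P ⊗ D q)))) ⊝ (ι 2 * n₁) · (D E ⊗ (D P ⊗ q))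

    W-root : ∀ {y} → y ∈ ys → Root W y
    W-root {y} y∈ = begin
      (K + 1#) * (E 0 y * (K * (P 2 y * q 0 y) + ι 2 * (P 1 y * q 1 y))) - ι 2 * n₁ * (E 1 y * (P 1 y * q 0 y))
        ≡⟨ cong₂ (λ v w → (K + 1#) * (E 0 y * (K * (v * q 0 y) + ι 2 * (w * q 1 y))) - ι 2 * n₁ * (E 1 y * (w * q 0 y))) P₂ P₁ ⟩
      (K + 1#) * (E 0 y * (K * (ι 2 * (z * r) * q 0 y) + ι 2 * (z * q 1 y))) - ι 2 * n₁ * (E 1 y * (z * q 0 y))
        ≡⟨ cong₂ (λ v w → (K + 1#) * (E 0 y * (K * (ι 2 * (z * r) * q 0 y) + ι 2 * (z * v))) - ι 2 * n₁ * (w * (z * q 0 y))) q₁ E₁ ⟩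
      (K + 1#) * (E 0 y * (K * (ι 2 * (z * r) * q 0 y) + ι 2 * (z * (q 0 y * s)))) - ι 2 * n₁ * (E 0 y * h * (z * q 0 y))
        ≡⟨ solve 8 (λ K n e z q r s h →
             (K :+ # 1) :* (e :* (K :* (# 2 :* (z :* r) :* q) :+ # 2 :* (z :* (q :* s))))
               :- # 2 :* n :* (e :* h :* (z :* q))
             := # 2 :* e :* z :* q :* ((K :+ # 1) :* (K :* r :+ s) :- n :* h))
             refl K n₁ (E 0 y) z (q 0 y) r s h ⟩
      ι 2 * E 0 y * z * q 0 y * ((K + 1#) * (K * r + s) - n₁ * h)
        ≡⟨ cong (ι 2 * E 0 y * z * q 0 y *_) (x≡y⇒x-y≡0 eq₁) ⟩
      ι 2 * E 0 y * z * q 0 y * 0#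
        ≡⟨ zeroʳ _ ⟩
      0# ∎
      where
      open ≡-Reasoning
      open Relations (relations y∈)

    -- On the roots of P, T is determined by W′ = T P′; there the second-order information on f
    -- becomes a polynomial relation between T, E and q alone.
    module Eliminated (lq≤k : suc m ℕ.∸ n ℕ.* k ≤ k) where

      private
        Lq : Len k q
        Lq = Len-≤ lq≤k lq
        LDq : Len k (D q)
        LDq = Len-≤ ℕₚ.pred[n]≤n (Len-D Lq)
        LDDq : Len k (D (D q))
        LDDq = Len-≤ ℕₚ.pred[n]≤n (Len-D LDq)
        LE : Len (suc k) E
        LE = Len-linProduct (a ∷ as)
        LDE : Len (suc k) (D E)
        LDE = Len-≤ ℕₚ.pred[n]≤n (Len-D LE)
        LDDE : Len (suc k) (D (D E))
        LDDE = Len-≤ ℕₚ.pred[n]≤n (Len-D LDE)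
        LDP : Len n (D P)
        LDP = Len-D (Len-rootProduct ys)
        LDDP : Len n (D (D P))
        LDDP = Len-≤ ℕₚ.pred[n]≤n (Len-D LDP)

        LW : Len (suc k ℕ.+ (n ℕ.+ k)) W
        LW = Len-⊝ (Len-· (K + 1#) (Len-⊗ LE (Len-⊕ (Len-· K (Len-⊗ LDDP Lq)) (Len-· (ι 2) (Len-⊗ LDP LDq)))))
                   (Len-· (ι 2 * n₁) (Len-⊗ LDE (Len-⊗ LDP Lq)))

        T-division = divide-roots ys uys LW (All.tabulate W-root)

      T : Jet
      T = proj₁ T-division

      private
        LT : Len (suc k ℕ.+ k) T
        LT = subst (λ l → Len l T) count (proj₁ (proj₂ T-division))
          where
          count : suc k ℕ.+ (n ℕ.+ k) ℕ.∸ n ≡ suc k ℕ.+ k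
          count = trans (cong (ℕ._∸ n) (trans (sym (ℕₚ.+-assoc (suc k) n k)) (trans (cong (ℕ._+ k) (ℕₚ.+-comm (suc k) n)) (ℕₚ.+-assoc n (suc k) k))))
                        (ℕₚ.m+n∸m≡n n (suc k ℕ.+ k))
        W≈ : W ≈ P ⊗ T
        W≈ = proj₂ (proj₂ T-division)

      -- The identity `eliminate` multiplied by E² q², which removes the quotients E′/E, E′′/E, q′/q
      -- and q′′/q, with T E q in place of E² q² times W′/(P′ E q). Its degree is bounded in terms
      -- of k alone.
      Z : Jet
      Z = (K * (K + 1#) * (K + ι 2)) · (T ⊗ (E ⊗ q)) ⊝
          ( coeffA K n₁ n₂ · ((D E ⊗ D E) ⊗ (q ⊗ q))
          ⊝ coeffC K n₁ n₂ · ((E ⊗ D (D E)) ⊗ (q ⊗ q))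
          ⊕ (ι 2 * n₁ * (K + 1#) * (K + ι 2)) · ((E ⊗ D E) ⊗ (q ⊗ D q))
          ⊕ ((K - 1#) * (K + 1#) * (K + 1#) * (K + ι 2)) · ((E ⊗ E) ⊗ (D q ⊗ D q))
          ⊝ (K * (K + 1#) * (K + 1#) * (K + ι 2)) · ((E ⊗ E) ⊗ (q ⊗ D (D q))))

      Z-root : ∀ {y} → y ∈ ys → Root Z y
      Z-root {y} y∈ = begin
        Z₀ (E 1 y) (E 2 y) (q 1 y) (q 2 y) (T 0 y)
          ≡⟨ cong₂ (λ v w → Z₀ v w (q 1 y) (q 2 y) (T 0 y)) E₁ E₂ ⟩
        Z₀ (e * h) (ι 2 * e * (h * h - κ)) (q 1 y) (q 2 y) (T 0 y)
          ≡⟨ cong₂ (λ v w → Z₀ (e * h) (ι 2 * e * (h * h - κ)) v w (T 0 y)) q₁ q₂ ⟩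
        Z₀ (e * h) (ι 2 * e * (h * h - κ)) (q₀ * s) (q₀ * t) (T 0 y)
          ≡⟨ cong (Z₀ (e * h) (ι 2 * e * (h * h - κ)) (q₀ * s) (q₀ * t)) T₀ ⟩
        Z₀ (e * h) (ι 2 * e * (h * h - κ)) (q₀ * s) (q₀ * t) (e * q₀ * β)
          ≡⟨ solve 13 (λ K₃ A C b d e′ β e q h k s t →
               K₃ :* (e :* q :* β :* (e :* q)) :-
               ( A :* ((e :* h :* (e :* h)) :* (q :* q)) :- C :* ((e :* (# 2 :* e :* (h :* h :- k))) :* (q :* q))
               :+ b :* ((e :* (e :* h)) :* (q :* (q :* s)))
               :+ d :* ((e :* e) :* (q :* s :* (q :* s))) :- e′ :* ((e :* e) :* (q :* (q :* t))))
               := e :* e :* q :* q :* (K₃ :* β :-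
                 (A :* (h :* h) :- C :* (# 2 :* (h :* h :- k)) :+ b :* (h :* s) :+ d :* (s :* s) :- e′ :* t)))
               refl κ₃ A C′ b′ d′ e′ β e q₀ h κ s t ⟩
        e * e * q₀ * q₀ * (κ₃ * β - quadratic K n₁ n₂ h κ s t)
          ≡⟨ cong (e * e * q₀ * q₀ *_) (x≡y⇒x-y≡0 (eliminate K n₁ n₂ h κ r r′ s t eq₁ eq₂)) ⟩
        e * e * q₀ * q₀ * 0#
          ≡⟨ zeroʳ _ ⟩
        0# ∎
        where
        open ≡-Reasoning
        open Relations (relations y∈)
        e  = E 0 y
        q₀ = q 0 y
        κ₃ = K * (K + 1#) * (K + ι 2)
        A  = coeffA K n₁ n₂
        C′ = coeffC K n₁ n₂
        b′ = ι 2 * n₁ * (K + 1#) * (K + ι 2)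
        d′ = (K - 1#) * (K + 1#) * (K + 1#) * (K + ι 2)
        e′ = K * (K + 1#) * (K + 1#) * (K + ι 2)
        β  = (K + 1#) * (h * (ι 2 * K * r + ι 2 * s) + (ι 3 * K * r′ + (ι 2 * K + ι 4) * r * s + ι 2 * t))
               - ι 2 * n₁ * (ι 2 * (h * h - κ) + ι 2 * h * r + h * s)

        Z₀ : (E₁ E₂ q₁ q₂ T₀ : Carrier) → Carrier
        Z₀ E₁ E₂ q₁ q₂ T₀ = κ₃ * (T₀ * (e * q₀)) -
          ( A * ((E₁ * E₁) * (q₀ * q₀)) - C′ * ((e * E₂) * (q₀ * q₀)) + b′ * ((e * E₁) * (q₀ * q₁))
          + d′ * ((e * e) * (q₁ * q₁)) - e′ * ((e * e) * (q₀ * q₂)))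

        W₁ : (E₁ E₂ P₁ P₂ P₃ q₁ q₂ : Carrier) → Carrier
        W₁ E₁ E₂ P₁ P₂ P₃ q₁ q₂ =
            (K + 1#) * (E₁ * (K * (P₂ * q₀) + ι 2 * (P₁ * q₁))
              + e * (K * (P₃ * q₀ + P₂ * q₁) + ι 2 * (P₂ * q₁ + P₁ * q₂)))
          - ι 2 * n₁ * (E₂ * (P₁ * q₀) + E₁ * (P₂ * q₀ + P₁ * q₁))

        -- At a root of P the derivative of W = P T is P′ T, so T is found by differentiating W and
        -- cancelling z.
        T₀ : T 0 y ≡ e * q₀ * β
        T₀ = *-cancelˡ z≢0 (begin
          z * T 0 y                            ≡⟨ solve 3 (λ z t u → z :* t := z :* t :+ # 0 :* u) refl z (T 0 y) (T 1 y) ⟩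
          z * T 0 y + 0# * T 1 y               ≡⟨ cong₂ (λ v w → v * T 0 y + w * T 1 y) P₁ P₀ ⟨
          (P ⊗ T) 1 y                          ≡⟨ at W≈ 1 y ⟨
          W₁ (E 1 y) (E 2 y) (P 1 y) (P 2 y) (P 3 y) (q 1 y) (q 2 y)
            ≡⟨ cong₂ (λ v w → W₁ v w (P 1 y) (P 2 y) (P 3 y) (q 1 y) (q 2 y)) E₁ E₂ ⟩
          W₁ (e * h) (ι 2 * e * (h * h - κ)) (P 1 y) (P 2 y) (P 3 y) (q 1 y) (q 2 y)
            ≡⟨ cong₂ (λ v w → W₁ (e * h) (ι 2 * e * (h * h - κ)) v w (P 3 y) (q 1 y) (q 2 y)) P₁ P₂ ⟩
          W₁ (e * h) (ι 2 * e * (h * h - κ)) z (ι 2 * (z * r)) (P 3 y) (q 1 y) (q 2 y)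
            ≡⟨ cong₂ (λ v w → W₁ (e * h) (ι 2 * e * (h * h - κ)) z (ι 2 * (z * r)) v w (q 2 y)) P₃ q₁ ⟩
          W₁ (e * h) (ι 2 * e * (h * h - κ)) z (ι 2 * (z * r)) (ι 3 * (z * r′)) (q₀ * s) (q 2 y)
            ≡⟨ cong (λ v → W₁ (e * h) (ι 2 * e * (h * h - κ)) z (ι 2 * (z * r)) (ι 3 * (z * r′)) (q₀ * s) v) q₂ ⟩
          W₁ (e * h) (ι 2 * e * (h * h - κ)) z (ι 2 * (z * r)) (ι 3 * (z * r′)) (q₀ * s) (q₀ * t)
            ≡⟨ solve 11 (λ K n e z q r r′ s t h k →
                 let two = # 2; P₂ = two :* (z :* r); q₁ = q :* s in
                 (K :+ # 1) :* (e :* h :* (K :* (P₂ :* q) :+ two :* (z :* q₁))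
                   :+ e :* (K :* (# 3 :* (z :* r′) :* q :+ P₂ :* q₁) :+ two :* (P₂ :* q₁ :+ z :* (q :* t))))
                 :- two :* n :* (two :* e :* (h :* h :- k) :* (z :* q) :+ e :* h :* (P₂ :* q :+ z :* q₁))
                 := z :* (e :* q :* ((K :+ # 1) :* (h :* (two :* K :* r :+ two :* s)
                      :+ (# 3 :* K :* r′ :+ (two :* K :+ # 4) :* r :* s :+ two :* t))
                    :- two :* n :* (two :* (h :* h :- k) :+ two :* h :* r :+ h :* s))))
                 refl K n₁ e z q₀ r r′ s t h κ ⟩
          z * (e * q₀ * β) ∎)

      private
        LZ : Len (suc k ℕ.+ k ℕ.+ (suc k ℕ.+ k)) Z
        LZ = Len-⊝ (Len-· _ (Len-⊗ LT (Len-⊗ LE Lq)))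
          (Len-⊝ (Len-⊕ (Len-⊕ (Len-⊝
            (Len-· _ (small (Len-⊗ (Len-⊗ LDE LDE) (Len-⊗ Lq Lq))))
            (Len-· _ (small (Len-⊗ (Len-⊗ LE LDDE) (Len-⊗ Lq Lq)))))
            (Len-· _ (small (Len-⊗ (Len-⊗ LE LDE) (Len-⊗ Lq LDq)))))
            (Len-· _ (small (Len-⊗ (Len-⊗ LE LE) (Len-⊗ LDq LDq)))))
            (Len-· _ (small (Len-⊗ (Len-⊗ LE LE) (Len-⊗ Lq LDDq)))))
          where
          small : ∀ {g} → Len (suc k ℕ.+ suc k ℕ.+ (k ℕ.+ k)) g → Len (suc k ℕ.+ k ℕ.+ (suc k ℕ.+ k)) g
          small {g} = subst (λ l → Len l g) (interchange (suc k) (suc k) k k)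
            where
            interchange : ∀ a b c d → a ℕ.+ b ℕ.+ (c ℕ.+ d) ≡ a ℕ.+ c ℕ.+ (b ℕ.+ d)
            interchange a b c d = trans (ℕₚ.+-assoc a b (c ℕ.+ d)) (trans (cong (a ℕ.+_)
              (trans (sym (ℕₚ.+-assoc b c d)) (trans (cong (ℕ._+ d) (ℕₚ.+-comm b c)) (ℕₚ.+-assoc c b d))))
              (sym (ℕₚ.+-assoc a c (b ℕ.+ d))))

      -- Z has at least as many roots as coefficients and is zero. At a pole -1/a, a simple root of
      -- E, what remains of it is `coeffA` E′² q² up to sign. The nonzero q has at most k
      -- coefficients, so it does not vanish at all k poles.
      coeffA≡0 : suc k ℕ.+ k ℕ.+ (suc k ℕ.+ k) ≤ n → coeffA K n₁ n₂ ≡ 0#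
      coeffA≡0 large = conclude (find (¬All⇒Any¬ (λ a → q 0 (pole a) ≟ 0#) (a ∷ as) not-all))
        where
        y∈ : ∃ λ y → y ∈ ys
        y∈ = nonempty ys (ℕₚ.≤-trans (s≤s z≤n) large)
          where
          nonempty : ∀ zs → 0 < length zs → ∃ λ y → y ∈ zs
          nonempty (y ∷ zs) _ = y , here refl

        Z≈0 : Z ≈ C 0#
        Z≈0 = ≈0-of-roots ys uys LZ (All.tabulate Z-root) large

        not-all : ¬ All (λ a → q 0 (pole a) ≡ 0#) (a ∷ as)
        not-all all = f≉0 (proj₂ y∈) (≈-trans fq (≈-trans (⊗-cong (≈-refl {P ^^ k})
          (≈0-of-roots (map pole (a ∷ as)) (poles-unique uniq as≢0) Lq (All-map⁺ all)
             (ℕₚ.≤-reflexive (sym (length-map pole (a ∷ as)))))) (⊗-zeroʳ (P ^^ k))))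

        conclude : ∃ (λ c → c ∈ a ∷ as × q 0 (pole c) ≢ 0#) → coeffA K n₁ n₂ ≡ 0#
        conclude (c , c∈ , q≢0) =
          let E≡0 , E′≢0 = linProduct-zero (pole c) c∈ uniq (lin-pole (All.lookup as≢0 c∈))
          in *-≡0 (*-≢0 (*-≢0 E′≢0 E′≢0) (*-≢0 q≢0 q≢0)) (at-root (pole c) E≡0)
          where
          open ≡-Reasoning
          at-root : ∀ x → E 0 x ≡ 0# → E 1 x * E 1 x * (q 0 x * q 0 x) * coeffA K n₁ n₂ ≡ 0#
          at-root x E≡0 = begin
            E 1 x * E 1 x * (q 0 x * q 0 x) * A
              ≡⟨ solve 12 (λ κ T q A C b d e′ E₁ E₂ q₁ q₂ →
                   let z = # 0 in
                   E₁ :* E₁ :* (q :* q) :* A := :- (κ :* (T :* (z :* q)) :-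
                     (A :* (E₁ :* E₁ :* (q :* q)) :- C :* (z :* E₂ :* (q :* q)) :+ b :* (z :* E₁ :* (q :* q₁))
                     :+ d :* (z :* z :* (q₁ :* q₁)) :- e′ :* (z :* z :* (q :* q₂)))))
                   refl κ (T 0 x) (q 0 x) A C′ b′ d′ e′ (E 1 x) (E 2 x) (q 1 x) (q 2 x) ⟩
            - Z₀ 0#
              ≡⟨ cong (λ e → - Z₀ e) E≡0 ⟨
            - Z 0 x
              ≡⟨ cong -_ (at Z≈0 0 x) ⟩
            - 0#
              ≡⟨ solve 0 (:- # 0 := # 0) refl ⟩
            0# ∎
            where
            κ A C′ b′ d′ e′ : Carrier
            κ  = K * (K + 1#) * (K + ι 2)
            A  = coeffA K n₁ n₂
            C′ = coeffC K n₁ n₂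
            b′ = ι 2 * n₁ * (K + 1#) * (K + ι 2)
            d′ = (K - 1#) * (K + 1#) * (K + 1#) * (K + ι 2)
            e′ = K * (K + 1#) * (K + 1#) * (K + ι 2)
            Z₀ : Carrier → Carrier
            Z₀ e = κ * (T 0 x * (e * q 0 x)) -
              ( A * (E 1 x * E 1 x * (q 0 x * q 0 x)) - C′ * (e * E 2 x * (q 0 x * q 0 x)) + b′ * (e * E 1 x * (q 0 x * q 1 x))
              + d′ * (e * e * (q 1 x * q 1 x)) - e′ * (e * e * (q 0 x * q 2 x)))

  -- Two nodes: values at the poles and the coset polynomial

  a*pole : ∀ {a} → a ≢ 0# → a * pole a ≡ - 1#
  a*pole {a} a≢0 = trans (solve 2 (λ a i → a :* :- i := :- (a :* i)) refl a (a ⁻¹)) (cong -_ (*-inverseʳ a a≢0))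

  x²≡1 : ∀ {x} → x * x ≡ 1# → x ≡ 1# ⊎ x ≡ - 1#
  x²≡1 {x} eq with x ≟ 1#
  ... | yes x≡1 = inj₁ x≡1
  ... | no x≢1  = inj₂ (x-y≡0⇒x≡y (*-≡0 (x≢y⇒x-y≢0 x≢1) (trans
      (solve 1 (λ x → (x :- # 1) :* (x :- :- # 1) := x :* x :- # 1) refl x)
      (x≡y⇒x-y≡0 eq))))

  val-singleton₀ : ∀ a m x → val (a ∷ []) 0 m x ≡ lin x a ^ m
  val-singleton₀ a m x = trans (cong (λ m → val (a ∷ []) 0 m x) (sym (ℕₚ.+-identityʳ m)))
    (trans (val-singleton a m 0 x) (trans (*-comm _ _) (*-identityˡ _)))

  -- At -1/a the power of 1 + aX drops out of `val-swap`, and a (1 - b/a) = a - b cancels the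
  -- denominator. This lowers the exponent to N, so that for p = 2N + 1 the value is 1 or -1.
  val-pole : ∀ {a b} → a ≢ b → a ≢ 0# → b ≢ 0# → ∀ N →
      val (a ∷ b ∷ []) 0 (suc N) (pole a) ≡ lin (pole a) b ^ N
    × val (a ∷ b ∷ []) 0 (suc N) (pole b) ≡ lin (pole b) a ^ N
  val-pole {a} {b} a≢b a≢0 b≢0 N =
      *-cancelˡ (x≢y⇒x-y≢0 a≢b) (begin
        (a - b) * val (a ∷ b ∷ []) 0 (suc N) (pole a)  ≡⟨ val-swap a b [] (suc N) (pole a) ⟩
        a * val (b ∷ []) 0 (suc N) (pole a) - b * val (a ∷ []) 0 (suc N) (pole a)
          ≡⟨ cong₂ (λ u v → a * u - b * v) (val-singleton₀ b (suc N) (pole a))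
               (trans (val-singleton₀ a (suc N) (pole a)) (trans (cong (_* (lin (pole a) a ^ N)) (lin-pole a≢0)) (zeroˡ _))) ⟩
        a * (lin (pole a) b * l) - b * 0#
          ≡⟨ solve 4 (λ a b x l → a :* ((# 1 :+ b :* x) :* l) :- b :* # 0
               := (a :+ b :* (a :* x)) :* l) refl a b (pole a) l ⟩
        (a + b * (a * pole a)) * l
          ≡⟨ cong (λ z → (a + b * z) * l) (a*pole a≢0) ⟩
        (a + b * - 1#) * l
          ≡⟨ solve 3 (λ a b l → (a :+ b :* :- # 1) :* l := (a :- b) :* l) refl a b l ⟩
        (a - b) * l ∎)
    , *-cancelˡ (x≢y⇒x-y≢0 a≢b) (begin
        (a - b) * val (a ∷ b ∷ []) 0 (suc N) (pole b)  ≡⟨ val-swap a b [] (suc N) (pole b) ⟩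
        a * val (b ∷ []) 0 (suc N) (pole b) - b * val (a ∷ []) 0 (suc N) (pole b)
          ≡⟨ cong₂ (λ u v → a * u - b * v)
               (trans (val-singleton₀ b (suc N) (pole b)) (trans (cong (_* (lin (pole b) b ^ N)) (lin-pole b≢0)) (zeroˡ _)))
               (val-singleton₀ a (suc N) (pole b)) ⟩
        a * 0# - b * (lin (pole b) a * l′)
          ≡⟨ solve 4 (λ a b x l → a :* # 0 :- b :* ((# 1 :+ a :* x) :* l)
               := (:- b :- a :* (b :* x)) :* l) refl a b (pole b) l′ ⟩
        (- b - a * (b * pole b)) * l′
          ≡⟨ cong (λ z → (- b - a * z) * l′) (a*pole b≢0) ⟩
        (- b - a * - 1#) * l′
          ≡⟨ solve 3 (λ a b l → (:- b :- a :* :- # 1) :* l := (a :- b) :* l) refl a b l′ ⟩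
        (a - b) * l′ ∎)
    where
    open ≡-Reasoning
    l  = lin (pole a) b ^ N
    l′ = lin (pole b) a ^ N

  scaled : Carrier → List Carrier → Jet
  scaled a ds = rootProduct (map (a *_) ds)

  -- With n roots d, ∏ (X - a d) = a^n P(X/a); the equations are the chain rule without
  -- denominators. The point -1 corresponds to the pole -1/a, so one value at -1 serves both nodes.
  scaled-jet : ∀ {a} → a ≢ 0# → ∀ ds → let c = a ^ length ds; P = rootProduct ds in
      scaled a ds 0 0# ≡ c * P 0 0#
    × a * scaled a ds 1 0# ≡ c * P 1 0#
    × a * a * scaled a ds 2 0# ≡ c * P 2 0#
    × scaled a ds 0 (- 1#) ≡ c * P 0 (pole a)
  scaled-jet {a} a≢0 [] = solve 0 (# 1 := # 1 :* # 1) refl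
    , solve 1 (λ a → a :* # 0 := # 1 :* # 0) refl a
    , solve 1 (λ a → a :* a :* # 0 := # 1 :* # 0) refl a
    , solve 0 (# 1 := # 1 :* # 1) refl
  scaled-jet {a} a≢0 (d ∷ ds) =
    let p₀ , p₁ , p₂ , p₃ = scaled-jet a≢0 ds in
      trans (cong ((0# - a * d) *_) p₀)
        (solve 4 (λ a d c p → (# 0 :- a :* d) :* (c :* p) := a :* c :* ((# 0 :- d) :* p)) refl a d c (P 0 0#))
    , (begin
        a * scaled a (d ∷ ds) 1 0#
          ≡⟨ cong (a *_) (X-⊗-suc (a * d) Q 0 0#) ⟩
        a * ((0# - a * d) * Q 1 0# + 1# * Q 0 0#)
          ≡⟨ solve 4 (λ a d q r → a :* ((# 0 :- a :* d) :* q :+ # 1 :* r)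
                := (# 0 :- a :* d) :* (a :* q) :+ a :* r) refl a d (Q 1 0#) (Q 0 0#) ⟩
        (0# - a * d) * (a * Q 1 0#) + a * Q 0 0#
          ≡⟨ cong₂ (λ u v → (0# - a * d) * u + a * v) p₁ p₀ ⟩
        (0# - a * d) * (c * P 1 0#) + a * (c * P 0 0#)
          ≡⟨ solve 5 (λ a d c q r → (# 0 :- a :* d) :* (c :* q) :+ a :* (c :* r)
                := a :* c :* ((# 0 :- d) :* q :+ # 1 :* r)) refl a d c (P 1 0#) (P 0 0#) ⟩
        a * c * ((0# - d) * P 1 0# + 1# * P 0 0#)
          ≡⟨ cong (a * c *_) (X-⊗-suc d P 0 0#) ⟨
        a * c * rootProduct (d ∷ ds) 1 0# ∎)
    , (begin
        a * a * scaled a (d ∷ ds) 2 0#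
          ≡⟨ cong (a * a *_) (X-⊗-suc (a * d) Q 1 0#) ⟩
        a * a * ((0# - a * d) * Q 2 0# + ι 2 * Q 1 0#)
          ≡⟨ solve 4 (λ a d q r → a :* a :* ((# 0 :- a :* d) :* q :+ # 2 :* r)
                := (# 0 :- a :* d) :* (a :* a :* q) :+ # 2 :* a :* (a :* r)) refl a d (Q 2 0#) (Q 1 0#) ⟩
        (0# - a * d) * (a * a * Q 2 0#) + ι 2 * a * (a * Q 1 0#)
          ≡⟨ cong₂ (λ u v → (0# - a * d) * u + ι 2 * a * v) p₂ p₁ ⟩
        (0# - a * d) * (c * P 2 0#) + ι 2 * a * (c * P 1 0#)
          ≡⟨ solve 5 (λ a d c q r → (# 0 :- a :* d) :* (c :* q) :+ # 2 :* a :* (c :* r)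
                := a :* c :* ((# 0 :- d) :* q :+ # 2 :* r)) refl a d c (P 2 0#) (P 1 0#) ⟩
        a * c * ((0# - d) * P 2 0# + ι 2 * P 1 0#)
          ≡⟨ cong (a * c *_) (X-⊗-suc d P 1 0#) ⟨
        a * c * rootProduct (d ∷ ds) 2 0# ∎)
    , trans (cong₂ (λ u v → (u - a * d) * v) (sym (a*pole a≢0)) p₃)
        (solve 5 (λ a d x c p → (a :* x :- a :* d) :* (c :* p) := a :* c :* ((x :- d) :* p)) refl a d (pole a) c (P 0 (pole a)))
    where
    open ≡-Reasoning
    c = a ^ length ds
    P = rootProduct ds
    Q = scaled a ds

  Len-const : ∀ {g} → Len 1 g → g ≈ C (g 0 0#)
  Len-const (cons c g (nil q) p) = ≈-trans p≈ (C-cong (sym (at p≈ 0 0#)))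
    where
    p≈ = ≈-trans p (≈-trans (⊕-cong (≈-refl {C c}) (⊗-cong (≈-refl {X}) q)) (horner-0 (C c) X))

  -- V is (1 + X)^(N+1) − η.
  module Coset (N : ℕ) (η : Carrier) where
    V : Jet
    V = phi (1# ∷ []) 0 (suc N) ⊝ C η

    Len-V : Len (suc (suc N)) V
    Len-V = Len-⊝ (Len-phi (1# ∷ []) (suc N)) (Len-≤ (s≤s z≤n) (Len-C η))

    lin-1 : ∀ a → lin 0# a ≡ 1#
    lin-1 a = solve 1 (λ a → # 1 :+ a :* # 0 := # 1) refl a

    V-0 : V 0 0# ≡ 1# - η
    V-0 = cong (_- η) (trans (val-singleton₀ 1# (suc N) 0#) (trans (cong (_^ suc N) (lin-1 1#)) (1^ (suc N))))

    V-1 : V 1 0# ≡ ι (suc N)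
    V-1 = trans (cong (_- 0#) (trans (at (D-phi (1# ∷ []) 0 N) 0 0#) (cong (λ z → ι (suc N) * (1# * (z - 0#)))
            (trans (val-singleton₀ 1# N 0#) (trans (cong (_^ N) (lin-1 1#)) (1^ N))))))
      (solve 1 (λ n → n :* (# 1 :* (# 1 :- # 0)) :- # 0 := n) refl (ι (suc N)))

    V-2 : ∀ N′ → N ≡ suc N′ → V 2 0# ≡ ι (suc N) * ι N
    V-2 N′ refl = begin
      phi (1# ∷ []) 0 (suc (suc N′)) 2 0# - 0#
        ≡⟨ cong (_- 0#) (trans (at (D-phi (1# ∷ []) 0 (suc N′)) 1 0#) (C⊗ (ι (suc N)) (phi (1# ∷ []) 1 (suc N′)) 1 0#)) ⟩
      ι (suc N) * phi (1# ∷ []) 1 (suc N′) 1 0# - 0#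
        ≡⟨ cong (λ z → ι (suc N) * z - 0#) (trans (at (D-phi (1# ∷ []) 1 N′) 0 0#) (cong (λ z → ι N * (1# * ((1# * (z - 0#)) - 0#)))
             (trans (val-singleton₀ 1# N′ 0#) (trans (cong (_^ N′) (lin-1 1#)) (1^ N′))))) ⟩
      ι (suc N) * (ι N * (1# * ((1# * (1# - 0#)) - 0#))) - 0#
        ≡⟨ solve 2 (λ m n → m :* (n :* (# 1 :* ((# 1 :* (# 1 :- # 0)) :- # 0))) :- # 0
              := m :* n) refl (ι (suc N)) (ι N) ⟩
      ι (suc N) * ι N ∎
      where open ≡-Reasoning

    V-minus-1 : V 0 (- 1#) ≡ - η
    V-minus-1 = trans (cong (_- η) (trans (val-singleton₀ 1# (suc N) (- 1#))
        (trans (cong (_* (lin (- 1#) 1# ^ N)) (solve 0 (# 1 :+ # 1 :* :- # 1 := # 0) refl)) (zeroˡ _))))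
      (+-identityˡ (- η))

    V-root : ∀ {x} → lin x 1# ^ suc N ≡ η → Root V x
    V-root {x} eq = trans (cong (_- η) (trans (val-singleton₀ 1# (suc N) x) eq)) (+-inverseʳ η)

    module Cover (hs : List Carrier) (uhs : Unique hs) (∣hs∣ : length hs ≡ suc N)
                 (roots : All (λ x → lin x 1# ^ suc N ≡ η) hs) (ιN≢0 : ι (suc N) ≢ 0#) where

      -- The points `hs` are as many as the degree of V, so V is a constant c times their root
      -- product, and c ≠ 0 because V′(0) ≠ 0. Dividing U by the same root product gives w.
      cover : ∀ {l U} → Len (suc N ℕ.+ l) U → All (Root U) hs →
              ∃ λ c → ∃ λ w → c ≢ 0# × Len l w × C c ⊗ U ≈ V ⊗ w
      cover {l} {U} lU rU =
        let v , lv , V≈ = divide-roots hs uhs Len-V (All.map V-root roots)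
            w , lw , U≈ = divide-roots hs uhs lU rU
            v≈C = Len-const (subst (λ l → Len l v) (trans (cong (suc (suc N) ℕ.∸_) ∣hs∣) (ℕₚ.m+n∸n≡m 1 (suc N))) lv)
            c≢0 = λ c≡0 → ιN≢0 (trans (sym V-1) (trans (at V≈ 1 0#) (trans
                    (at (≈-trans (⊗-cong (≈-refl {rootProduct hs}) (≈-trans v≈C (C-cong c≡0))) (⊗-zeroʳ (rootProduct hs))) 1 0#) refl)))
        in v 0 0# , w , c≢0
         , subst (λ l → Len l w) (trans (cong ((suc N ℕ.+ l) ℕ.∸_) ∣hs∣) (ℕₚ.m+n∸m≡n (suc N) l)) lw
         , ≈-trans (⊗-cong (≈-sym v≈C) U≈) (≈-trans (≈-sym (⊗-assoc v (rootProduct hs) w))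
             (⊗-cong (≈-trans (⊗-comm v (rootProduct hs)) (≈-sym V≈)) (≈-refl {w})))

  Len-linear : ∀ {g} → Len 2 g → ∃ λ c → ∃ λ d → g ≈ C c ⊕ X ⊗ C d
  Len-linear (cons c g l p) = c , g 0 0# , ≈-trans p (⊕-cong (≈-refl {C c}) (⊗-cong (≈-refl {X}) (Len-const l)))

  Len-rootProduct⊗ : ∀ ds {l g} → Len l g → Len (length ds ℕ.+ l) (rootProduct ds ⊗ g)
  Len-rootProduct⊗ [] {g = g} lg = Len-≈ (≈-sym (⊗-identityˡ g)) lg
  Len-rootProduct⊗ (d ∷ ds) {g = g} lg =
    let h = rootProduct ds ⊗ g ; lh = Len-rootProduct⊗ ds lg in
    Len-≈ (≈-trans (≈-sym (*-distribʳ-- X (C d) h)) (≈-sym (⊗-assoc (X- d) (rootProduct ds) g)))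
      (Len-⊝ (Len-X⊗ lh) (Len-suc (Len-C⊗ d lh)))

  rootProduct-≢0 : ∀ {x} ys → All (x ≢_) ys → rootProduct ys 0 x ≢ 0#
  rootProduct-≢0 []       []           = 1≢0
  rootProduct-≢0 (y ∷ ys) (x≢y ∷ x∉) = *-≢0 (x≢y⇒x-y≢0 x≢y) (rootProduct-≢0 ys x∉)

  val-zero : ∀ c cs i → val (c ∷ cs) 0 i 0# ≡ 1#
  val-zero c cs zero    = refl
  val-zero c cs (suc i) = trans (cong (λ z → val (c ∷ cs) 0 i 0# + z) (zeroˡ _)) (trans (+-identityʳ _) (val-zero c cs i))

  phi-1-at-0 : ∀ a b i m → i ℕ.+ 1 ≡ m → phi (a ∷ b ∷ []) 0 m 1 0# ≡ 0#
  phi-1-at-0 a b i m refl = begin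
    phi (a ∷ b ∷ []) 0 (i ℕ.+ 1) 1 0#        ≡⟨ phi-jet (a ∷ b ∷ []) 0 i 1 0# ⟩
    rise i 1 * (a * (val (a ∷ b ∷ []) 0 i 0# - val (b ∷ []) 0 i 0#))
      ≡⟨ cong₂ (λ u v → rise i 1 * (a * (u - v))) (val-zero a (b ∷ []) i) (val-zero b [] i) ⟩
    rise i 1 * (a * (1# - 1#))
      ≡⟨ solve 2 (λ r a → r :* (a :* (# 1 :- # 1)) := # 0) refl (rise i 1) a ⟩
    0# ∎
    where open ≡-Reasoning

  -- For N = i + 1 the second derivative at 0 is (N + 1) N Σ c_i a_i², where the sum is -a b; 2N =
  -- -1 makes (N + 1) N equal to -1/4.
  phi-2-at-0 : ∀ a b i m → i ℕ.+ 2 ≡ m → ι 2 * ι (suc i) ≡ - 1# → ι 4 * phi (a ∷ b ∷ []) 0 m 2 0# ≡ a * b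
  phi-2-at-0 a b i m refl half = begin
    ι 4 * phi nodes 0 (i ℕ.+ 2) 2 0#
      ≡⟨ cong (ι 4 *_) (phi-jet nodes 0 i 2 0#) ⟩
    ι 4 * (rise i 2 * (a * (a * (val nodes 0 i 0# - v) - b * (v - 0#))))
      ≡⟨ cong₂ (λ u w → ι 4 * (rise i 2 * (a * (a * (u - w) - b * (w - 0#))))) (val-zero a (b ∷ []) i) (val-zero b [] i) ⟩
    ι 4 * (rise i 2 * (a * (a * (1# - 1#) - b * (1# - 0#))))
      ≡⟨ cong (λ r → ι 4 * (r * (a * (a * (1# - 1#) - b * (1# - 0#))))) rise≡ ⟩
    ι 4 * ((1# + n) * (n * 1#) * (a * (a * (1# - 1#) - b * (1# - 0#))))
      ≡⟨ solve 3 (λ n a b → # 4 :* ((# 1 :+ n) :* (n :* # 1) :*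
            (a :* (a :* (# 1 :- # 1) :- b :* (# 1 :- # 0))))
          := :- ((# 2 :+ # 2 :* n) :* (# 2 :* n)) :* (a :* b)) refl n a b ⟩
    - ((ι 2 + ι 2 * n) * (ι 2 * n)) * (a * b)
      ≡⟨ cong (λ t → - ((ι 2 + t) * t) * (a * b)) half ⟩
    - ((ι 2 + - 1#) * - 1#) * (a * b)
      ≡⟨ solve 2 (λ a b → :- ((# 2 :+ :- # 1) :* :- # 1) :* (a :* b) := a :* b) refl a b ⟩
    a * b ∎
    where
    open ≡-Reasoning
    nodes = a ∷ b ∷ []
    n = ι (suc i)
    v = val (b ∷ []) 0 i 0#
    rise≡ : rise i 2 ≡ (1# + n) * (n * 1#)
    rise≡ = cong₂ (λ s t → ι (suc s) * (ι (suc t) * 1#)) (ℕₚ.+-comm i 1) (ℕₚ.+-identityʳ i)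

  module _ {a b : Carrier} (a≢b : a ≢ b) (a≢0 : a ≢ 0#) (b≢0 : b ≢ 0#) (N : ℕ)
           (square : ∀ x → x ≢ 0# → x ^ N * x ^ N ≡ 1#) where

    private
      pole-sign : ∀ {c d} → c ≢ d → c ≢ 0# → lin (pole c) d ^ N ≡ 1# ⊎ lin (pole c) d ^ N ≡ - 1#
      pole-sign c≢d c≢0 = x²≡1 (square _ (λ l≡0 → c≢d (lin-injective (lin-pole c≢0) l≡0)))

    phi-pole : ∀ m → suc N ≡ m → ∀ {c} → c ∈ a ∷ b ∷ [] →
      phi (a ∷ b ∷ []) 0 m 0 (pole c) ≡ 1# ⊎ phi (a ∷ b ∷ []) 0 m 0 (pole c) ≡ - 1#
    phi-pole m refl (here refl) = subst (λ z → z ≡ 1# ⊎ z ≡ - 1#)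
      (sym (proj₁ (val-pole a≢b a≢0 b≢0 N))) (pole-sign a≢b a≢0)
    phi-pole m refl (there (here refl)) = subst (λ z → z ≡ 1# ⊎ z ≡ - 1#)
      (sym (proj₂ (val-pole a≢b a≢0 b≢0 N))) (pole-sign (λ e → a≢b (sym e)) b≢0)

  ⊝C-suc : ∀ g c j x → (g ⊝ C c) (suc j) x ≡ g (suc j) x
  ⊝C-suc g c j x = solve 1 (λ u → u :- # 0 := u) refl (g (suc j) x)

  -- Two nodes: the covering product and the contradictions

  module CoverProduct {a b : Carrier} (a≢0 : a ≢ 0#) (b≢0 : b ≢ 0#) where

    -- When a and b are the two scaled nodes, every nonzero element of (G - λ)/λ has the form a d or
    -- b d. So this product vanishes there and can be compared with the polynomial of the coset.
    coverProduct : List Carrier → Jet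
    coverProduct ds = scaled a ds ⊗ scaled b ds

    Len-coverProduct : ∀ ds → Len (length ds ℕ.+ suc (length ds)) (coverProduct ds)
    Len-coverProduct ds = subst (λ l → Len l (coverProduct ds))
      (cong₂ (λ u v → u ℕ.+ suc v) (length-map (a *_) ds) (length-map (b *_) ds))
      (Len-rootProduct⊗ (map (a *_) ds) (Len-rootProduct (map (b *_) ds)))

    Covered : List Carrier → Carrier → Set
    Covered ds x = ∃ λ d → d ∈ ds × (x ≡ a * d ⊎ x ≡ b * d)

    coverProduct-root : ∀ {ds x} → Covered ds x → Root (coverProduct ds) x
    coverProduct-root {ds} (d , d∈ , inj₁ refl) =
      trans (cong (_* scaled b ds 0 (a * d)) (rootProduct-root (∈-map⁺ (a *_) d∈))) (zeroˡ _)
    coverProduct-root {ds} (d , d∈ , inj₂ refl) =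
      trans (cong (scaled a ds 0 (b * d) *_) (rootProduct-root (∈-map⁺ (b *_) d∈))) (zeroʳ _)

    module _ (ds : List Carrier) where
      c₀ : Carrier
      c₀ = a ^ length ds * b ^ length ds
      c₀≢0 : c₀ ≢ 0#
      c₀≢0 = *-≢0 (^-≢0 (length ds) a≢0) (^-≢0 (length ds) b≢0)

      private
        p p₁ p₂ u v ca cb : Carrier
        p = rootProduct ds 0 0#
        p₁ = rootProduct ds 1 0#
        p₂ = rootProduct ds 2 0#
        u = rootProduct ds 0 (pole a)
        v = rootProduct ds 0 (pole b)
        ca = a ^ length ds
        cb = b ^ length ds

        module _ where
          Ja = scaled-jet a≢0 ds
          Jb = scaled-jet b≢0 ds

      cover-0 : coverProduct ds 0 0# ≡ c₀ * (p * p)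
      cover-0 = trans (cong₂ _*_ (proj₁ Ja) (proj₁ Jb))
        (solve 4 (λ c d p q → c :* p :* (d :* q) := c :* d :* (p :* q)) refl ca cb p p)

      cover-minus-1 : coverProduct ds 0 (- 1#) ≡ c₀ * (u * v)
      cover-minus-1 = trans (cong₂ _*_ (proj₂ (proj₂ (proj₂ Ja))) (proj₂ (proj₂ (proj₂ Jb))))
        (solve 4 (λ c d p q → c :* p :* (d :* q) := c :* d :* (p :* q)) refl ca cb u v)

      cover-1 : a * b * coverProduct ds 1 0# ≡ c₀ * ((a + b) * (p * p₁))
      cover-1 = begin
        a * b * (sa 1 * sb 0 + sa 0 * sb 1)
          ≡⟨ solve 6 (λ a b s t s′ t′ → a :* b :* (s :* t′ :+ s′ :* t)
               := b :* ((a :* s) :* t′) :+ a :* (s′ :* (b :* t))) refl a b (sa 1) (sb 1) (sa 0) (sb 0) ⟩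
        b * ((a * sa 1) * sb 0) + a * (sa 0 * (b * sb 1))
          ≡⟨ cong₂ (λ s t → b * (s * sb 0) + a * (sa 0 * t)) (proj₁ (proj₂ Ja)) (proj₁ (proj₂ Jb)) ⟩
        b * ((ca * p₁) * sb 0) + a * (sa 0 * (cb * p₁))
          ≡⟨ cong₂ (λ s t → b * ((ca * p₁) * t) + a * (s * (cb * p₁))) (proj₁ Ja) (proj₁ Jb) ⟩
        b * ((ca * p₁) * (cb * p)) + a * ((ca * p) * (cb * p₁))
          ≡⟨ solve 6 (λ a b c d p q → b :* ((c :* q) :* (d :* p)) :+ a :* ((c :* p) :* (d :* q))
               := c :* d :* ((a :+ b) :* (p :* q))) refl a b ca cb p p₁ ⟩
        c₀ * ((a + b) * (p * p₁)) ∎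
        where
        open ≡-Reasoning
        sa sb : ℕ → Carrier
        sa j = scaled a ds j 0#
        sb j = scaled b ds j 0#

      cover-2 : (a * b) * (a * b) * coverProduct ds 2 0#
                ≡ c₀ * ((a * a + b * b) * (p * p₂) + ι 2 * (a * b) * (p₁ * p₁))
      cover-2 = begin
        (a * b) * (a * b) * ((sa 2 * sb 0 + sa 1 * sb 1) + (sa 1 * sb 1 + sa 0 * sb 2))
          ≡⟨ solve 8 (λ a b s₀ s₁ s₂ t₀ t₁ t₂ →
               (a :* b) :* (a :* b) :* ((s₂ :* t₀ :+ s₁ :* t₁) :+ (s₁ :* t₁ :+ s₀ :* t₂))
               := b :* b :* ((a :* a :* s₂) :* t₀) :+ # 2 :* (a :* b) :* ((a :* s₁) :* (b :* t₁))
                    :+ a :* a :* (s₀ :* (b :* b :* t₂))) refl a b (sa 0) (sa 1) (sa 2) (sb 0) (sb 1) (sb 2) ⟩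
        b * b * ((a * a * sa 2) * sb 0) + ι 2 * (a * b) * ((a * sa 1) * (b * sb 1)) + a * a * (sa 0 * (b * b * sb 2))
          ≡⟨ cong₂ (λ s t → b * b * (s * sb 0) + ι 2 * (a * b) * ((a * sa 1) * (b * sb 1)) + a * a * (sa 0 * t))
               (proj₁ (proj₂ (proj₂ Ja))) (proj₁ (proj₂ (proj₂ Jb))) ⟩
        b * b * ((ca * p₂) * sb 0) + ι 2 * (a * b) * ((a * sa 1) * (b * sb 1)) + a * a * (sa 0 * (cb * p₂))
          ≡⟨ cong₂ (λ s t → b * b * ((ca * p₂) * sb 0) + ι 2 * (a * b) * (s * t) + a * a * (sa 0 * (cb * p₂)))
               (proj₁ (proj₂ Ja)) (proj₁ (proj₂ Jb)) ⟩
        b * b * ((ca * p₂) * sb 0) + ι 2 * (a * b) * ((ca * p₁) * (cb * p₁)) + a * a * (sa 0 * (cb * p₂))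
          ≡⟨ cong₂ (λ s t → b * b * ((ca * p₂) * t) + ι 2 * (a * b) * ((ca * p₁) * (cb * p₁)) + a * a * (s * (cb * p₂)))
               (proj₁ Ja) (proj₁ Jb) ⟩
        b * b * ((ca * p₂) * (cb * p)) + ι 2 * (a * b) * ((ca * p₁) * (cb * p₁)) + a * a * ((ca * p) * (cb * p₂))
          ≡⟨ solve 7 (λ a b c d p p₁ p₂ → b :* b :* ((c :* p₂) :* (d :* p)) :+ # 2 :* (a :* b) :* ((c :* p₁) :* (d :* p₁))
                   :+ a :* a :* ((c :* p) :* (d :* p₂))
               := c :* d :* ((a :* a :+ b :* b) :* (p :* p₂) :+ # 2 :* (a :* b) :* (p₁ :* p₁))) refl a b ca cb p p₁ p₂ ⟩
        c₀ * ((a * a + b * b) * (p * p₂) + ι 2 * (a * b) * (p₁ * p₁)) ∎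
        where
        open ≡-Reasoning
        sa sb : ℕ → Carrier
        sa j = scaled a ds j 0#
        sb j = scaled b ds j 0#

  -- The primes that divide the integers left at the end of the two-node case; 853 is written as 29²
  -- + 12 to keep the unary numerals small.
  module Contradictions (2≢0 : ι 2 ≢ 0#) (3≢0 : ι 3 ≢ 0#) (5≢0 : ι 5 ≢ 0#) (7≢0 : ι 7 ≢ 0#) (11≢0 : ι 11 ≢ 0#)
                        (853≢0 : ι 29 * ι 29 + ι 12 ≢ 0#) where

    -- Both (u v q)² and (p² q)² are 4, while the last equation gives 64 (u v q)² = 9 (p² q)². Hence
    -- 220 = 4 · 5 · 11 would be zero.
    constant-quotient : ∀ {p u v q} → p * p * q ≡ ι 2 → u * u * q ≡ ι 2 → v * v * q ≡ ι 2 → ι 8 * (u * v) ≡ ι 3 * (p * p) → ⊥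
    constant-quotient {p} {u} {v} {q} pp uu vv e = *-≢0 (*-≢0 2≢0 2≢0) (*-≢0 5≢0 11≢0) (begin
      ι 2 * ι 2 * (ι 5 * ι 11)
        ≡⟨ solve 0 (# 2 :* # 2 :* (# 5 :* # 11) :=
             # 8 :* # 8 :* (# 2 :* # 2) :- # 9 :* (# 2 :* # 2)) refl ⟩
      ι 8 * ι 8 * (ι 2 * ι 2) - ι 9 * (ι 2 * ι 2)
        ≡⟨ cong₂ (λ s t → ι 8 * ι 8 * s - ι 9 * t) (cong₂ _*_ (sym uu) (sym vv)) (cong₂ _*_ (sym pp) (sym pp)) ⟩
      ι 8 * ι 8 * (u * u * q * (v * v * q)) - ι 9 * (p * p * q * (p * p * q))
        ≡⟨ cong (_- ι 9 * (p * p * q * (p * p * q))) (solve 3 (λ u v q → # 8 :* # 8 :* (u :* u :* q :* (v :* v :* q))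
              := (# 8 :* (u :* v)) :* (# 8 :* (u :* v)) :* (q :* q)) refl u v q) ⟩
      (ι 8 * (u * v)) * (ι 8 * (u * v)) * (q * q) - ι 9 * (p * p * q * (p * p * q))
        ≡⟨ cong (λ s → s * s * (q * q) - ι 9 * (p * p * q * (p * p * q))) e ⟩
      (ι 3 * (p * p)) * (ι 3 * (p * p)) * (q * q) - ι 9 * (p * p * q * (p * p * q))
        ≡⟨ solve 2 (λ p q → (# 3 :* (p :* p)) :* (# 3 :* (p :* p)) :* (q :* q) :- # 9 :* (p :* p :* q :* (p :* p :* q)) := # 0) refl p q ⟩
      0# ∎)
      where open ≡-Reasoning

    -- For σ = a + b the two equations give σ² - 10σt - 16t² = 0. If a or b is t, then σ = -t and
    -- the form is -5t²; in the remaining case t = 7σ and it is -853σ².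
    linear-quotient : ∀ {a b t} → a ≢ 0# → b ≢ 0# → ι 2 * (a + b) * t ≡ a * b →
      (a * a + b * b) * (a * b + ι 12 * (t * t)) + ι 8 * (a * b) * (t * t) ≡ ι 6 * ((a * b) * (a * b)) →
      (a ≡ t ⊎ b ≡ t) ⊎ (a - t) * (b - t) ≡ ι 4 * (a * b) → ⊥
    linear-quotient {a} {b} {t} a≢0 b≢0 e₁ e₂ = cases
      where
      open ≡-Reasoning
      σ : Carrier
      σ = a + b
      σt≢0 : ι 2 * σ * t ≢ 0#
      σt≢0 e = *-≢0 a≢0 b≢0 (trans (sym e₁) e)
      t≢0 : t ≢ 0#
      t≢0 = *-≢0ʳ σt≢0
      σ≢0 : σ ≢ 0#
      σ≢0 = *-≢0ʳ (*-≢0ˡ σt≢0)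

      quadratic-σ : σ * σ - ι 10 * (σ * t) - ι 16 * (t * t) ≡ 0#
      quadratic-σ = *-≡0 σt≢0 (begin
        ι 2 * σ * t * (σ * σ - ι 10 * (σ * t) - ι 16 * (t * t))
          ≡⟨ solve 2 (λ s t → let two = # 2; P = two :* s :* t in
               P :* (s :* s :- # 10 :* (s :* t) :- # 16 :* (t :* t))
               := (s :* s :- two :* P) :* (P :+ # 12 :* (t :* t)) :+ # 8 :* P :* (t :* t) :- # 6 :* (P :* P)) refl σ t ⟩
        Φ (ι 2 * σ * t)
          ≡⟨ cong Φ e₁ ⟩
        Φ (a * b)
          ≡⟨ solve 3 (λ a b t → let P = a :* b; s = a :+ b; two = # 2 in
               (s :* s :- two :* P) :* (P :+ # 12 :* (t :* t)) :+ # 8 :* P :* (t :* t) :- # 6 :* (P :* P)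
               := ((a :* a :+ b :* b) :* (P :+ # 12 :* (t :* t)) :+ # 8 :* P :* (t :* t)) :- # 6 :* (P :* P)) refl a b t ⟩
        ((a * a + b * b) * (a * b + ι 12 * (t * t)) + ι 8 * (a * b) * (t * t)) - ι 6 * ((a * b) * (a * b))
          ≡⟨ x≡y⇒x-y≡0 e₂ ⟩
        0# ∎)
        where
        Φ : Carrier → Carrier
        Φ P = (σ * σ - ι 2 * P) * (P + ι 12 * (t * t)) + ι 8 * P * (t * t) - ι 6 * (P * P)

      root : ∀ {c d} → c + d ≡ σ → c * d ≡ a * b → c ≡ t → ⊥
      root {c} {d} s p refl = *-≢0 5≢0 (*-≢0 t≢0 t≢0) (begin
        ι 5 * (t * t)
          ≡⟨ solve 2 (λ s t → # 5 :* (t :* t) :=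
               (s :+ t) :* (s :- # 11 :* t) :- (s :* s :- # 10 :* (s :* t) :- # 16 :* (t :* t))) refl σ t ⟩
        (σ + t) * (σ - ι 11 * t) - (σ * σ - ι 10 * (σ * t) - ι 16 * (t * t))
          ≡⟨ cong₂ (λ y z → y * (σ - ι 11 * t) - z) σ+t≡0 quadratic-σ ⟩
        0# * (σ - ι 11 * t) - 0#
          ≡⟨ solve 1 (λ y → # 0 :* y :- # 0 := # 0) refl (σ - ι 11 * t) ⟩
        0# ∎)
        where
        σ+t≡0 : σ + t ≡ 0#
        σ+t≡0 = *-≡0 t≢0 (begin
          t * (σ + t)               ≡⟨ cong (λ z → t * (z + t)) s ⟨
          t * (t + d + t)           ≡⟨ solve 2 (λ t d → t :* (t :+ d :+ t) := # 2 :* (t :+ d) :* t :- t :* d) refl t d ⟩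
          ι 2 * (t + d) * t - t * d ≡⟨ cong₂ (λ y z → ι 2 * y * t - z) s p ⟩
          ι 2 * σ * t - a * b       ≡⟨ x≡y⇒x-y≡0 e₁ ⟩
          0# ∎)

      cases : (a ≡ t ⊎ b ≡ t) ⊎ (a - t) * (b - t) ≡ ι 4 * (a * b) → ⊥
      cases (inj₁ (inj₁ a≡t)) = root refl refl a≡t
      cases (inj₁ (inj₂ b≡t)) = root (+-comm b a) (*-comm b a) b≡t
      cases (inj₂ e) = *-≢0 853≢0 (*-≢0 σ≢0 σ≢0) (begin
        (ι 29 * ι 29 + ι 12) * (σ * σ)
          ≡⟨ solve 1 (λ s → let t = # 7 :* s in (# 29 :* # 29 :+ # 12) :* (s :* s)
                := :- (s :* s :- # 10 :* (s :* t) :- # 16 :* (t :* t))) refl σ ⟩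
        - (σ * σ - ι 10 * (σ * (ι 7 * σ)) - ι 16 * (ι 7 * σ * (ι 7 * σ)))
          ≡⟨ cong (λ t → - (σ * σ - ι 10 * (σ * t) - ι 16 * (t * t))) 7σ≡t ⟩
        - (σ * σ - ι 10 * (σ * t) - ι 16 * (t * t))
          ≡⟨ cong -_ quadratic-σ ⟩
        - 0#
          ≡⟨ solve 0 (:- # 0 := # 0) refl ⟩
        0# ∎)
        where
        7σ≡t : ι 7 * σ ≡ t
        7σ≡t = *-cancelˡ t≢0 (begin
          t * (ι 7 * σ)
            ≡⟨ solve 2 (λ s t → t :* (# 7 :* s) := # 3 :* (# 2 :* s :* t) :+ s :* t) refl σ t ⟩
          ι 3 * (ι 2 * σ * t) + σ * t
            ≡⟨ cong (λ z → ι 3 * z + σ * t) e₁ ⟩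
          ι 3 * (a * b) + σ * t
            ≡⟨ solve 3 (λ a b t → # 3 :* (a :* b) :+ (a :+ b) :* t
                 := # 4 :* (a :* b) :- (a :- t) :* (b :- t) :+ t :* t) refl a b t ⟩
          ι 4 * (a * b) - (a - t) * (b - t) + t * t
            ≡⟨ cong (_+ t * t) (x≡y⇒x-y≡0 (sym e)) ⟩
          0# + t * t
            ≡⟨ +-identityˡ _ ⟩
          t * t ∎)

  -- For k = 2 and p = 2 N + 1 the degree bound is attained.  At the pole −1/a of a node the value of f is
  -- ±1 − η, which is compared with the values at 0 and −1 of the polynomial ∏ (X − a d)(X − b d), a multiple
  -- of the polynomial of the coset.
  module TwoNodes (N′ : ℕ) (a b : Carrier) (a≢b : a ≢ b) (a≢0 : a ≢ 0#) (b≢0 : b ≢ 0#)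
    (half : ι 2 * ι (3 ℕ.+ N′) ≡ - 1#)
    (square : ∀ x → x ≢ 0# → x ^ (3 ℕ.+ N′) * x ^ (3 ℕ.+ N′) ≡ 1#)
    (char : ∀ j → j < N′ ℕ.+ 4 → ι (suc j) ≢ 0#)
    (2≢0 : ι 2 ≢ 0#) (3≢0 : ι 3 ≢ 0#) (5≢0 : ι 5 ≢ 0#) (7≢0 : ι 7 ≢ 0#) (11≢0 : ι 11 ≢ 0#)
    (853≢0 : ι 29 * ι 29 + ι 12 ≢ 0#) where

    private
      N m : ℕ
      N = 3 ℕ.+ N′
      m = N′ ℕ.+ 4
      nodes : List Carrier
      nodes = a ∷ b ∷ []
      nodes-unique : Unique nodes
      nodes-unique = (a≢b ∷ []) ∷ [] ∷ []
      nodes≢0 : All (_≢ 0#) nodes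
      nodes≢0 = a≢0 ∷ b≢0 ∷ []

    private
      m≡ : 4 ℕ.+ N′ ≡ m
      m≡ = ℕₚ.+-comm 4 N′

    phi-1 : phi nodes 0 m 1 0# ≡ 0#
    phi-1 = phi-1-at-0 a b (3 ℕ.+ N′) m (trans (ℕₚ.+-comm (3 ℕ.+ N′) 1) m≡)

    phi-2 : ι 4 * phi nodes 0 m 2 0# ≡ a * b
    phi-2 = phi-2-at-0 a b (2 ℕ.+ N′) m (trans (ℕₚ.+-comm (2 ℕ.+ N′) 2) m≡) half

    phi-pole-a : phi nodes 0 m 0 (pole a) ≡ 1# ⊎ phi nodes 0 m 0 (pole a) ≡ - 1#
    phi-pole-a = phi-pole a≢b a≢0 b≢0 N square m m≡ (here refl)

    phi-pole-b : phi nodes 0 m 0 (pole b) ≡ 1# ⊎ phi nodes 0 m 0 (pole b) ≡ - 1#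
    phi-pole-b = phi-pole a≢b a≢0 b≢0 N square m m≡ (there (here refl))

    open CoverProduct {a} {b} a≢0 b≢0
    open Contradictions 2≢0 3≢0 5≢0 7≢0 11≢0 853≢0

    -- The degree bound and the covering bound are both tight here: with n elements d besides 0, 2n
    -- + 2 = N + 1. So q is constant, and X ∏ (X - a d)(X - b d) is a constant multiple of the coset
    -- polynomial.
    module InSubgroup (ds : List Carrier) (uys : Unique (0# ∷ ds))
      (good : All (λ y → All (Periodic.Good N 1# y) nodes) (0# ∷ ds))
      (hs : List Carrier) (uhs : Unique hs) (∣hs∣ : length hs ≡ N)
      (coset : All (λ x → lin x 1# ^ N ≡ 1#) hs) (covered : All (λ x → x ≡ 0# ⊎ Covered ds x) hs)
      (enough : N ≤ suc (length ds ℕ.+ length ds)) where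

      private
        n : ℕ
        n = length ds
        P̂ : Jet
        P̂ = rootProduct ds
        f P : Jet
        f = phi nodes 0 m ⊝ C 1#
        P = rootProduct (0# ∷ ds)
        V : Jet
        V = Coset.V (2 ℕ.+ N′) 1#

        factors : ∃ λ q → Len (suc m ℕ.∸ suc n ℕ.* 2) q × f ≈ P ^^ 2 ⊗ q
        factors = Factorization.factorization N′ 1# 1≢0 a (b ∷ []) nodes-unique nodes≢0 (0# ∷ ds) uys good char

        bound : suc n ℕ.* 2 ≤ m
        bound = Factorization.degree-bound N′ 1# 1≢0 a (b ∷ []) nodes-unique nodes≢0 (0# ∷ ds) uys good char

        2n≡ : n ℕ.+ n ≡ 2 ℕ.+ N′
        2n≡ = ℕₚ.≤-antisym
          (ℕₚ.+-cancelˡ-≤ 2 _ _ (subst (ℕ._≤ 4 ℕ.+ N′) (trans (ℕₚ.*-comm (suc n) 2) (trans (cong (suc n ℕ.+_) (ℕₚ.+-identityʳ (suc n)))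
               (cong suc (ℕₚ.+-suc n n)))) (subst (suc n ℕ.* 2 ≤_) (sym m≡) bound)))
          (ℕₚ.≤-pred enough)

        q : Jet
        q = proj₁ factors
        q≈ : q ≈ C (q 0 0#)
        q≈ = Len-const (subst (λ l → Len l q) count (proj₁ (proj₂ factors)))
          where
          count : suc m ℕ.∸ suc n ℕ.* 2 ≡ 1
          count = trans (cong₂ (λ s t → suc s ℕ.∸ t) (sym m≡)
            (trans (ℕₚ.*-comm (suc n) 2) (trans (cong (suc n ℕ.+_) (ℕₚ.+-identityʳ (suc n)))
              (trans (cong suc (ℕₚ.+-suc n n)) (cong (2 ℕ.+_) 2n≡))))) (ℕₚ.m+n∸n≡m 1 N′)

        q₀ : Carrier
        q₀ = q 0 0#
        f≈ : f ≈ (P ⊗ P) ⊗ C q₀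
        f≈ = ≈-trans (proj₂ (proj₂ factors)) (⊗-cong (⊗-cong (≈-refl {P}) (≈-trans (⊗-comm P (C 1#)) (⊗-identityˡ P))) q≈)

        P-0 : P 0 0# ≡ 0#
        P-0 = trans (cong (_* P̂ 0 0#) (+-inverseʳ 0#)) (zeroˡ _)
        P-1 : P 1 0# ≡ P̂ 0 0#
        P-1 = trans (X-⊗-suc 0# P̂ 0 0#) (solve 2 (λ u v → (# 0 :- # 0) :* u :+ # 1 :* v := v) refl (P̂ 1 0#) (P̂ 0 0#))

        w : Carrier
        w = P̂ 0 0# * P̂ 0 0# * q₀

        -- P = X P̂ has a simple root at 0, so f′′(0) = 2 P′(0)² q₀ = 2w; `phi-2` evaluates the same
        -- derivative.
        8w≡ab : ι 8 * w ≡ a * b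
        8w≡ab = begin
          ι 8 * w
            ≡⟨ solve 4 (λ p q P₂ z → # 8 :* (p :* p :* q) :=
                 # 4 :* ((((P₂ :* # 0 :+ p :* p) :+ (p :* p :+ # 0 :* P₂)) :* q
                   :+ (p :* # 0 :+ # 0 :* p) :* # 0)
                   :+ ((p :* # 0 :+ # 0 :* p) :* # 0 :+ (# 0 :* # 0) :* # 0)))
                 refl (P̂ 0 0#) q₀ (P 2 0#) q₀ ⟩
          ι 4 * second 0# (P̂ 0 0#)            ≡⟨ cong₂ (λ s t → ι 4 * second s t) P-0 P-1 ⟨
          ι 4 * second (P 0 0#) (P 1 0#)      ≡⟨ cong (ι 4 *_) (at f≈ 2 0#) ⟨
          ι 4 * f 2 0#                        ≡⟨ cong (ι 4 *_) (⊝C-suc (phi nodes 0 m) 1# 1 0#) ⟩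
          ι 4 * phi nodes 0 m 2 0#            ≡⟨ phi-2 ⟩
          a * b ∎
          where
          open ≡-Reasoning
          second : Carrier → Carrier → Carrier
          second P₀ P₁ = (((P 2 0# * P₀ + P₁ * P₁) + (P₁ * P₁ + P₀ * P 2 0#)) * q₀ + (P₁ * P₀ + P₀ * P₁) * 0#)
                       + ((P₁ * P₀ + P₀ * P₁) * 0# + P₀ * P₀ * 0#)

        w≢0 : w ≢ 0#
        w≢0 = *-≢0ʳ (λ e → *-≢0 a≢0 b≢0 (trans (sym 8w≡ab) e))

        -- f takes the value 0 or -2 at the pole. It is not 0, because the pole is not one of the
        -- points and q is a nonzero constant.
        at-pole : ∀ {c} → c ≢ 0# → c ∈ nodes → phi nodes 0 m 0 (pole c) ≡ 1# ⊎ phi nodes 0 m 0 (pole c) ≡ - 1# →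
                  let x = pole c in (x * P̂ 0 x) * (x * P̂ 0 x) * q₀ ≡ - ι 2
        at-pole {c} c≢0 c∈ s = trans (trans (solve 3 (λ x p q → (x :* p) :* (x :* p) :* q
              := ((x :- # 0) :* p) :* ((x :- # 0) :* p) :* q) refl x (P̂ 0 x) q₀)
            (sym (at f≈ 0 x))) (value s)
          where
          x = pole c
          x∉ : All (x ≢_) (0# ∷ ds)
          x∉ = All.map (λ {y} g x≡y → lin≢0 (2 ℕ.+ N′) y 1≢0 (All.lookup g c∈) (subst (λ z → lin z c ≡ 0#) x≡y (lin-pole c≢0))) good
          fx≢0 : f 0 x ≢ 0#
          fx≢0 e = *-≢0 (*-≢0 (rootProduct-≢0 (0# ∷ ds) x∉) (rootProduct-≢0 (0# ∷ ds) x∉)) (*-≢0ʳ w≢0) (trans (sym (at f≈ 0 x)) e)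
          value : phi nodes 0 m 0 x ≡ 1# ⊎ phi nodes 0 m 0 x ≡ - 1# → f 0 x ≡ - ι 2
          value (inj₁ e) = ⊥-elim (fx≢0 (trans (cong (_- 1#) e) (+-inverseʳ 1#)))
          value (inj₂ e) = trans (cong (_- 1#) e) (solve 0 (:- # 1 :- # 1 := :- # 2) refl)

        U : Jet
        U = coverProduct ds

        cover : ∃ λ c → ∃ λ w → c ≢ 0# × Len 1 w × C c ⊗ (X ⊗ U) ≈ V ⊗ w
        cover = Coset.Cover.cover (2 ℕ.+ N′) 1# hs uhs ∣hs∣ coset (char (2 ℕ.+ N′) (subst (2 ℕ.+ N′ <_) m≡ (ℕₚ.n≤1+n N)))
          (subst (λ l → Len l (X ⊗ U)) (trans (cong suc (trans (ℕₚ.+-suc n n) (cong suc 2n≡))) (ℕₚ.+-comm 1 N)) (Len-X⊗ (Len-coverProduct ds)))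
          (All.map (λ { (inj₁ refl) → zeroˡ _ ; (inj₂ c) → trans (cong (_ *_) (coverProduct-root c)) (zeroʳ _) }) covered)

        -- The value at -1 and the derivative at 0 of X U are proportional to V(-1) = -1 and V′(0) =
        -- N; 2N = -1 produces the factor -2.
        uv≡ : P̂ 0 (pole a) * P̂ 0 (pole b) ≡ - ι 2 * (P̂ 0 0# * P̂ 0 0#)
        uv≡ = *-cancelˡ (c₀≢0 ds) (trans (sym (cover-minus-1 ds)) (trans U≡
            (trans (cong (- ι 2 *_) (cover-0 ds)) (solve 3 (λ c d p → c :* (d :* p) := d :* (c :* p)) refl (- ι 2) (c₀ ds) (P̂ 0 0# * P̂ 0 0#)))))
          where
          open ≡-Reasoning
          c = proj₁ cover
          w′ = proj₁ (proj₂ cover)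
          c≢0 = proj₁ (proj₂ (proj₂ cover))
          rel : C c ⊗ (X ⊗ U) ≈ V ⊗ C (w′ 0 0#)
          rel = ≈-trans (proj₂ (proj₂ (proj₂ (proj₂ cover)))) (⊗-cong (≈-refl {V}) (Len-const (proj₁ (proj₂ (proj₂ (proj₂ cover))))))
          w₀ = w′ 0 0#
          e₁ : c * U 0 (- 1#) ≡ w₀
          e₁ = begin
            c * U 0 (- 1#)             ≡⟨ solve 2 (λ c u → c :* u := :- (c :* (:- # 1 :* u))) refl c (U 0 (- 1#)) ⟩
            - (c * (- 1# * U 0 (- 1#))) ≡⟨ cong -_ (at rel 0 (- 1#)) ⟩
            - (V 0 (- 1#) * w₀)      ≡⟨ cong (λ z → - (z * w₀)) (Coset.V-minus-1 (2 ℕ.+ N′) 1#) ⟩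
            - (- 1# * w₀)              ≡⟨ solve 1 (λ w → :- (:- # 1 :* w) := w) refl w₀ ⟩
            w₀ ∎
          e₂ : c * U 0 0# ≡ ι N * w₀
          e₂ = begin
            c * U 0 0#                    ≡⟨ solve 3 (λ c u v → c :* u := c :* (# 1 :* u :+ # 0 :* v)) refl c (U 0 0#) (U 1 0#) ⟩
            c * (X ⊗ U) 1 0#              ≡⟨ C⊗ c (X ⊗ U) 1 0# ⟨
            (C c ⊗ (X ⊗ U)) 1 0#          ≡⟨ at rel 1 0# ⟩
            V 1 0# * w₀ + V 0 0# * 0# ≡⟨ cong₂ _+_ (cong (_* w₀) (Coset.V-1 (2 ℕ.+ N′) 1#)) (zeroʳ _) ⟩
            ι N * w₀ + 0#                 ≡⟨ +-identityʳ _ ⟩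
            ι N * w₀ ∎
          U≡ : U 0 (- 1#) ≡ - ι 2 * U 0 0#
          U≡ = *-cancelˡ c≢0 (begin
            c * U 0 (- 1#)         ≡⟨ e₁ ⟩
            w₀                     ≡⟨ solve 1 (λ w → w := :- (:- # 1 :* w)) refl w₀ ⟩
            - (- 1# * w₀)          ≡⟨ cong (λ z → - (z * w₀)) half ⟨
            - (ι 2 * ι N * w₀)     ≡⟨ solve 3 (λ t n w → :- (t :* n :* w) := :- t :* (n :* w)) refl (ι 2) (ι N) w₀ ⟩
            - ι 2 * (ι N * w₀)     ≡⟨ cong (- ι 2 *_) e₂ ⟨
            - ι 2 * (c * U 0 0#)   ≡⟨ solve 3 (λ t c u → t :* (c :* u) := c :* (t :* u)) refl (- ι 2) c (U 0 0#) ⟩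
            c * (- ι 2 * U 0 0#) ∎)

      -- Multiplying the values of f at the two poles gives 4. With a b = 8w and u v = -2p₀² this
      -- becomes 256 w² = 4 w², and 252 = 4 · 9 · 7 is nonzero.
      impossible : ⊥
      impossible = *-≢0 (*-≢0 (*-≢0 2≢0 2≢0) (*-≢0 (*-≢0 3≢0 3≢0) 7≢0)) (*-≢0 w≢0 w≢0) (begin
        ι 2 * ι 2 * (ι 3 * ι 3 * ι 7) * (w * w)
          ≡⟨ solve 1 (λ w → # 2 :* # 2 :* (# 3 :* # 3 :* # 7) :* (w :* w) :=
               (# 8 :* w) :* (# 8 :* w) :* (:- # 2 :* :- # 2) :- # 4 :* (w :* w)) refl w ⟩
        (ι 8 * w) * (ι 8 * w) * (- ι 2 * - ι 2) - ι 4 * (w * w)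
          ≡⟨ cong₂ (λ s t → s * s * t - ι 4 * (w * w)) 8w≡ab (cong₂ _*_ (sym (at-pole a≢0 (here refl) phi-pole-a)) (sym (at-pole b≢0 (there (here refl)) phi-pole-b))) ⟩
        a * b * (a * b) * ((x * u′) * (x * u′) * q₀ * ((y * v′) * (y * v′) * q₀)) - ι 4 * (w * w)
          ≡⟨ cong (_- ι 4 * (w * w)) (solve 7 (λ a b x y u v q → a :* b :* (a :* b) :* ((x :* u) :* (x :* u) :* q :* ((y :* v) :* (y :* v) :* q))
               := (a :* x) :* (a :* x) :* ((b :* y) :* (b :* y)) :* ((u :* v) :* (u :* v)) :* (q :* q)) refl a b x y u′ v′ q₀) ⟩
        (a * x) * (a * x) * ((b * y) * (b * y)) * ((u′ * v′) * (u′ * v′)) * (q₀ * q₀) - ι 4 * (w * w)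
          ≡⟨ cong₂ (λ s t → s * s * ((b * y) * (b * y)) * (t * t) * (q₀ * q₀) - ι 4 * (w * w)) (a*pole a≢0) uv≡ ⟩
        (- 1#) * (- 1#) * ((b * y) * (b * y)) * ((- ι 2 * (p₀ * p₀)) * (- ι 2 * (p₀ * p₀))) * (q₀ * q₀) - ι 4 * (w * w)
          ≡⟨ cong (λ s → (- 1#) * (- 1#) * (s * s) * ((- ι 2 * (p₀ * p₀)) * (- ι 2 * (p₀ * p₀))) * (q₀ * q₀) - ι 4 * (w * w)) (a*pole b≢0) ⟩
        (- 1#) * (- 1#) * ((- 1#) * (- 1#)) * ((- ι 2 * (p₀ * p₀)) * (- ι 2 * (p₀ * p₀))) * (q₀ * q₀) - ι 4 * (w * w)
          ≡⟨ solve 2 (λ p q → let o = :- # 1; t = :- # 2 :* (p :* p); w = p :* p :* q in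
               o :* o :* (o :* o) :* (t :* t) :* (q :* q) :- # 4 :* (w :* w) := # 0) refl p₀ q₀ ⟩
        0# ∎)
        where
        open ≡-Reasoning
        x = pole a
        y = pole b
        u′ = P̂ 0 x
        v′ = P̂ 0 y
        p₀ = P̂ 0 0#

    -- The bounds leave N ≤ 2n ≤ N + 1. For 2n = N + 1 the quotient q is constant and the cofactor
    -- of V in the covering product is linear; for 2n = N it is the other way round.
    module OutsideSubgroup (ds : List Carrier) (uds : Unique ds)
      (good : All (λ y → All (Periodic.Good N (- 1#) y) nodes) ds)
      (hs : List Carrier) (uhs : Unique hs) (∣hs∣ : length hs ≡ N)
      (coset : All (λ x → lin x 1# ^ N ≡ - 1#) hs) (covered : All (Covered ds) hs)
      (enough : N ≤ length ds ℕ.+ length ds) where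

      private
        -1≢0 : - 1# ≢ 0#
        -1≢0 e = 1≢0 (trans (solve 0 (# 1 := :- :- # 1) refl)
          (trans (cong -_ e) (solve 0 (:- # 0 := # 0) refl)))
        n : ℕ
        n = length ds
        f P V U : Jet
        f = phi nodes 0 m ⊝ C (- 1#)
        P = rootProduct ds
        V = Coset.V (2 ℕ.+ N′) (- 1#)
        U = coverProduct ds

        factors : ∃ λ q → Len (suc m ℕ.∸ n ℕ.* 2) q × f ≈ P ^^ 2 ⊗ q
        factors = Factorization.factorization N′ (- 1#) -1≢0 a (b ∷ []) nodes-unique nodes≢0 ds uds good char

        2n : n ℕ.* 2 ≡ n ℕ.+ n
        2n = trans (ℕₚ.*-comm n 2) (cong (n ℕ.+_) (ℕₚ.+-identityʳ n))

        bound : n ℕ.+ n ≤ suc N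
        bound = subst₂ _≤_ 2n (sym m≡)
          (Factorization.degree-bound N′ (- 1#) -1≢0 a (b ∷ []) nodes-unique nodes≢0 ds uds good char)

        q : Jet
        q = proj₁ factors

        f≈ : f ≈ (P ⊗ P) ⊗ q
        f≈ = ≈-trans (proj₂ (proj₂ factors)) (⊗-cong (⊗-cong (≈-refl {P}) (≈-trans (⊗-comm P (C 1#)) (⊗-identityˡ P))) (≈-refl {q}))

        p p₁ p₂ u v xa xb : Carrier
        p = P 0 0#
        p₁ = P 1 0#
        p₂ = P 2 0#
        xa = pole a
        xb = pole b
        u = P 0 xa
        v = P 0 xb

        value-0 : p * p * q 0 0# ≡ ι 2
        value-0 = trans (sym (at f≈ 0 0#)) (trans (cong (_- - 1#) (val-zero a (b ∷ []) m))
          (solve 0 (# 1 :- :- # 1 := # 2) refl))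

        p≢0 : p ≢ 0#
        p≢0 e = 2≢0 (trans (sym value-0) (trans (cong (λ z → z * z * q 0 0#) e)
          (solve 1 (λ q → # 0 :* # 0 :* q := # 0) refl (q 0 0#))))

        value-1 : (p₁ * p + p * p₁) * q 0 0# + p * p * q 1 0# ≡ 0#
        value-1 = trans (sym (at f≈ 1 0#)) (trans (⊝C-suc (phi nodes 0 m) (- 1#) 0 0#) phi-1)

        value-2 : ι 4 * ((((p₂ * p + p₁ * p₁) + (p₁ * p₁ + p * p₂)) * q 0 0# + (p₁ * p + p * p₁) * q 1 0#)
                       + ((p₁ * p + p * p₁) * q 1 0# + p * p * q 2 0#)) ≡ a * b
        value-2 = trans (cong (ι 4 *_) (trans (sym (at f≈ 2 0#)) (⊝C-suc (phi nodes 0 m) (- 1#) 1 0#))) phi-2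

        -- f is 2 or 0 at the pole, and a zero must come from q, since the pole is not a root of P.
        at-pole : ∀ {c} → c ∈ nodes → c ≢ 0# → let x = pole c in P 0 x * P 0 x * q 0 x ≡ ι 2 ⊎ q 0 x ≡ 0#
        at-pole {c} c∈ c≢0 = value (phi-pole a≢b a≢0 b≢0 N square m m≡ c∈)
          where
          x : Carrier
          x = pole c
          x∉ : All (x ≢_) ds
          x∉ = All.map (λ {y} g x≡y → lin≢0 (2 ℕ.+ N′) y -1≢0 (All.lookup g c∈) (subst (λ z → lin z c ≡ 0#) x≡y (lin-pole c≢0))) good
          value : phi nodes 0 m 0 x ≡ 1# ⊎ phi nodes 0 m 0 x ≡ - 1# → P 0 x * P 0 x * q 0 x ≡ ι 2 ⊎ q 0 x ≡ 0#
          value (inj₁ e) = inj₁ (trans (sym (at f≈ 0 x)) (trans (cong (_- - 1#) e)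
            (solve 0 (# 1 :- :- # 1 := # 2) refl)))
          value (inj₂ e) = inj₂ (*-≡0 (*-≢0 (rootProduct-≢0 ds x∉) (rootProduct-≢0 ds x∉))
            (trans (sym (at f≈ 0 x)) (trans (cong (_- - 1#) e) (+-inverseʳ (- 1#)))))

        ιN≢0 : ι (3 ℕ.+ N′) ≢ 0#
        ιN≢0 = char (2 ℕ.+ N′) (subst (2 ℕ.+ N′ <_) m≡ (ℕₚ.n≤1+n N))

        cover : ∀ l → n ℕ.+ suc n ≡ N ℕ.+ l → ∃ λ c → ∃ λ w → c ≢ 0# × Len l w × C c ⊗ U ≈ V ⊗ w
        cover l eq = Coset.Cover.cover (2 ℕ.+ N′) (- 1#) hs uhs ∣hs∣ coset ιN≢0
          (subst (λ l → Len l U) eq (Len-coverProduct ds)) (All.map coverProduct-root covered)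

        V₀ : V 0 0# ≡ ι 2
        V₀ = trans (Coset.V-0 (2 ℕ.+ N′) (- 1#)) (solve 0 (# 1 :- :- # 1 := # 2) refl)
        V₋₁ : V 0 (- 1#) ≡ 1#
        V₋₁ = trans (Coset.V-minus-1 (2 ℕ.+ N′) (- 1#)) (solve 0 (:- :- # 1 := # 1) refl)
        V₁ : V 1 0# ≡ ι N
        V₁ = Coset.V-1 (2 ℕ.+ N′) (- 1#)
        V₂ : V 2 0# ≡ ι (3 ℕ.+ N′) * ι (2 ℕ.+ N′)
        V₂ = Coset.V-2 (2 ℕ.+ N′) (- 1#) (1 ℕ.+ N′) refl

      -- f′(0) = 0 forces P′(0) = 0 and hence U′(0) = 0. With 2N = -1 the linear cofactor is then
      -- proportional to 4 + X, and comparing values at 0 and -1 gives 8 U(-1) = 3 U(0).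
      odd : n ℕ.+ n ≡ suc N → ⊥
      odd 2n≡ = constant-quotient {p} {u} {v} {q₀} value-0 (nonvanishing a a≢0 (here refl)) (nonvanishing b b≢0 (there (here refl))) uv≡
        where
        open ≡-Reasoning
        q₀ : Carrier
        q₀ = q 0 0#
        q≈ : q ≈ C q₀
        q≈ = Len-const (subst (λ l → Len l q) (trans (cong₂ (λ s t → suc s ℕ.∸ t) (sym m≡) (trans 2n 2n≡)) (ℕₚ.m+n∸n≡m 1 (suc N)))
               (proj₁ (proj₂ factors)))
        q₀≢0 : q₀ ≢ 0#
        q₀≢0 = *-≢0ʳ (λ e → 2≢0 (trans (sym value-0) e))

        nonvanishing : ∀ c → c ≢ 0# → c ∈ nodes → P 0 (pole c) * P 0 (pole c) * q₀ ≡ ι 2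
        nonvanishing c c≢0 c∈ = go (at-pole c∈ c≢0)
          where
          go : P 0 (pole c) * P 0 (pole c) * q 0 (pole c) ≡ ι 2 ⊎ q 0 (pole c) ≡ 0# → P 0 (pole c) * P 0 (pole c) * q₀ ≡ ι 2
          go (inj₁ e) = trans (cong (P 0 (pole c) * P 0 (pole c) *_) (sym (at q≈ 0 (pole c)))) e
          go (inj₂ e) = ⊥-elim (q₀≢0 (trans (sym (at q≈ 0 (pole c))) e))

        p₁≡0 : p₁ ≡ 0#
        p₁≡0 = *-≡0 (*-≢0 2≢0 (*-≢0 p≢0 q₀≢0)) (begin
          ι 2 * (p * q₀) * p₁
            ≡⟨ solve 3 (λ p r q → # 2 :* (p :* q) :* r := (r :* p :+ p :* r) :* q :+ p :* p :* # 0) refl p p₁ q₀ ⟩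
          (p₁ * p + p * p₁) * q₀ + p * p * 0#
            ≡⟨ cong (λ z → (p₁ * p + p * p₁) * q₀ + p * p * z) (at q≈ 1 0#) ⟨
          (p₁ * p + p * p₁) * q₀ + p * p * q 1 0#
            ≡⟨ value-1 ⟩
          0# ∎)

        U₁≡0 : U 1 0# ≡ 0#
        U₁≡0 = *-≡0 (*-≢0 a≢0 b≢0) (trans (cover-1 ds) (trans (cong (λ z → c₀ ds * ((a + b) * (p * z))) p₁≡0)
          (solve 3 (λ c s p → c :* (s :* (p :* # 0)) := # 0) refl (c₀ ds) (a + b) p)))

        cov : ∃ λ c → ∃ λ w → c ≢ 0# × Len 2 w × C c ⊗ U ≈ V ⊗ w
        cov = cover 2 (trans (ℕₚ.+-suc n n) (trans (cong suc 2n≡) (ℕₚ.+-comm 2 N)))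
        c : Carrier
        c = proj₁ cov
        w : Jet
        w = proj₁ (proj₂ cov)
        lin-w : ∃ λ w₀ → ∃ λ w₁ → w ≈ C w₀ ⊕ X ⊗ C w₁
        lin-w = Len-linear (proj₁ (proj₂ (proj₂ (proj₂ cov))))
        w₀ w₁ : Carrier
        w₀ = proj₁ lin-w
        w₁ = proj₁ (proj₂ lin-w)
        rel : C c ⊗ U ≈ V ⊗ (C w₀ ⊕ X ⊗ C w₁)
        rel = ≈-trans (proj₂ (proj₂ (proj₂ (proj₂ cov)))) (⊗-cong (≈-refl {V}) (proj₂ (proj₂ lin-w)))

        cU₀ : c * U 0 0# ≡ ι 2 * w₀
        cU₀ = trans (at rel 0 0#) (trans (cong (_* (w₀ + 0# * w₁)) V₀)
          (solve 2 (λ w x → # 2 :* (w :+ # 0 :* x) := # 2 :* w) refl w₀ w₁))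
        cU₋₁ : c * U 0 (- 1#) ≡ w₀ - w₁
        cU₋₁ = trans (at rel 0 (- 1#)) (trans (cong (_* (w₀ + - 1# * w₁)) V₋₁)
          (solve 2 (λ w x → # 1 :* (w :+ :- # 1 :* x) := w :- x) refl w₀ w₁))

        w₀≡ : w₀ ≡ ι 4 * w₁
        w₀≡ = begin
          w₀
            ≡⟨ solve 3 (λ w x n → w := # 4 :* x :- # 2 :* (n :* w :+ # 2 :* x) :+ (# 2 :* n :+ # 1) :* w) refl w₀ w₁ (ι N) ⟩
          ι 4 * w₁ - ι 2 * (ι N * w₀ + ι 2 * w₁) + (ι 2 * ι N + 1#) * w₀
            ≡⟨ cong₂ (λ y z → ι 4 * w₁ - ι 2 * y + (z + 1#) * w₀) derivative half ⟩
          ι 4 * w₁ - ι 2 * 0# + (- 1# + 1#) * w₀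
            ≡⟨ solve 2 (λ w x → # 4 :* x :- # 2 :* # 0 :+ (:- # 1 :+ # 1) :* w := # 4 :* x) refl w₀ w₁ ⟩
          ι 4 * w₁ ∎
          where
          derivative : ι N * w₀ + ι 2 * w₁ ≡ 0#
          derivative = begin
            ι N * w₀ + ι 2 * w₁
              ≡⟨ solve 4 (λ m t w x → m :* w :+ t :* x :=
                   m :* (w :+ # 0 :* x) :+ t :* (# 0 :+ (# 1 :* x :+ # 0 :* # 0))) refl (ι N) (ι 2) w₀ w₁ ⟩
            ι N * (w₀ + 0# * w₁) + ι 2 * (0# + (1# * w₁ + 0# * 0#))
              ≡⟨ cong₂ (λ y z → y * (w₀ + 0# * w₁) + z * (0# + (1# * w₁ + 0# * 0#))) V₁ V₀ ⟨
            (V ⊗ (C w₀ ⊕ X ⊗ C w₁)) 1 0#    ≡⟨ at rel 1 0# ⟨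
            (C c ⊗ U) 1 0#                  ≡⟨ C⊗ c U 1 0# ⟩
            c * U 1 0#                      ≡⟨ cong (c *_) U₁≡0 ⟩
            c * 0#                          ≡⟨ zeroʳ c ⟩
            0# ∎

        U≡ : ι 8 * U 0 (- 1#) ≡ ι 3 * U 0 0#
        U≡ = *-cancelˡ (proj₁ (proj₂ (proj₂ cov))) (begin
          c * (ι 8 * U 0 (- 1#))   ≡⟨ solve 3 (λ c e u → c :* (e :* u) := e :* (c :* u)) refl c (ι 8) (U 0 (- 1#)) ⟩
          ι 8 * (c * U 0 (- 1#))   ≡⟨ cong (ι 8 *_) (trans cU₋₁ (cong (_- w₁) w₀≡)) ⟩
          ι 8 * (ι 4 * w₁ - w₁)    ≡⟨ solve 1 (λ x → # 8 :* (# 4 :* x :- x) := # 3 :* (# 2 :* (# 4 :* x))) refl w₁ ⟩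
          ι 3 * (ι 2 * (ι 4 * w₁)) ≡⟨ cong (λ z → ι 3 * (ι 2 * z)) w₀≡ ⟨
          ι 3 * (ι 2 * w₀)         ≡⟨ cong (ι 3 *_) cU₀ ⟨
          ι 3 * (c * U 0 0#)       ≡⟨ solve 3 (λ c e u → e :* (c :* u) := c :* (e :* u)) refl c (ι 3) (U 0 0#) ⟩
          c * (ι 3 * U 0 0#) ∎)

        uv≡ : ι 8 * (u * v) ≡ ι 3 * (p * p)
        uv≡ = *-cancelˡ (c₀≢0 ds) (begin
          c₀ ds * (ι 8 * (u * v))  ≡⟨ solve 3 (λ c e u → c :* (e :* u) := e :* (c :* u)) refl (c₀ ds) (ι 8) (u * v) ⟩
          ι 8 * (c₀ ds * (u * v))  ≡⟨ cong (ι 8 *_) (cover-minus-1 ds) ⟨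
          ι 8 * U 0 (- 1#)         ≡⟨ U≡ ⟩
          ι 3 * U 0 0#             ≡⟨ cong (ι 3 *_) (cover-0 ds) ⟩
          ι 3 * (c₀ ds * (p * p))  ≡⟨ solve 3 (λ c e u → e :* (c :* u) := c :* (e :* u)) refl (c₀ ds) (ι 3) (p * p) ⟩
          c₀ ds * (ι 3 * (p * p)) ∎)

      -- U is a constant multiple of V = (1 + X)^N + 1, whose derivatives at 0 follow from 2N = -1.
      -- Writing q = q₀ (1 + t X), the derivatives of f at 0 express P′(0) and P′′(0) through t;
      -- together these are two equations in a, b and t, and the poles supply a third.
      even : n ℕ.+ n ≡ N → ⊥
      even 2n≡ = linear-quotient {a} {b} {t} a≢0 b≢0 first second third
        where
        open ≡-Reasoning
        lin-q : ∃ λ q₀ → ∃ λ q₁ → q ≈ C q₀ ⊕ X ⊗ C q₁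
        lin-q = Len-linear (subst (λ l → Len l q) (trans (cong₂ (λ s t → suc s ℕ.∸ t) (sym m≡) (trans 2n 2n≡)) (ℕₚ.m+n∸n≡m 2 N))
               (proj₁ (proj₂ factors)))
        q₀ q₁ t ρ : Carrier
        q₀ = proj₁ lin-q
        q₁ = proj₁ (proj₂ lin-q)
        t = q₁ * q₀ ⁻¹
        ρ = p₂ * p ⁻¹
        q≈ : q ≈ C q₀ ⊕ X ⊗ C q₁
        q≈ = proj₂ (proj₂ lin-q)
        q-0 : q 0 0# ≡ q₀
        q-0 = trans (at q≈ 0 0#) (solve 2 (λ q r → q :+ # 0 :* r := q) refl q₀ q₁)
        q-1 : q 1 0# ≡ q₁
        q-1 = trans (at q≈ 1 0#) (solve 1 (λ r → # 0 :+ (# 1 :* r :+ # 0 :* # 0) := r) refl q₁)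
        q-2 : q 2 0# ≡ 0#
        q-2 = trans (at q≈ 2 0#) (solve 1 (λ r → let z = # 0 in
          z :+ ((z :* r :+ # 1 :* z) :+ (# 1 :* z :+ z :* z)) := z) refl q₁)
        ppq : p * p * q₀ ≡ ι 2
        ppq = trans (cong (p * p *_) (sym q-0)) value-0
        q₀≢0 : q₀ ≢ 0#
        q₀≢0 = *-≢0ʳ (λ e → 2≢0 (trans (sym ppq) e))
        q₁≡ : q₁ ≡ q₀ * t
        q₁≡ = sym (trans (solve 3 (λ u v i → u :* (v :* i) := v :* (u :* i)) refl q₀ q₁ (q₀ ⁻¹))
          (trans (cong (q₁ *_) (*-inverseʳ q₀ q₀≢0)) (trans (*-comm q₁ 1#) (*-identityˡ q₁))))
        p₂≡ : p₂ ≡ p * ρ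
        p₂≡ = sym (trans (solve 3 (λ u v i → u :* (v :* i) := v :* (u :* i)) refl p p₂ (p ⁻¹))
          (trans (cong (p₂ *_) (*-inverseʳ p p≢0)) (trans (*-comm p₂ 1#) (*-identityˡ p₂))))

        2p₁≡ : ι 2 * p₁ ≡ - (p * t)
        2p₁≡ = x-y≡0⇒x≡y (*-≡0 (*-≢0 p≢0 q₀≢0) (begin
          p * q₀ * (ι 2 * p₁ - - (p * t))
            ≡⟨ solve 4 (λ p r q t → p :* q :* (# 2 :* r :- :- (p :* t))
                 := (r :* p :+ p :* r) :* q :+ p :* p :* (q :* t)) refl p p₁ q₀ t ⟩
          (p₁ * p + p * p₁) * q₀ + p * p * (q₀ * t)
            ≡⟨ cong₂ (λ y z → (p₁ * p + p * p₁) * y + p * p * z) (sym q-0) (trans (sym q₁≡) (sym q-1)) ⟩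
          (p₁ * p + p * p₁) * q 0 0# + p * p * q 1 0#
            ≡⟨ value-1 ⟩
          0# ∎))

        -- This is f′′(0) for f = P² q, with P′(0) = -p t/2. `Ψ s` is 4 f′′(0) + 12 t² as a function
        -- of s = p² q₀, and at s = 2 the terms in t² cancel.
        16ρ≡ : ι 16 * ρ ≡ a * b + ι 12 * (t * t)
        16ρ≡ = begin
          ι 16 * ρ
            ≡⟨ solve 2 (λ r t → let s = # 2 in # 16 :* r :=
                 (# 8 :* r :* s :+ # 2 :* t :* t :* s :- # 8 :* t :* t :* s) :+ # 12 :* (t :* t)) refl ρ t ⟩
          Ψ (ι 2)
            ≡⟨ cong Ψ ppq ⟨
          Ψ (p * p * q₀)
            ≡⟨ solve 4 (λ p q r t → let s = p :* p :* q; x = :- (p :* t) in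
                 (# 8 :* r :* s :+ # 2 :* t :* t :* s :- # 8 :* t :* t :* s) :+ # 12 :* (t :* t)
                 := (# 8 :* (p :* r :* p) :* q :+ # 2 :* (x :* x) :* q :+ # 8 :* p :* x :* (q :* t)) :+ # 12 :* (t :* t)) refl p q₀ ρ t ⟩
          (ι 8 * (p * ρ * p) * q₀ + ι 2 * (- (p * t) * - (p * t)) * q₀ + ι 8 * p * - (p * t) * (q₀ * t)) + ι 12 * (t * t)
            ≡⟨ cong₂ (λ x y → (ι 8 * (y * p) * q₀ + ι 2 * (x * x) * q₀ + ι 8 * p * x * (q₀ * t)) + ι 12 * (t * t)) (sym 2p₁≡) (sym p₂≡) ⟩
          (ι 8 * (p₂ * p) * q₀ + ι 2 * (ι 2 * p₁ * (ι 2 * p₁)) * q₀ + ι 8 * p * (ι 2 * p₁) * (q₀ * t)) + ι 12 * (t * t)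
            ≡⟨ cong (_+ ι 12 * (t * t)) (solve 5 (λ p r s q z → # 8 :* (s :* p) :* q :+ # 2 :* (# 2 :* r :* (# 2 :* r)) :* q :+ # 8 :* p :* (# 2 :* r) :* z
                 := # 4 :* ((((s :* p :+ r :* r) :+ (r :* r :+ p :* s)) :* q :+ (r :* p :+ p :* r) :* z)
                       :+ ((r :* p :+ p :* r) :* z :+ p :* p :* # 0))) refl p p₁ p₂ q₀ (q₀ * t)) ⟩
          Θ q₀ (q₀ * t) 0# + ι 12 * (t * t)
            ≡⟨ cong₂ (λ y z → Θ y z 0# + ι 12 * (t * t)) (sym q-0) (trans (sym q₁≡) (sym q-1)) ⟩
          Θ (q 0 0#) (q 1 0#) 0# + ι 12 * (t * t)
            ≡⟨ cong (λ z → Θ (q 0 0#) (q 1 0#) z + ι 12 * (t * t)) q-2 ⟨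
          Θ (q 0 0#) (q 1 0#) (q 2 0#) + ι 12 * (t * t)
            ≡⟨ cong (_+ ι 12 * (t * t)) value-2 ⟩
          a * b + ι 12 * (t * t) ∎
          where
          Ψ : Carrier → Carrier
          Ψ s = (ι 8 * ρ * s + ι 2 * t * t * s - ι 8 * t * t * s) + ι 12 * (t * t)
          Θ : Carrier → Carrier → Carrier → Carrier
          Θ y z w = ι 4 * ((((p₂ * p + p₁ * p₁) + (p₁ * p₁ + p * p₂)) * y + (p₁ * p + p * p₁) * z)
                       + ((p₁ * p + p * p₁) * z + p * p * w))

        cov : ∃ λ c → ∃ λ w → c ≢ 0# × Len 1 w × C c ⊗ U ≈ V ⊗ w
        cov = cover 1 (trans (ℕₚ.+-suc n n) (trans (cong suc 2n≡) (ℕₚ.+-comm 1 N)))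
        c w₀ : Carrier
        c = proj₁ cov
        w₀ = proj₁ (proj₂ cov) 0 0#
        c≢0 : c ≢ 0#
        c≢0 = proj₁ (proj₂ (proj₂ cov))
        rel : C c ⊗ U ≈ C w₀ ⊗ V
        rel = ≈-trans (proj₂ (proj₂ (proj₂ (proj₂ cov)))) (≈-trans (⊗-cong (≈-refl {V}) (Len-const (proj₁ (proj₂ (proj₂ (proj₂ cov))))))
          (⊗-comm V (C w₀)))
        cU : ∀ j x {y} → V j x ≡ y → c * U j x ≡ w₀ * y
        cU j x e = trans (sym (C⊗ c U j x)) (trans (at rel j x) (trans (C⊗ w₀ V j x) (cong (w₀ *_) e)))

        U₋₁ : U 0 0# ≡ ι 2 * U 0 (- 1#)
        U₋₁ = *-cancelˡ c≢0 (begin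
          c * U 0 0#              ≡⟨ cU 0 0# V₀ ⟩
          w₀ * ι 2                ≡⟨ solve 1 (λ w → w :* # 2 := # 2 :* (w :* # 1)) refl w₀ ⟩
          ι 2 * (w₀ * 1#)         ≡⟨ cong (ι 2 *_) (cU 0 (- 1#) V₋₁) ⟨
          ι 2 * (c * U 0 (- 1#))  ≡⟨ solve 2 (λ c u → # 2 :* (c :* u) := c :* (# 2 :* u)) refl c (U 0 (- 1#)) ⟩
          c * (ι 2 * U 0 (- 1#)) ∎)

        U₁ : ι 4 * U 1 0# ≡ - U 0 0#
        U₁ = *-cancelˡ c≢0 (begin
          c * (ι 4 * U 1 0#)      ≡⟨ solve 2 (λ c u → c :* (# 4 :* u) := # 4 :* (c :* u)) refl c (U 1 0#) ⟩
          ι 4 * (c * U 1 0#)      ≡⟨ cong (ι 4 *_) (cU 1 0# V₁) ⟩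
          ι 4 * (w₀ * ι N)        ≡⟨ solve 2 (λ w n → # 4 :* (w :* n) := # 2 :* w :* (# 2 :* n)) refl w₀ (ι N) ⟩
          ι 2 * w₀ * (ι 2 * ι N)  ≡⟨ cong (ι 2 * w₀ *_) half ⟩
          ι 2 * w₀ * - 1#         ≡⟨ solve 1 (λ w → # 2 :* w :* :- # 1 := :- (w :* # 2)) refl w₀ ⟩
          - (w₀ * ι 2)            ≡⟨ cong -_ (cU 0 0# V₀) ⟨
          - (c * U 0 0#)          ≡⟨ solve 2 (λ c u → :- (c :* u) := c :* :- u) refl c (U 0 0#) ⟩
          c * - U 0 0# ∎)

        U₂ : ι 8 * U 2 0# ≡ ι 3 * U 0 0#
        U₂ = *-cancelˡ c≢0 (begin
          c * (ι 8 * U 2 0#)      ≡⟨ solve 2 (λ c u → c :* (# 8 :* u) := # 8 :* (c :* u)) refl c (U 2 0#) ⟩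
          ι 8 * (c * U 2 0#)      ≡⟨ cong (ι 8 *_) (cU 2 0# V₂) ⟩
          ι 8 * (w₀ * ((1# + N₋₁) * N₋₁))
            ≡⟨ solve 2 (λ w n → let N₂ = # 2 :* (# 1 :+ n) in
                 # 8 :* (w :* ((# 1 :+ n) :* n)) := # 2 :* w :* (N₂ :* (N₂ :- # 2))) refl w₀ N₋₁ ⟩
          ι 2 * w₀ * (ι 2 * ι N * (ι 2 * ι N - ι 2))
            ≡⟨ cong (λ z → ι 2 * w₀ * (z * (z - ι 2))) half ⟩
          ι 2 * w₀ * (- 1# * (- 1# - ι 2))
            ≡⟨ solve 1 (λ w → # 2 :* w :* (:- # 1 :* (:- # 1 :- # 2)) := # 3 :* (w :* # 2)) refl w₀ ⟩
          ι 3 * (w₀ * ι 2)        ≡⟨ cong (ι 3 *_) (cU 0 0# V₀) ⟨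
          ι 3 * (c * U 0 0#)      ≡⟨ solve 2 (λ c u → # 3 :* (c :* u) := c :* (# 3 :* u)) refl c (U 0 0#) ⟩
          c * (ι 3 * U 0 0#) ∎)
          where
          N₋₁ : Carrier
          N₋₁ = ι (2 ℕ.+ N′)

        pp≡ : p * p ≡ ι 2 * (u * v)
        pp≡ = *-cancelˡ (c₀≢0 ds) (begin
          c₀ ds * (p * p)           ≡⟨ cover-0 ds ⟨
          U 0 0#                    ≡⟨ U₋₁ ⟩
          ι 2 * U 0 (- 1#)          ≡⟨ cong (ι 2 *_) (cover-minus-1 ds) ⟩
          ι 2 * (c₀ ds * (u * v))   ≡⟨ solve 2 (λ c u → # 2 :* (c :* u) := c :* (# 2 :* u)) refl (c₀ ds) (u * v) ⟩
          c₀ ds * (ι 2 * (u * v)) ∎)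

        first : ι 2 * (a + b) * t ≡ a * b
        first = *-cancelˡ (*-≢0 (c₀≢0 ds) (*-≢0 p≢0 p≢0)) (begin
          c₀ ds * (p * p) * (ι 2 * (a + b) * t)
            ≡⟨ solve 4 (λ c p s t → c :* (p :* p) :* (# 2 :* s :* t) := :- (# 2 :* c :* s :* p :* :- (p :* t))) refl (c₀ ds) p (a + b) t ⟩
          - (ι 2 * c₀ ds * (a + b) * p * - (p * t))
            ≡⟨ cong (λ z → - (ι 2 * c₀ ds * (a + b) * p * z)) 2p₁≡ ⟨
          - (ι 2 * c₀ ds * (a + b) * p * (ι 2 * p₁))
            ≡⟨ solve 4 (λ c p s r → :- (# 2 :* c :* s :* p :* (# 2 :* r)) := :- (# 4 :* (c :* (s :* (p :* r))))) refl (c₀ ds) p (a + b) p₁ ⟩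
          - (ι 4 * (c₀ ds * ((a + b) * (p * p₁))))
            ≡⟨ cong (λ z → - (ι 4 * z)) (cover-1 ds) ⟨
          - (ι 4 * (a * b * U 1 0#))
            ≡⟨ solve 2 (λ s u → :- (# 4 :* (s :* u)) := :- (s :* (# 4 :* u))) refl (a * b) (U 1 0#) ⟩
          - (a * b * (ι 4 * U 1 0#))
            ≡⟨ cong (λ z → - (a * b * z)) (trans U₁ (cong -_ (cover-0 ds))) ⟩
          - (a * b * - (c₀ ds * (p * p)))
            ≡⟨ solve 2 (λ s u → :- (s :* :- u) := u :* s) refl (a * b) (c₀ ds * (p * p)) ⟩
          c₀ ds * (p * p) * (a * b) ∎)

        second : (a * a + b * b) * (a * b + ι 12 * (t * t)) + ι 8 * (a * b) * (t * t) ≡ ι 6 * ((a * b) * (a * b))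
        second = *-cancelˡ (*-≢0 (c₀≢0 ds) (*-≢0 p≢0 p≢0)) (begin
          c₀ ds * (p * p) * ((a * a + b * b) * (a * b + ι 12 * (t * t)) + ι 8 * (a * b) * (t * t))
            ≡⟨ cong (λ z → c₀ ds * (p * p) * ((a * a + b * b) * z + ι 8 * (a * b) * (t * t))) 16ρ≡ ⟨
          c₀ ds * (p * p) * ((a * a + b * b) * (ι 16 * ρ) + ι 8 * (a * b) * (t * t))
            ≡⟨ solve 6 (λ c p s y r t → c :* (p :* p) :* (s :* (# 16 :* r) :+ # 8 :* y :* (t :* t))
                 := c :* (# 16 :* s :* (p :* (p :* r)) :+ # 8 :* y :* (:- (p :* t) :* :- (p :* t)))) refl (c₀ ds) p (a * a + b * b) (a * b) ρ t ⟩
          c₀ ds * (ι 16 * (a * a + b * b) * (p * (p * ρ)) + ι 8 * (a * b) * (- (p * t) * - (p * t)))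
            ≡⟨ cong₂ (λ y z → c₀ ds * (ι 16 * (a * a + b * b) * (p * y) + ι 8 * (a * b) * (z * z))) (sym p₂≡) (sym 2p₁≡) ⟩
          c₀ ds * (ι 16 * (a * a + b * b) * (p * p₂) + ι 8 * (a * b) * (ι 2 * p₁ * (ι 2 * p₁)))
            ≡⟨ solve 5 (λ c s y z r → c :* (# 16 :* s :* z :+ # 8 :* y :* (# 2 :* r :* (# 2 :* r)))
                 := # 16 :* (c :* (s :* z :+ # 2 :* y :* (r :* r)))) refl (c₀ ds) (a * a + b * b) (a * b) (p * p₂) p₁ ⟩
          ι 16 * (c₀ ds * ((a * a + b * b) * (p * p₂) + ι 2 * (a * b) * (p₁ * p₁)))
            ≡⟨ cong (ι 16 *_) (cover-2 ds) ⟨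
          ι 16 * ((a * b) * (a * b) * U 2 0#)
            ≡⟨ solve 2 (λ s u → # 16 :* (s :* u) := # 2 :* s :* (# 8 :* u)) refl ((a * b) * (a * b)) (U 2 0#) ⟩
          ι 2 * ((a * b) * (a * b)) * (ι 8 * U 2 0#)
            ≡⟨ cong (ι 2 * ((a * b) * (a * b)) *_) (trans U₂ (cong (ι 3 *_) (cover-0 ds))) ⟩
          ι 2 * ((a * b) * (a * b)) * (ι 3 * (c₀ ds * (p * p)))
            ≡⟨ solve 2 (λ s u → # 2 :* s :* (# 3 :* u) := u :* (# 6 :* s)) refl ((a * b) * (a * b)) (c₀ ds * (p * p)) ⟩
          c₀ ds * (p * p) * (ι 6 * ((a * b) * (a * b))) ∎)

        q-at : ∀ x → q 0 x ≡ q₀ * (1# + x * t)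
        q-at x = trans (at q≈ 0 x) (trans (cong (λ z → q₀ + x * z) q₁≡)
          (solve 3 (λ q x t → q :+ x :* (q :* t) := q :* (# 1 :+ x :* t)) refl q₀ x t))

        at-node : ∀ {c} → c ≢ 0# → c * (1# + pole c * t) ≡ c - t
        at-node {c} c≢0 = trans (solve 3 (λ c x t → c :* (# 1 :+ x :* t) := c :+ (c :* x) :* t) refl c (pole c) t)
          (trans (cong (λ z → c + z * t) (a*pole c≢0)) (solve 2 (λ c t → c :+ :- # 1 :* t := c :- t) refl c t))

        root : ∀ {c} → c ≢ 0# → q 0 (pole c) ≡ 0# → c ≡ t
        root {c} c≢0 e = x-y≡0⇒x≡y (trans (sym (at-node c≢0))
          (trans (cong (c *_) (*-≡0 q₀≢0 (trans (sym (q-at (pole c))) e))) (zeroʳ c)))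

        -- q vanishes at -1/a only if a = t, and likewise for b. Otherwise f is 2 at both poles, and
        -- the product of the two values is compared with (p² q₀)² through p² = 2 u v.
        third : (a ≡ t ⊎ b ≡ t) ⊎ (a - t) * (b - t) ≡ ι 4 * (a * b)
        third = go (at-pole (here refl) a≢0) (at-pole (there (here refl)) b≢0)
          where
          go : u * u * q 0 xa ≡ ι 2 ⊎ q 0 xa ≡ 0# → v * v * q 0 xb ≡ ι 2 ⊎ q 0 xb ≡ 0# →
               (a ≡ t ⊎ b ≡ t) ⊎ (a - t) * (b - t) ≡ ι 4 * (a * b)
          go (inj₂ e) _        = inj₁ (inj₁ (root a≢0 e))
          go _        (inj₂ e) = inj₁ (inj₂ (root b≢0 e))
          go (inj₁ e) (inj₁ d) = inj₂ (*-cancelˡ (*-≢0 2≢0 2≢0) (begin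
            ι 2 * ι 2 * ((a - t) * (b - t))
              ≡⟨ cong₂ (λ y z → y * ι 2 * z) (sym ppq) (cong₂ _*_ (sym (at-node a≢0)) (sym (at-node b≢0))) ⟩
            p * p * q₀ * ι 2 * (a * ya * (b * yb))
              ≡⟨ cong (λ z → p * p * q₀ * z * (a * ya * (b * yb))) ppq ⟨
            p * p * q₀ * (p * p * q₀) * (a * ya * (b * yb))
              ≡⟨ cong (λ z → z * q₀ * (z * q₀) * (a * ya * (b * yb))) pp≡ ⟩
            ι 2 * (u * v) * q₀ * (ι 2 * (u * v) * q₀) * (a * ya * (b * yb))
              ≡⟨ solve 7 (λ u v q a b y z → let w = # 2 :* (u :* v) :* q in w :* w :* (a :* y :* (b :* z))
                   := # 4 :* (a :* b) :* ((u :* u :* (q :* y)) :* (v :* v :* (q :* z)))) refl u v q₀ a b ya yb ⟩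
            ι 4 * (a * b) * ((u * u * (q₀ * ya)) * (v * v * (q₀ * yb)))
              ≡⟨ cong₂ (λ y z → ι 4 * (a * b) * ((u * u * y) * (v * v * z))) (q-at xa) (q-at xb) ⟨
            ι 4 * (a * b) * ((u * u * q 0 xa) * (v * v * q 0 xb))
              ≡⟨ cong₂ (λ y z → ι 4 * (a * b) * (y * z)) e d ⟩
            ι 4 * (a * b) * (ι 2 * ι 2)
              ≡⟨ *-comm _ _ ⟩
            ι 2 * ι 2 * (ι 4 * (a * b)) ∎))
            where
            ya yb : Carrier
            ya = 1# + xa * t
            yb = 1# + xb * t

      impossible : ⊥
      impossible = go (ℕₚ.m≤n⇒m<n∨m≡n enough)
        where
        go : N < n ℕ.+ n ⊎ N ≡ n ℕ.+ n → ⊥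
        go (inj₁ N<2n) = odd (ℕₚ.≤-antisym bound N<2n)
        go (inj₂ N≡2n) = even (sym N≡2n)

  -- Multiplicative subgroups of a finite field

  open DecMembership _≟_ using (_∈?_)
  open Data.List.Relation.Unary.Unique.DecPropositional.Properties _≟_ using (deduplicate-!)

  listProduct : List Carrier → Carrier
  listProduct []       = 1#
  listProduct (x ∷ xs) = x * listProduct xs

  listProduct-↭ : ∀ {xs ys} → xs ↭ ys → listProduct xs ≡ listProduct ys
  listProduct-↭ _↭_.refl = refl
  listProduct-↭ (prep x p) = cong (x *_) (listProduct-↭ p)
  listProduct-↭ (swap x y p) = trans (cong (λ z → x * (y * z)) (listProduct-↭ p))
    (solve 3 (λ x y z → x :* (y :* z) := y :* (x :* z)) refl x y _)
  listProduct-↭ (_↭_.trans p q) = trans (listProduct-↭ p) (listProduct-↭ q)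

  listProduct-map : ∀ x gs → listProduct (map (x *_) gs) ≡ x ^ length gs * listProduct gs
  listProduct-map x []       = sym (*-identityˡ 1#)
  listProduct-map x (g ∷ gs) = trans (cong (x * g *_) (listProduct-map x gs))
    (solve 4 (λ x g u v → x :* g :* (u :* v) := x :* u :* (g :* v)) refl x g (x ^ length gs) (listProduct gs))

  listProduct-≢0 : ∀ {gs} → All (_≢ 0#) gs → listProduct gs ≢ 0#
  listProduct-≢0 []           = 1≢0
  listProduct-≢0 (g≢0 ∷ gs≢0) = *-≢0 g≢0 (listProduct-≢0 gs≢0)

  -- Multiplication by x permutes `gs`, so it leaves the product of all elements unchanged while
  -- multiplying it by the power of x.
  ^-order : ∀ {gs} → Unique gs → All (_≢ 0#) gs → (∀ {g h} → g ∈ gs → h ∈ gs → g * h ∈ gs) →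
            ∀ {x} → x ∈ gs → x ^ length gs ≡ 1#
  ^-order {gs} unique gs≢0 closed {x} x∈ = *-cancelˡ (listProduct-≢0 gs≢0) (begin
    listProduct gs * x ^ length gs     ≡⟨ *-comm _ _ ⟩
    x ^ length gs * listProduct gs     ≡⟨ listProduct-map x gs ⟨
    listProduct (map (x *_) gs)        ≡⟨ listProduct-↭ permutation ⟩
    listProduct gs                     ≡⟨ trans (*-comm (listProduct gs) 1#) (*-identityˡ _) ⟨
    listProduct gs * 1#                ∎)
    where
    open ≡-Reasoning
    permutation : map (x *_) gs ↭ gs
    permutation = ⊆⇒↭ (map-unique (λ _ _ → *-cancelˡ (All.lookup gs≢0 x∈)) unique)
      (λ y∈ → let g , g∈ , eq = ∈-map⁻ (x *_) y∈ in subst (_∈ gs) (sym eq) (closed x∈ g∈))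
      (ℕₚ.≤-reflexive (sym (length-map (x *_) gs)))

  -- With more roots the polynomial (1 + X)^(n+1) - 1 would be zero, against its derivative n + 1 at
  -- 0.
  roots-of-unity-≤ : ∀ n {gs} → ι (suc n) ≢ 0# → Unique gs → All (λ g → g ^ suc n ≡ 1#) gs → length gs ≤ suc n
  roots-of-unity-≤ n {gs} ιn≢0 unique roots = ℕₚ.≮⇒≥ λ n<gs → ιn≢0 (trans (sym (Coset.V-1 n 1#))
    (at (≈0-of-roots (map (_- 1#) gs)
      (map-unique (λ {x} {y} _ _ eq → x-y≡0⇒x≡y (trans (solve 2 (λ x y → x :- y := (x :- # 1) :- (y :- # 1)) refl x y)
         (x≡y⇒x-y≡0 eq))) unique)
      (Coset.Len-V n 1#)
      (All-map⁺ (All.map (λ {g} eq → Coset.V-root n 1# (trans (cong (_^ suc n)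
         (solve 1 (λ g → # 1 :+ # 1 :* (g :- # 1) := g) refl g)) eq)) roots))
      (subst (suc (suc n) ≤_) (sym (length-map (_- 1#) gs)) n<gs)) 1 0#))

  module Finite (P₀ : ℕ) (units : List Carrier) (units-unique : Unique units) (units≢0 : All (_≢ 0#) units)
                (units-complete : ∀ {x} → x ≢ 0# → x ∈ units) (∣units∣ : length units ≡ P₀)
                (char : ∀ j → j < P₀ → ι (suc j) ≢ 0#) (char-p : ι (suc P₀) ≡ 0#) where

    fermat : ∀ {x} → x ≢ 0# → x ^ P₀ ≡ 1#
    fermat {x} x≢0 = trans (cong (x ^_) (sym ∣units∣)) (^-order units-unique units≢0
      (λ g∈ h∈ → units-complete (*-≢0 (All.lookup units≢0 g∈) (All.lookup units≢0 h∈))) (units-complete x≢0))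

    -- With k = j + 2 and p = (i + 2) N + 1, multiplying coeffA by the index i + 2 = −1/N leaves a natural
    -- number below p.
    numeric : ∀ i j N′ → P₀ ≡ (2 ℕ.+ i) ℕ.* (3 ℕ.+ N′) → 4 ℕ.+ 7 ℕ.* j ℕ.+ 2 ℕ.* (j ℕ.* j) ≤ 3 ℕ.+ N′ →
              coeffA (ι (2 ℕ.+ j)) (ι (2 ℕ.+ N′)) (ι (1 ℕ.+ N′)) ≡ 0# → i ≡ 0 × j ≡ 0
    numeric i j N′ P₀≡ small A≡0 = conclude w refl
      where
      open ≡-Reasoning
      J n δ M : Carrier
      J = ι j
      n = ι (1 ℕ.+ N′)
      δ = ι (2 ℕ.+ i)
      M = 1# + (1# + n)
      s w : ℕ
      s = 4 ℕ.+ 7 ℕ.* j ℕ.+ 2 ℕ.* (j ℕ.* j)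
      w = 11 ℕ.* j ℕ.+ 4 ℕ.* (j ℕ.* j) ℕ.+ i ℕ.* s

      ds≡ : (2 ℕ.+ i) ℕ.* s ≡ w ℕ.+ (8 ℕ.+ 3 ℕ.* j)
      ds≡ = multiple-of-index i j

      ι-s : ι s ≡ ι 4 + ι 7 * J + ι 2 * (J * J)
      ι-s = trans (ι-+ (4 ℕ.+ 7 ℕ.* j) (2 ℕ.* (j ℕ.* j))) (cong₂ _+_ (trans (ι-+ 4 (7 ℕ.* j)) (cong (ι 4 +_) (ι-* 7 j)))
        (trans (ι-* 2 (j ℕ.* j)) (cong (ι 2 *_) (ι-* j j))))

      -- `coeffA` is (N - 1)(k - 1) times this bracket, with M = N; both factors are nonzero modulo
      -- p.
      bracket : (ι 8 + ι 3 * J) * M + ι s ≡ 0#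
      bracket = *-≡0 (*-≢0 (char (1 ℕ.+ N′) (ℕₚ.<-≤-trans (ℕₚ.n<1+n _) (ℕₚ.≤-trans (ℕₚ.n≤1+n _) N≤P₀)))
                           (char j (ℕₚ.<-≤-trans j<s (ℕₚ.≤-trans small N≤P₀)))) (begin
        (1# + n) * ι (suc j) * ((ι 8 + ι 3 * J) * M + ι s)
          ≡⟨ cong₂ (λ y z → (1# + n) * y * ((ι 8 + ι 3 * J) * M + z)) (ι-suc j) ι-s ⟩
        (1# + n) * (1# + J) * ((ι 8 + ι 3 * J) * M + (ι 4 + ι 7 * J + ι 2 * (J * J)))
          ≡⟨ solve 2 (λ n J →
               let K = # 1 :+ (# 1 :+ J) ; n₁ = # 1 :+ n
                   c = K :* (K :+ # 1) :* n₁ :* (# 3 :* n :+ # 2 :* K :+ # 4) in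
               n₁ :* (# 1 :+ J) :* ((# 8 :+ # 3 :* J) :* (# 1 :+ n₁)
                 :+ (# 4 :+ # 7 :* J :+ # 2 :* (J :* J)))
               := # 2 :* c :- (K :+ # 2) :* n₁ :* (# 2 :* K :* (K :+ # 1) :+ n₁ :* (# 3 :* K :+ # 1)))
               refl n J ⟩
        coeffA (1# + (1# + J)) (1# + n) n
          ≡⟨ cong (λ y → coeffA (1# + y) (1# + n) n) (ι-suc j) ⟨
        coeffA (ι (2 ℕ.+ j)) (1# + n) n
          ≡⟨ A≡0 ⟩
        0# ∎)
        where
        N≤P₀ : 3 ℕ.+ N′ ≤ P₀
        N≤P₀ = subst (3 ℕ.+ N′ ≤_) (sym P₀≡) (ℕₚ.m≤m+n (3 ℕ.+ N′) _)
        j<s : j < s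
        j<s = ℕₚ.≤-trans (s≤s (ℕₚ.≤-trans (ℕₚ.m≤m+n j (6 ℕ.* j)) (ℕₚ.m≤n+m (7 ℕ.* j) 3))) (ℕₚ.m≤m+n (4 ℕ.+ 7 ℕ.* j) _)

      δM≡-1 : δ * M ≡ - 1#
      δM≡-1 = x-y≡0⇒x≡y (begin
        δ * M - - 1#             ≡⟨ solve 2 (λ d m → d :* m :- :- # 1 := # 1 :+ d :* m) refl δ M ⟩
        1# + δ * M               ≡⟨ cong (1# +_) (ι-* (2 ℕ.+ i) (3 ℕ.+ N′)) ⟨
        1# + ι ((2 ℕ.+ i) ℕ.* (3 ℕ.+ N′)) ≡⟨ cong (λ m → 1# + ι m) P₀≡ ⟨
        1# + ι P₀                ≡⟨ ι-suc P₀ ⟨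
        ι (suc P₀)               ≡⟨ char-p ⟩
        0# ∎)

      ι-w : ι w ≡ 0#
      ι-w = begin
        ι w
          ≡⟨ solve 2 (λ w e → w := (w :+ e) :- e) refl (ι w) (ι 8 + ι 3 * J) ⟩
        (ι w + (ι 8 + ι 3 * J)) - (ι 8 + ι 3 * J)
          ≡⟨ cong (_- (ι 8 + ι 3 * J)) (trans (sym (trans (ι-+ w (8 ℕ.+ 3 ℕ.* j)) (cong (ι w +_) (trans (ι-+ 8 (3 ℕ.* j)) (cong (ι 8 +_) (ι-* 3 j))))))
               (trans (cong ι (sym ds≡)) (ι-* (2 ℕ.+ i) s))) ⟩
        δ * ι s - (ι 8 + ι 3 * J)
          ≡⟨ solve 4 (λ d m e s → d :* s :- e := d :* (e :* m :+ s) :- e :* (d :* m :+ # 1)) refl δ M (ι 8 + ι 3 * J) (ι s) ⟩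
        δ * ((ι 8 + ι 3 * J) * M + ι s) - (ι 8 + ι 3 * J) * (δ * M + 1#)
          ≡⟨ cong₂ (λ y z → δ * y - (ι 8 + ι 3 * J) * (z + 1#)) bracket δM≡-1 ⟩
        δ * 0# - (ι 8 + ι 3 * J) * (- 1# + 1#)
          ≡⟨ solve 2 (λ d e → d :* # 0 :- e :* (:- # 1 :+ # 1) := # 0) refl δ (ι 8 + ι 3 * J) ⟩
        0# ∎

      -- w + (3k + 2) = d s ≤ d N = p - 1, so w is below p and must be the natural number zero. Its
      -- summands then vanish one by one.
      conclude : ∀ v → v ≡ w → i ≡ 0 × j ≡ 0
      conclude (suc v) eq = ⊥-elim (char v (ℕₚ.≤-trans (ℕₚ.≤-reflexive eq) (ℕₚ.≤-trans (ℕₚ.m≤m+n w (8 ℕ.+ 3 ℕ.* j))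
        (subst₂ _≤_ ds≡ (sym P₀≡) (ℕₚ.*-monoʳ-≤ (2 ℕ.+ i) small)))) (trans (cong ι eq) ι-w))
      conclude zero eq =
          ℕₚ.m*n≡0⇒m≡0 i s (ℕₚ.m+n≡0⇒n≡0 (11 ℕ.* j ℕ.+ 4 ℕ.* (j ℕ.* j)) (sym eq))
        , ℕₚ.m+n≡0⇒m≡0 j (ℕₚ.m+n≡0⇒m≡0 (11 ℕ.* j) (ℕₚ.m+n≡0⇒m≡0 (11 ℕ.* j ℕ.+ 4 ℕ.* (j ℕ.* j)) (sym eq)))

    module Subgroup (gs : List Carrier) (gs-unique : Unique gs) (gs≢0 : All (_≢ 0#) gs)
                    (closed : ∀ {g h} → g ∈ gs → h ∈ gs → g * h ∈ gs)
                    (N′ : ℕ) (∣gs∣ : length gs ≡ 3 ℕ.+ N′) (proper : ∃ λ x → x ≢ 0# × x ∉ gs) where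

      N : ℕ
      N = 3 ℕ.+ N′

      order : ∀ {x} → x ∈ gs → x ^ N ≡ 1#
      order {x} x∈ = trans (cong (x ^_) (sym ∣gs∣)) (^-order gs-unique gs≢0 closed x∈)

      private
        insert-unique : ∀ {x} → x ∉ gs → Unique (x ∷ gs)
        insert-unique x∉ = ¬Any⇒All¬ gs x∉ ∷ gs-unique

      N<P₀ : N < P₀
      N<P₀ = let x , x≢0 , x∉ = proper in
        subst₂ _≤_ (cong suc ∣gs∣) ∣units∣ (length-⊆ (insert-unique x∉)
          (λ { (here refl) → units-complete x≢0 ; (there y∈) → units-complete (All.lookup gs≢0 y∈) }))

      -- A solution outside the subgroup would give N + 1 solutions of x^N = 1.
      root-∈ : ∀ {x} → x ^ N ≡ 1# → x ∈ gs
      root-∈ {x} eq = go (x ∈? gs)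
        where
        go : Dec (x ∈ gs) → x ∈ gs
        go (yes x∈) = x∈
        go (no x∉)  = ⊥-elim (ℕₚ.1+n≰n (subst (_≤ N) (cong suc ∣gs∣)
          (roots-of-unity-≤ (2 ℕ.+ N′) (char (2 ℕ.+ N′) (ℕₚ.<⇒≤ N<P₀)) (insert-unique x∉) (eq ∷ All.tabulate order))))

      -- A remainder r > 0 of p - 1 modulo N would give g^r = 1 on the whole subgroup, that is N
      -- roots of unity of order dividing r < N. Properness excludes the quotients 0 and 1.
      index : ∃ λ i → P₀ ≡ (2 ℕ.+ i) ℕ.* N
      index = go (P₀ / N) (P₀ % N) refl (m≡m%n+[m/n]*n P₀ N)
        where
        go : ∀ d r → r ≡ P₀ % N → P₀ ≡ r ℕ.+ d ℕ.* N → ∃ λ i → P₀ ≡ (2 ℕ.+ i) ℕ.* N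
        go zero          zero    _ eq = ⊥-elim (ℕₚ.<⇒≢ (ℕₚ.≤-<-trans z≤n N<P₀) (sym eq))
        go (suc zero)    zero    _ eq = ⊥-elim (ℕₚ.<⇒≢ N<P₀ (sym (trans eq (ℕₚ.+-identityʳ N))))
        go (suc (suc i)) zero    _ eq = i , eq
        go d             (suc r) r≡ eq = ⊥-elim (ℕₚ.<⇒≱ (subst (_< N) (sym r≡) (m%n<n P₀ N)) (subst (_≤ suc r) ∣gs∣
          (roots-of-unity-≤ r (char r (subst (_≤ P₀) (sym r≡) (m%n≤m P₀ N))) gs-unique (All.tabulate (λ {g} g∈ → begin
            g ^ suc r                      ≡⟨ trans (*-comm _ 1#) (*-identityˡ _) ⟨
            g ^ suc r * 1#                 ≡⟨ cong (g ^ suc r *_) (trans (cong (_^ d) (order g∈)) (1^ d)) ⟨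
            g ^ suc r * (g ^ N) ^ d        ≡⟨ cong (g ^ suc r *_) (^-* g d N) ⟨
            g ^ suc r * g ^ (d ℕ.* N)      ≡⟨ ^-+ g (suc r) (d ℕ.* N) ⟨
            g ^ (suc r ℕ.+ d ℕ.* N)        ≡⟨ cong (g ^_) eq ⟨
            g ^ P₀                         ≡⟨ fermat (All.lookup gs≢0 g∈) ⟩
            1# ∎)))))
          where open ≡-Reasoning

      -- Products of two sets in a shifted subgroup

      module Shifted (l : Carrier) (l≢0 : l ≢ 0#) where

        Products-in : List Carrier → List Carrier → Set
        Products-in xs ys = ∀ {x y} → x ∈ xs → y ∈ ys → ∃ λ g → g ∈ gs × x * y ≡ g - l

        Products-cover : List Carrier → List Carrier → Set
        Products-cover xs ys = ∀ {g} → g ∈ gs → g - l ≢ 0# → ∃ λ x → ∃ λ y → x ∈ xs × y ∈ ys × x * y ≡ g - l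

        l⁻¹ η : Carrier
        l⁻¹ = l ⁻¹
        η = l⁻¹ ^ N

        ν : Carrier → Carrier
        ν x = x * l⁻¹

        l⁻¹≢0 : l⁻¹ ≢ 0#
        l⁻¹≢0 e = 1≢0 (trans (sym (*-inverseʳ l l≢0)) (trans (cong (l *_) e) (zeroʳ l)))

        η≢0 : η ≢ 0#
        η≢0 = ^-≢0 N l⁻¹≢0

        ν≢0 : ∀ {xs} → All (_≢ 0#) xs → All (_≢ 0#) (map ν xs)
        ν≢0 xs≢0 = All-map⁺ (All.map (λ x≢0 → *-≢0 x≢0 l⁻¹≢0) xs≢0)

        ν-injective : ∀ {x y} → ν x ≡ ν y → x ≡ y
        ν-injective {x} {y} eq = *-cancelˡ l⁻¹≢0 (trans (*-comm l⁻¹ x) (trans eq (*-comm y l⁻¹)))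

        ν-unique : ∀ {xs} → Unique xs → Unique (map ν xs)
        ν-unique = map-unique (λ _ _ → ν-injective)

        g*l⁻¹ : ∀ {g} → g ∈ gs → (g * l⁻¹) ^ N ≡ η
        g*l⁻¹ {g} g∈ = trans (*-^ g l⁻¹ N) (trans (cong (_* η) (order g∈)) (*-identityˡ η))

        good : ∀ {x y g} → g ∈ gs → x * y ≡ g - l → lin y (ν x) ^ N ≡ η
        good {x} {y} {g} g∈ eq = trans (cong (_^ N) (begin
          1# + x * l⁻¹ * y            ≡⟨ cong (_+ x * l⁻¹ * y) (*-inverseʳ l l≢0) ⟨
          l * l⁻¹ + x * l⁻¹ * y       ≡⟨ solve 4 (λ l i x y → l :* i :+ x :* i :* y := (l :+ x :* y) :* i) refl l l⁻¹ x y ⟩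
          (l + x * y) * l⁻¹           ≡⟨ cong (λ z → (l + z) * l⁻¹) eq ⟩
          (l + (g - l)) * l⁻¹         ≡⟨ cong (_* l⁻¹) (solve 2 (λ l g → l :+ (g :- l) := g) refl l g) ⟩
          g * l⁻¹                     ∎)) (g*l⁻¹ g∈)
          where open ≡-Reasoning

        goods : ∀ {xs ys} → Products-in xs ys → All (λ y → All (Periodic.Good N η y) (map ν xs)) ys
        goods sub = All.tabulate (λ y∈ → All-map⁺ (All.tabulate (λ x∈ → let g , g∈ , eq = sub x∈ y∈ in good g∈ eq)))

        -- The degree stays below the characteristic because the index is at least 2: N + k ≤ 2N ≤ p
        -- - 1.
        char-≤ : ∀ {k} → suc k ≤ N → ∀ j → j < N′ ℕ.+ (3 ℕ.+ k) → ι (suc j) ≢ 0#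
        char-≤ {k} k<N j j< = char j (ℕₚ.<-≤-trans j< (ℕₚ.≤-trans bound (subst (N ℕ.+ N ≤_) (sym (proj₂ index))
            (subst (_≤ (2 ℕ.+ proj₁ index) ℕ.* N) (cong (N ℕ.+_) (ℕₚ.+-identityʳ N)) (ℕₚ.*-monoˡ-≤ N (s≤s (s≤s (z≤n {proj₁ index}))))))))
          where
          bound : N′ ℕ.+ (3 ℕ.+ k) ≤ N ℕ.+ N
          bound = subst (_≤ N ℕ.+ N) (trans (ℕₚ.+-comm N k) (trans (sym (ℕₚ.+-assoc k 3 N′))
            (trans (ℕₚ.+-comm (k ℕ.+ 3) N′) (cong (N′ ℕ.+_) (ℕₚ.+-comm k 3))))) (ℕₚ.+-monoʳ-≤ N (ℕₚ.<⇒≤ k<N))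

        ∣xs∣≤N : ∀ {xs ys} → Unique xs → All (_≢ 0#) ys → Products-in xs ys → 0 < length ys → length xs ≤ N
        ∣xs∣≤N {xs} {y ∷ ys} unique (y≢0 ∷ _) sub _ = subst₂ _≤_ (length-map (y *_) xs) (trans (length-map (_- l) gs) ∣gs∣)
          (length-⊆ (map-unique (λ _ _ → *-cancelˡ y≢0) unique) (λ z∈ →
            let x , x∈ , eq = ∈-map⁻ (y *_) z∈
                g , g∈ , e  = sub x∈ (here refl) in
            subst (_∈ map (_- l) gs) (sym (trans eq (trans (*-comm y x) e))) (∈-map⁺ (_- l) g∈)))

        product-bound : ∀ {xs ys} → Unique xs → All (_≢ 0#) xs → Unique ys → All (_≢ 0#) ys → 0 < length xs → 0 < length ys →
          Products-in xs ys → length ys ℕ.* length xs ≤ N′ ℕ.+ (2 ℕ.+ length xs)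
        product-bound {x ∷ xs} {ys} u xs≢0 u′ ys≢0 _ 0<ys sub =
          subst (λ k → length ys ℕ.* suc k ≤ N′ ℕ.+ (3 ℕ.+ k)) (length-map ν xs)
            (Factorization.degree-bound N′ η η≢0 (ν x) (map ν xs) (ν-unique u) (ν≢0 xs≢0) ys u′ (goods sub)
              (subst (λ k → ∀ j → j < N′ ℕ.+ (3 ℕ.+ k) → ι (suc j) ≢ 0#) (sym (length-map ν xs)) (char-≤ (∣xs∣≤N u ys≢0 sub 0<ys))))

        coverage : ∀ {xs ys} → Products-cover xs ys → ∀ {x} → x ∈ map (_- l) gs → x ≡ 0# ⊎ x ∈ cartesianProductWith _*_ xs ys
        coverage {xs} {ys} cov {x} x∈ = go (∈-map⁻ (_- l) x∈)
          where
          go : (∃ λ g → g ∈ gs × x ≡ g - l) → x ≡ 0# ⊎ x ∈ cartesianProductWith _*_ xs ys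
          go (g , g∈ , eq) with x ≟ 0#
          ... | yes x≡0 = inj₁ x≡0
          ... | no x≢0  = let x′ , y′ , x∈ , y∈ , e = cov g∈ (λ e → x≢0 (trans eq e)) in
            inj₂ (subst (_∈ cartesianProductWith _*_ xs ys) (trans e (sym eq)) (∈-cartesianProductWith⁺ _*_ x∈ y∈))

        shift-unique : Unique (map (_- l) gs)
        shift-unique = map-unique (λ {x} {y} _ _ eq → x-y≡0⇒x≡y (trans
          (solve 3 (λ x y l → x :- y := (x :- l) :- (y :- l)) refl x y l) (x≡y⇒x-y≡0 eq))) gs-unique

        ∣shift∣ : length (map (_- l) gs) ≡ N
        ∣shift∣ = trans (length-map (_- l) gs) ∣gs∣

        -- When l ∈ G, the point 0 may be added to Y.
        data Points (ys : List Carrier) : List Carrier → Set where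
          inside  : l ∈ gs → η ≡ 1# → Points ys (0# ∷ ys)
          outside : l ∉ gs → η ≢ 1# → Points ys ys

        -- λ^N η = 1, so η = 1 exactly when λ^N = 1, and by `root-∈` exactly when λ lies in G.
        points : ∀ ys → ∃ (Points ys)
        points ys = go (l ∈? gs)
          where
          l^N*η : l ^ N * η ≡ 1#
          l^N*η = trans (sym (*-^ l l⁻¹ N)) (trans (cong (_^ N) (*-inverseʳ l l≢0)) (1^ N))
          go : Dec (l ∈ gs) → ∃ (Points ys)
          go (yes l∈) = 0# ∷ ys , inside l∈ (trans (sym (*-identityˡ η)) (trans (cong (_* η) (sym (order l∈))) l^N*η))
          go (no l∉)  = ys , outside l∉ (λ η≡1 → l∉ (root-∈ (trans (trans (sym (*-identityˡ _)) (*-comm 1# _)) (trans (cong (l ^ N *_) (sym η≡1)) l^N*η))))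

        points-good : ∀ {xs ys zs} → Products-in xs ys → Points ys zs → All (λ y → All (Periodic.Good N η y) (map ν xs)) zs
        points-good sub (inside _ η≡1) = All.tabulate (λ {a} _ → trans (cong (_^ N)
          (solve 1 (λ a → # 1 :+ a :* # 0 := # 1) refl a)) (trans (1^ N) (sym η≡1))) ∷ goods sub
        points-good sub (outside _ _)  = goods sub

        points-unique : ∀ {ys zs} → Unique ys → All (_≢ 0#) ys → Points ys zs → Unique zs
        points-unique u ys≢0 (inside _ _)  = All.map (λ y≢0 e → y≢0 (sym e)) ys≢0 ∷ u
        points-unique u ys≢0 (outside _ _) = u

        g-l≢0 : l ∉ gs → ∀ {x} → x ∈ map (_- l) gs → x ≢ 0#
        g-l≢0 l∉ x∈ x≡0 = let g , g∈ , eq = ∈-map⁻ (_- l) x∈ in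
          l∉ (subst (_∈ gs) (x-y≡0⇒x≡y (trans (sym eq) x≡0)) g∈)

        cover-count : ∀ {xs ys} → Products-cover xs ys → N ≤ suc (length xs ℕ.* length ys)
        cover-count {xs} {ys} cov = subst₂ _≤_ ∣shift∣ (cong suc (length-cartesianProductWith _*_ xs ys))
          (length-⊆ {ys = 0# ∷ cartesianProductWith _*_ xs ys} shift-unique (λ x∈ → case (coverage cov x∈)))
          where
          case : ∀ {x} → x ≡ 0# ⊎ x ∈ cartesianProductWith _*_ xs ys → x ∈ 0# ∷ cartesianProductWith _*_ xs ys
          case (inj₁ refl) = here refl
          case (inj₂ x∈)   = there x∈

        cover-count-outside : ∀ {xs ys} → l ∉ gs → Products-cover xs ys → N ≤ length xs ℕ.* length ys
        cover-count-outside {xs} {ys} l∉ cov = subst₂ _≤_ ∣shift∣ (length-cartesianProductWith _*_ xs ys)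
          (length-⊆ shift-unique (λ x∈ → case (g-l≢0 l∉ x∈) (coverage cov x∈)))
          where
          case : ∀ {x} → x ≢ 0# → x ≡ 0# ⊎ x ∈ cartesianProductWith _*_ xs ys → x ∈ cartesianProductWith _*_ xs ys
          case x≢0 (inj₁ x≡0) = ⊥-elim (x≢0 x≡0)
          case x≢0 (inj₂ x∈)  = x∈

        -- For λ in G the products cover one element less than N, and the added point makes up for
        -- it: (|Y| + 1) |X| ≥ |X| |Y| + 1.
        points-enough : ∀ {xs ys zs} → 0 < length xs → Products-cover xs ys → Points ys zs → N ≤ length zs ℕ.* length xs
        points-enough {xs} {ys} 0<xs cov (inside _ _) = ℕₚ.≤-trans (cover-count cov)
          (ℕₚ.≤-trans (ℕₚ.≤-reflexive (cong suc (ℕₚ.*-comm (length xs) (length ys)))) (ℕₚ.+-monoˡ-≤ (length ys ℕ.* length xs) 0<xs))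
        points-enough {xs} {ys} 0<xs cov (outside l∉ _) =
          subst (N ≤_) (ℕₚ.*-comm (length xs) (length ys)) (cover-count-outside l∉ cov)

        hs : List Carrier
        hs = map (λ g → (g - l) * l⁻¹) gs

        hs-unique : Unique hs
        hs-unique = map-unique (λ {x} {y} _ _ eq → x-y≡0⇒x≡y (*-≡0 l⁻¹≢0 (trans
          (solve 4 (λ x y l i → i :* (x :- y) := (x :- l) :* i :- (y :- l) :* i) refl x y l l⁻¹) (x≡y⇒x-y≡0 eq)))) gs-unique

        hs-coset : All (λ x → lin x 1# ^ N ≡ η) hs
        hs-coset = All-map⁺ (All.tabulate (λ {g} g∈ → trans (cong (_^ N) (begin
          1# + 1# * ((g - l) * l⁻¹)       ≡⟨ cong (λ z → z + 1# * ((g - l) * l⁻¹)) (*-inverseʳ l l≢0) ⟨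
          l * l⁻¹ + 1# * ((g - l) * l⁻¹)  ≡⟨ solve 3 (λ l i g → l :* i :+ # 1 :* ((g :- l) :* i) := g :* i) refl l l⁻¹ g ⟩
          g * l⁻¹ ∎)) (g*l⁻¹ g∈)))
          where open ≡-Reasoning

        two-nodes : ∀ {x₁ x₂ ys zs} → x₁ ≢ x₂ → x₁ ≢ 0# → x₂ ≢ 0# → Unique ys → All (_≢ 0#) ys → Points ys zs →
          Products-in (x₁ ∷ x₂ ∷ []) ys → Products-cover (x₁ ∷ x₂ ∷ []) ys → P₀ ≡ 2 ℕ.* N → 853 ≤ P₀ → ⊥
        two-nodes {x₁} {x₂} {ys} x₁≢x₂ x₁≢0 x₂≢0 u ys≢0 pt sub cov P₀≡2N large = go pt
          where
          open ≡-Reasoning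
          xs nodes : List Carrier
          xs = x₁ ∷ x₂ ∷ []
          nodes = ν x₁ ∷ ν x₂ ∷ []
          a≢b : ν x₁ ≢ ν x₂
          a≢b e = x₁≢x₂ (ν-injective e)
          a≢0 : ν x₁ ≢ 0#
          a≢0 = *-≢0 x₁≢0 l⁻¹≢0
          b≢0 : ν x₂ ≢ 0#
          b≢0 = *-≢0 x₂≢0 l⁻¹≢0
          half : ι 2 * ι N ≡ - 1#
          half = x-y≡0⇒x≡y (begin
            ι 2 * ι N - - 1#        ≡⟨ solve 1 (λ m → m :- :- # 1 := # 1 :+ m) refl (ι 2 * ι N) ⟩
            1# + ι 2 * ι N          ≡⟨ cong (1# +_) (trans (cong ι P₀≡2N) (ι-* 2 N)) ⟨
            1# + ι P₀               ≡⟨ ι-suc P₀ ⟨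
            ι (suc P₀)              ≡⟨ char-p ⟩
            0# ∎)
          square : ∀ x → x ≢ 0# → x ^ N * x ^ N ≡ 1#
          square x x≢0 = begin
            x ^ N * x ^ N           ≡⟨ ^-+ x N N ⟨
            x ^ (N ℕ.+ N)           ≡⟨ cong (x ^_) (trans P₀≡2N (cong (N ℕ.+_) (ℕₚ.+-identityʳ N))) ⟨
            x ^ P₀                  ≡⟨ fermat x≢0 ⟩
            1# ∎
          small : ∀ j k → suc j ℕ.+ k ≡ 853 → ι (suc j) ≢ 0#
          small j k eq = char j (ℕₚ.≤-trans (ℕₚ.m≤m+n (suc j) k) (subst (_≤ P₀) (sym eq) large))
          853≢0 : ι 29 * ι 29 + ι 12 ≢ 0#
          853≢0 e = small 852 0 refl (trans (trans (ι-+ (29 ℕ.* 29) 12) (cong (_+ ι 12) (ι-* 29 29))) e)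
          module T = TwoNodes N′ (ν x₁) (ν x₂) a≢b a≢0 b≢0 half square (char-≤ {1} (s≤s (s≤s z≤n)))
            (small 1 851 refl) (small 2 850 refl) (small 4 848 refl) (small 6 846 refl) (small 10 842 refl) 853≢0
          open CoverProduct {ν x₁} {ν x₂} a≢0 b≢0 using (Covered)

          cover-at : ∀ {g} → g ∈ gs → g - l ≢ 0# → Covered ys ((g - l) * l⁻¹)
          cover-at {g} g∈ g-l≢0 = let x , y , x∈ , y∈ , eq = cov g∈ g-l≢0 in y , y∈ , which x∈ (trans (cong (_* l⁻¹) (sym eq))
              (solve 3 (λ x y i → x :* y :* i := x :* i :* y) refl x y l⁻¹))
            where
            which : ∀ {x y z} → x ∈ xs → z ≡ ν x * y → z ≡ ν x₁ * y ⊎ z ≡ ν x₂ * y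
            which (here refl)         eq = inj₁ eq
            which (there (here refl)) eq = inj₂ eq

          2n : 2 ℕ.* length ys ≡ length ys ℕ.+ length ys
          2n = cong (length ys ℕ.+_) (ℕₚ.+-identityʳ (length ys))

          go : ∀ {zs} → Points ys zs → ⊥
          go pt@(inside _ η≡1) = T.InSubgroup.impossible ys (points-unique u ys≢0 pt)
            (subst (λ e → All (λ y → All (Periodic.Good N e y) nodes) (0# ∷ ys)) η≡1 (points-good sub pt))
            hs hs-unique (trans (length-map _ gs) ∣gs∣) (subst (λ e → All (λ x → lin x 1# ^ N ≡ e) hs) η≡1 hs-coset)
            (All-map⁺ (All.tabulate (λ {g} g∈ → case g∈ ((g - l) ≟ 0#))))
            (subst (λ k → N ≤ suc k) 2n (cover-count cov))
            where
            case : ∀ {g} → g ∈ gs → Dec (g - l ≡ 0#) → (g - l) * l⁻¹ ≡ 0# ⊎ Covered ys ((g - l) * l⁻¹)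
            case g∈ (yes e) = inj₁ (trans (cong (_* l⁻¹) e) (zeroˡ l⁻¹))
            case g∈ (no ne) = inj₂ (cover-at g∈ ne)
          go pt@(outside l∉ η≢1) = T.OutsideSubgroup.impossible ys u
            (subst (λ e → All (λ y → All (Periodic.Good N e y) nodes) ys) η≡-1 (points-good sub pt))
            hs hs-unique (trans (length-map _ gs) ∣gs∣) (subst (λ e → All (λ x → lin x 1# ^ N ≡ e) hs) η≡-1 hs-coset)
            (All-map⁺ (All.tabulate (λ {g} g∈ → cover-at g∈ (g-l≢0 l∉ (∈-map⁺ (_- l) g∈)))))
            (subst (N ≤_) 2n (cover-count-outside l∉ cov))
            where
            η≡-1 : η ≡ - 1#
            η≡-1 = case (x²≡1 (square l⁻¹ l⁻¹≢0))
              where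
              case : η ≡ 1# ⊎ η ≡ - 1# → η ≡ - 1#
              case (inj₁ e) = ⊥-elim (η≢1 e)
              case (inj₂ e) = e

        -- From n k ≥ N ≥ 16k² there are n ≥ 16k points, more than the coefficients of the
        -- eliminant. So `coeffA` vanishes, and the numerical argument leaves only two nodes and
        -- index 2.
        no-decomposition : ∀ {xs ys} → Unique xs → All (_≢ 0#) xs → Unique ys → All (_≢ 0#) ys →
          2 ≤ length xs → 0 < length ys → Products-in xs ys → Products-cover xs ys →
          16 ℕ.* (length xs ℕ.* length xs) ≤ N → 853 ≤ N → ⊥
        no-decomposition {_ ∷ []} _ _ _ _ (s≤s ())
        no-decomposition {x₁ ∷ x₂ ∷ rest} {ys} uxs@((x₁≢x₂ ∷ _) ∷ _) xs≢0@(x₁≢0 ∷ x₂≢0 ∷ _) u ys≢0 _ 0<ys sub cov small large =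
          conclude rest refl (proj₂ numbers)
          where
          xs zs : List Carrier
          xs = x₁ ∷ x₂ ∷ rest
          zs = proj₁ (points ys)
          pt : Points ys zs
          pt = proj₂ (points ys)
          j k n : ℕ
          j = length rest
          k = 2 ℕ.+ j
          n = length zs

          enough : N ≤ n ℕ.* k
          enough = points-enough {xs} (s≤s z≤n) cov pt

          16k≤n : 16 ℕ.* k ≤ n
          16k≤n = ℕₚ.*-cancelʳ-≤ (16 ℕ.* k) n k (ℕₚ.≤-trans (ℕₚ.≤-reflexive (ℕₚ.*-assoc 16 k k)) (ℕₚ.≤-trans small enough))

          A : ∀ νs → νs ≡ map ν (x₂ ∷ rest) → coeffA (ι (suc (length νs))) (ι (2 ℕ.+ N′)) (ι (1 ℕ.+ N′)) ≡ 0#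
          A νs refl = Factorization.Eliminated.coeffA≡0 N′ η η≢0 (ν x₁) νs (ν-unique uxs) (ν≢0 xs≢0) zs (points-unique u ys≢0 pt)
            (points-good sub pt)
            (subst (λ k → ∀ j → j < N′ ℕ.+ (3 ℕ.+ k) → ι (suc j) ≢ 0#) (sym (length-map ν (x₂ ∷ rest))) (char-≤ (∣xs∣≤N uxs ys≢0 sub 0<ys)))
            (subst (λ k → suc (N′ ℕ.+ (3 ℕ.+ k)) ℕ.∸ n ℕ.* suc k ≤ suc k) (sym (length-map ν (x₂ ∷ rest))) few)
            (subst (λ k → suc (suc k) ℕ.+ suc k ℕ.+ (suc (suc k) ℕ.+ suc k) ≤ n) (sym (length-map ν (x₂ ∷ rest))) many)
            where
            -- Here m + 1 = N + k and n k ≥ N, so at most k coefficients remain for q.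
            few : suc (N′ ℕ.+ (2 ℕ.+ k)) ℕ.∸ n ℕ.* k ≤ k
            few = ℕₚ.m≤n+o⇒m∸n≤o (suc (N′ ℕ.+ (2 ℕ.+ k))) (n ℕ.* k)
              (ℕₚ.≤-trans (ℕₚ.≤-reflexive (cong suc (trans (ℕₚ.+-suc N′ (suc k)) (cong suc (ℕₚ.+-suc N′ k))))) (ℕₚ.+-monoˡ-≤ k enough))
            many : suc k ℕ.+ k ℕ.+ (suc k ℕ.+ k) ≤ n
            many = ℕₚ.≤-trans (length-bound j) 16k≤n

          numbers : proj₁ index ≡ 0 × j ≡ 0
          numbers = numeric (proj₁ index) j N′ (proj₂ index) (ℕₚ.≤-trans (numeric-bound j) small)
            (subst (λ k → coeffA (ι (suc k)) (ι (2 ℕ.+ N′)) (ι (1 ℕ.+ N′)) ≡ 0#) (length-map ν (x₂ ∷ rest)) (A (map ν (x₂ ∷ rest)) refl))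

          conclude : ∀ r → r ≡ rest → length rest ≡ 0 → ⊥
          conclude [] refl _ = two-nodes x₁≢x₂ x₁≢0 x₂≢0 u ys≢0 pt sub cov
            (trans (proj₂ index) (cong (λ i → (2 ℕ.+ i) ℕ.* N) (proj₁ numbers))) (ℕₚ.≤-trans large (ℕₚ.<⇒≤ N<P₀))
          conclude (_ ∷ _) refl ()

        -- Products of three sets

        module Ternary (p : ℕ) (code : Carrier → ℕ) (code<p : ∀ x → code x < p)
                       (code-injective : ∀ {x y} → code x ≡ code y → x ≡ y) where

          open ProductSets _≟_ _*_ *-assoc *-comm p code code<p code-injective using (triple-product-bound)

          products : List Carrier → List Carrier → List Carrier
          products xs ys = deduplicate _≟_ (cartesianProductWith _*_ xs ys)

          products-unique : ∀ xs ys → Unique (products xs ys)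
          products-unique xs ys = deduplicate-! (cartesianProductWith _*_ xs ys)

          ∈-products⁺ : ∀ {xs ys x y} → x ∈ xs → y ∈ ys → x * y ∈ products xs ys
          ∈-products⁺ x∈ y∈ = ∈-deduplicate⁺ _≟_ (∈-cartesianProductWith⁺ _*_ x∈ y∈)

          ∈-products⁻ : ∀ xs ys {z} → z ∈ products xs ys → ∃ λ x → ∃ λ y → x ∈ xs × y ∈ ys × z ≡ x * y
          ∈-products⁻ xs ys z∈ = ∈-cartesianProductWith⁻ _*_ xs ys (∈-deduplicate⁻ _≟_ (cartesianProductWith _*_ xs ys) z∈)

          Triples-in : List Carrier → List Carrier → List Carrier → Set
          Triples-in xs ys zs = ∀ {x y z} → x ∈ xs → y ∈ ys → z ∈ zs → ∃ λ g → g ∈ gs × (x * y) * z ≡ g - l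

          Triples-cover : List Carrier → List Carrier → List Carrier → Set
          Triples-cover xs ys zs = ∀ {g} → g ∈ gs → g - l ≢ 0# →
            ∃ λ x → ∃ λ y → ∃ λ z → x ∈ xs × y ∈ ys × z ∈ zs × (x * y) * z ≡ g - l

          Factor : List Carrier → Set
          Factor xs = Unique xs × All (_≢ 0#) xs × 2 ≤ length xs

          -- The triple product is read as X times the product set of the other two. Since X cannot
          -- be small, |X| exceeds √N/4, and the degree bound then limits the other product set.
          two-large : ∀ {xs ys zs} → 853 ≤ N → Factor xs → Factor ys → Factor zs →
            Triples-in xs ys zs → Triples-cover xs ys zs →
            N < 16 ℕ.* (length xs ℕ.* length xs) × length (products ys zs) ℕ.* length xs ≤ N′ ℕ.+ (2 ℕ.+ length xs)
          two-large {xs} {ys@(y₀ ∷ _)} {zs@(z₀ ∷ _)} 853≤N (uxs , xs≢0 , 2≤xs) (_ , ys≢0 , _) (_ , zs≢0 , _) sub cov =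
              ℕₚ.≰⇒> (λ small → no-decomposition uxs xs≢0 (products-unique ys zs) yzs≢0 2≤xs 0<yzs sub′ cov′ small 853≤N)
            , product-bound uxs xs≢0 (products-unique ys zs) yzs≢0 (ℕₚ.<⇒≤ 2≤xs) 0<yzs sub′
            where
            yzs≢0 : All (_≢ 0#) (products ys zs)
            yzs≢0 = All.tabulate (λ w∈ w≡0 → let y , z , y∈ , z∈ , eq = ∈-products⁻ ys zs w∈ in
              *-≢0 (All.lookup ys≢0 y∈) (All.lookup zs≢0 z∈) (trans (sym eq) w≡0))
            0<yzs : 0 < length (products ys zs)
            0<yzs = nonempty (∈-products⁺ {ys} {zs} (here refl) (here refl))
              where
              nonempty : ∀ {w ws} → w ∈ ws → 0 < length ws
              nonempty (here _)  = s≤s z≤n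
              nonempty (there _) = s≤s z≤n
            sub′ : Products-in xs (products ys zs)
            sub′ {x} x∈ w∈ = let y , z , y∈ , z∈ , eq = ∈-products⁻ ys zs w∈
                                 g , g∈ , e = sub x∈ y∈ z∈
                             in g , g∈ , trans (cong (x *_) eq) (trans (sym (*-assoc x y z)) e)
            cov′ : Products-cover xs (products ys zs)
            cov′ g∈ ne = let x , y , z , x∈ , y∈ , z∈ , e = cov g∈ ne in
              x , y * z , x∈ , ∈-products⁺ y∈ z∈ , trans (sym (*-assoc x y z)) e
          two-large {ys = []} _ _ (_ , _ , ()) _ _ _
          two-large {ys = _ ∷ _} {zs = []} _ _ _ (_ , _ , ()) _ _

          swap₁₂ : ∀ x y z → (y * x) * z ≡ (x * y) * z
          swap₁₂ x y z = cong (_* z) (*-comm y x)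

          rotate : ∀ x y z → (z * x) * y ≡ (x * y) * z
          rotate x y z = trans (*-assoc z x y) (*-comm z (x * y))

          -- Each pairwise product set has at most K = 4R elements, with R just above √N. In
          -- `triple-product-bound` the terms of order N are K², about 16N, against 2θN, so every θ
          -- > 8 wins for large N. With θ = 16 the term θ² K = 1024R is of lower order, and N >
          -- 1024² absorbs it.
          no-ternary-decomposition : ∀ {as bs cs} → 1024 ℕ.* 1024 < N → Factor as → Factor bs → Factor cs →
            Triples-in as bs cs → Triples-cover as bs cs → ⊥
          no-ternary-decomposition {as} {bs} {cs} large fa fb fc sub cov =
            product-count 16 (4 ℕ.* suc r) N (length xs) N≤
              (triple-product-bound as bs cs 16 {products as bs} {products bs cs} {products as cs} {xs} ∈-products⁺ ∈-products⁺ ∈-products⁺ xs-unique factored)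
              ac≤ bc≤ ab≤ gap
            where
            open ℕₚ.≤-Reasoning

            853≤N : 853 ≤ N
            853≤N = ℕₚ.≤-trans (ℕₚ.m≤m+n 853 1047723) (ℕₚ.<⇒≤ large)

            root : ∃ λ r → r ℕ.* r ≤ N × N < suc r ℕ.* suc r
            root = isqrt N
            r : ℕ
            r = proj₁ root
            lo : r ℕ.* r ≤ N
            lo = proj₁ (proj₂ root)
            hi : N < suc r ℕ.* suc r
            hi = proj₂ (proj₂ root)

            R≥ : 1025 ≤ suc r
            R≥ = ℕₚ.≰⇒> λ R≤ → ℕₚ.<⇒≱ hi (ℕₚ.≤-trans (ℕₚ.*-mono-≤ R≤ R≤) (ℕₚ.<⇒≤ large))

            gap : 2 ℕ.* 16 ℕ.+ (4 ℕ.* suc r ℕ.* (4 ℕ.* suc r) ℕ.+ 16 ℕ.* 16 ℕ.* (4 ℕ.* suc r)) < 2 ℕ.* 16 ℕ.* N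
            gap = numeric-gap (16 ℕ.* 16) r N (ℕₚ.≤-trans R≥ (ℕₚ.m≤m+n (suc r) _)) (ℕₚ.≤-trans (ℕₚ.m≤m+n 33 992) R≥)
                    (ℕₚ.≤-trans (ℕₚ.m≤m+n 3 1021) (ℕₚ.≤-pred R≥)) lo

            bound : ∀ {us vs ws} → Factor us → Factor vs → Factor ws → Triples-in us vs ws → Triples-cover us vs ws →
                    length (products vs ws) ≤ 4 ℕ.* suc r
            bound {us} {vs} {ws} fu fv fw s c = let large , small = two-large {us} {vs} {ws} 853≤N fu fv fw s c in
              small-product N′ r (length us) (length (products vs ws)) lo hi large small

            bc≤ : length (products bs cs) ≤ 4 ℕ.* suc r
            bc≤ = bound {as} {bs} {cs} fa fb fc sub cov
            ac≤ : length (products as cs) ≤ 4 ℕ.* suc r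
            ac≤ = bound {bs} {as} {cs} fb fa fc
              (λ {b} {a} {c} b∈ a∈ c∈ → let g , g∈ , e = sub a∈ b∈ c∈ in g , g∈ , trans (swap₁₂ a b c) e)
              (λ g∈ ne → let a , b , c , a∈ , b∈ , c∈ , e = cov g∈ ne in b , a , c , b∈ , a∈ , c∈ , trans (swap₁₂ a b c) e)
            ab≤ : length (products as bs) ≤ 4 ℕ.* suc r
            ab≤ = bound {cs} {as} {bs} fc fa fb
              (λ {c} {a} {b} c∈ a∈ b∈ → let g , g∈ , e = sub a∈ b∈ c∈ in g , g∈ , trans (rotate a b c) e)
              (λ g∈ ne → let a , b , c , a∈ , b∈ , c∈ , e = cov g∈ ne in c , a , b , c∈ , a∈ , b∈ , trans (rotate a b c) e)

            ≡0? : ∀ x → Dec (x ≡ 0#)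
            ≡0? x = x ≟ 0#
            xs : List Carrier
            xs = filter (λ x → ¬? (≡0? x)) (map (_- l) gs)

            xs-unique : Unique xs
            xs-unique = Uniqueₚ.filter⁺ (λ x → ¬? (≡0? x)) shift-unique

            N≤ : N ≤ suc (length xs)
            N≤ = begin
              N                                                  ≡⟨ ∣shift∣ ⟨
              length (map (_- l) gs)                             ≡⟨ length-filter-¬ ≡0? (map (_- l) gs) ⟩
              length (filter ≡0? (map (_- l) gs)) ℕ.+ length xs  ≤⟨ ℕₚ.+-monoˡ-≤ (length xs) (length-⊆ {ys = 0# ∷ []} (Uniqueₚ.filter⁺ ≡0? shift-unique)
                                                                      (λ x∈ → here (proj₂ (∈-filter⁻ ≡0? {xs = map (_- l) gs} x∈)))) ⟩
              suc (length xs)                                    ∎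

            factored : ∀ {x} → x ∈ xs → ∃ λ a → ∃ λ b → ∃ λ c → a ∈ as × b ∈ bs × c ∈ cs × (a * b) * c ≡ x
            factored x∈ =
              let x∈′ , x≢0  = ∈-filter⁻ (λ x → ¬? (≡0? x)) {xs = map (_- l) gs} x∈
                  g , g∈ , eq = ∈-map⁻ (_- l) x∈′
                  a , b , c , a∈ , b∈ , c∈ , e = cov g∈ (λ ne → x≢0 (trans eq ne))
              in a , b , c , a∈ , b∈ , c∈ , trans e (sym eq)

-- The field 𝔽_p and its subsets as lists

open import Data.Fin using (Fin)
open import Data.Fin.Base using (zero; suc; toℕ; fromℕ<)
import Data.Fin.Properties as Finₚ
open import Data.Fin.Subset using (Subset; ∣_∣; inside; outside) renaming (_∈_ to _∈ˢ_)
open import Data.Vec.Base using ([]; _∷_; _[_]=_)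

module Residues (n : ℕ) where

  p : ℕ
  p = suc n

  reduce : ℕ → Fin p
  reduce m = fromℕ< (m%n<n m p)

  toℕ-reduce : ∀ m → toℕ (reduce m) ≡ m % p
  toℕ-reduce m = Finₚ.toℕ-fromℕ< (m%n<n m p)

  reduce-toℕ : ∀ x → reduce (toℕ x) ≡ x
  reduce-toℕ x = Finₚ.toℕ-injective (trans (toℕ-reduce (toℕ x)) (m<n⇒m%n≡m (Finₚ.toℕ<n x)))

  reduce-cong : ∀ k m → k % p ≡ m % p → reduce k ≡ reduce m
  reduce-cong k m eq = Finₚ.toℕ-injective (trans (toℕ-reduce k) (trans eq (sym (toℕ-reduce m))))

  infixl 6 _+_
  infixl 7 _*_
  _+_ _*_ : Fin p → Fin p → Fin p
  x + y = reduce (toℕ x ℕ.+ toℕ y)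
  _*_ = mulF

  -_ : Fin p → Fin p
  - x = reduce (p ∸ toℕ x)

  reduce-+ : ∀ k m → reduce (k ℕ.+ m) ≡ reduce k + reduce m
  reduce-+ k m = reduce-cong (k ℕ.+ m) (toℕ (reduce k) ℕ.+ toℕ (reduce m)) (trans (%-distribˡ-+ k m p)
    (cong₂ (λ u v → (u ℕ.+ v) % p) (sym (toℕ-reduce k)) (sym (toℕ-reduce m))))

  reduce-* : ∀ k m → reduce (k ℕ.* m) ≡ reduce k * reduce m
  reduce-* k m = reduce-cong (k ℕ.* m) (toℕ (reduce k) ℕ.* toℕ (reduce m)) (trans (%-distribˡ-* k m p)
    (cong₂ (λ u v → (u ℕ.* v) % p) (sym (toℕ-reduce k)) (sym (toℕ-reduce m))))

  +-comm : ∀ x y → x + y ≡ y + x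
  +-comm x y = cong reduce (ℕₚ.+-comm (toℕ x) (toℕ y))

  *-comm : ∀ x y → x * y ≡ y * x
  *-comm x y = cong reduce (ℕₚ.*-comm (toℕ x) (toℕ y))

  +-assoc : ∀ x y z → x + y + z ≡ x + (y + z)
  +-assoc x y z = begin
    x + y + z                                            ≡⟨ cong (x + y +_) (reduce-toℕ z) ⟨
    reduce (toℕ x ℕ.+ toℕ y) + reduce (toℕ z)            ≡⟨ reduce-+ (toℕ x ℕ.+ toℕ y) (toℕ z) ⟨
    reduce (toℕ x ℕ.+ toℕ y ℕ.+ toℕ z)                   ≡⟨ cong reduce (ℕₚ.+-assoc (toℕ x) (toℕ y) (toℕ z)) ⟩
    reduce (toℕ x ℕ.+ (toℕ y ℕ.+ toℕ z))                 ≡⟨ reduce-+ (toℕ x) (toℕ y ℕ.+ toℕ z) ⟩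
    reduce (toℕ x) + (y + z)                             ≡⟨ cong (_+ (y + z)) (reduce-toℕ x) ⟩
    x + (y + z)                                          ∎
    where open ≡-Reasoning

  *-assoc : ∀ x y z → x * y * z ≡ x * (y * z)
  *-assoc x y z = begin
    x * y * z                                            ≡⟨ cong (x * y *_) (reduce-toℕ z) ⟨
    reduce (toℕ x ℕ.* toℕ y) * reduce (toℕ z)            ≡⟨ reduce-* (toℕ x ℕ.* toℕ y) (toℕ z) ⟨
    reduce (toℕ x ℕ.* toℕ y ℕ.* toℕ z)                   ≡⟨ cong reduce (ℕₚ.*-assoc (toℕ x) (toℕ y) (toℕ z)) ⟩
    reduce (toℕ x ℕ.* (toℕ y ℕ.* toℕ z))                 ≡⟨ reduce-* (toℕ x) (toℕ y ℕ.* toℕ z) ⟩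
    reduce (toℕ x) * (y * z)                             ≡⟨ cong (_* (y * z)) (reduce-toℕ x) ⟩
    x * (y * z)                                          ∎
    where open ≡-Reasoning

  *-distribˡ-+ : ∀ x y z → x * (y + z) ≡ x * y + x * z
  *-distribˡ-+ x y z = begin
    x * (y + z)                                          ≡⟨ cong (_* (y + z)) (reduce-toℕ x) ⟨
    reduce (toℕ x) * reduce (toℕ y ℕ.+ toℕ z)            ≡⟨ reduce-* (toℕ x) (toℕ y ℕ.+ toℕ z) ⟨
    reduce (toℕ x ℕ.* (toℕ y ℕ.+ toℕ z))                 ≡⟨ cong reduce (ℕₚ.*-distribˡ-+ (toℕ x) (toℕ y) (toℕ z)) ⟩
    reduce (toℕ x ℕ.* toℕ y ℕ.+ toℕ x ℕ.* toℕ z)         ≡⟨ reduce-+ (toℕ x ℕ.* toℕ y) (toℕ x ℕ.* toℕ z) ⟩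
    x * y + x * z                                        ∎
    where open ≡-Reasoning

  *-distribʳ-+ : ∀ x y z → (y + z) * x ≡ y * x + z * x
  *-distribʳ-+ x y z = trans (*-comm (y + z) x) (trans (*-distribˡ-+ x y z) (cong₂ _+_ (*-comm x y) (*-comm x z)))

  +-identityʳ : ∀ x → x + reduce 0 ≡ x
  +-identityʳ x = trans (cong (_+ reduce 0) (sym (reduce-toℕ x))) (trans (sym (reduce-+ (toℕ x) 0))
    (trans (cong reduce (ℕₚ.+-identityʳ (toℕ x))) (reduce-toℕ x)))

  *-identityʳ : ∀ x → x * reduce 1 ≡ x
  *-identityʳ x = trans (cong (_* reduce 1) (sym (reduce-toℕ x))) (trans (sym (reduce-* (toℕ x) 1))
    (trans (cong reduce (ℕₚ.*-identityʳ (toℕ x))) (reduce-toℕ x)))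

  -- The left side is what `subF x y` unfolds to, so this links the subtraction of the statement
  -- with that of the field.
  +-neg : ∀ x y → reduce (toℕ x ℕ.+ (p ∸ toℕ y)) ≡ x + - y
  +-neg x y = trans (reduce-+ (toℕ x) (p ∸ toℕ y)) (cong (_+ - y) (reduce-toℕ x))

  -‿inverseʳ : ∀ x → x + - x ≡ reduce 0
  -‿inverseʳ x = trans (sym (+-neg x x)) (trans (cong reduce (ℕₚ.m+[n∸m]≡n (ℕₚ.<⇒≤ (Finₚ.toℕ<n x))))
    (reduce-cong p 0 (n%n≡0 p)))

  reduce-injective : ∀ {m} → m < p → reduce m ≡ reduce 0 → m ≡ 0
  reduce-injective {m} m<p eq = trans (sym (m<n⇒m%n≡m m<p)) (trans (sym (toℕ-reduce m)) (trans (cong toℕ eq) (toℕ-reduce 0)))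

module PrimeField (n : ℕ) (prime : Prime (suc n)) where
  open Residues n

  private
    1<p : 1 < p
    1<p = ℕ.nonTrivial⇒n>1 p {{prime⇒nonTrivial prime}}

    toℕ≢0 : ∀ {x} → x ≢ reduce 0 → toℕ x ≢ 0
    toℕ≢0 {x} x≢0 eq = x≢0 (trans (sym (reduce-toℕ x)) (cong reduce eq))

    -- Bézout's identity for p and x comes in two forms: 1 + u p = v x gives the inverse v, and 1 +
    -- v x = u p gives -v.
    inverse : ∀ x → x ≢ reduce 0 → ∃ λ y → x * y ≡ reduce 1
    inverse x x≢0 = go (coprime-Bézout (prime⇒coprime prime {{ℕ.≢-nonZero (toℕ≢0 x≢0)}} (Finₚ.toℕ<n x)))
      where
      open ≡-Reasoning
      go : Bézout.Identity 1 p (toℕ x) → ∃ λ y → x * y ≡ reduce 1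
      go (Bézout.-+ u v eq) = reduce v , (begin
        x * reduce v                 ≡⟨ cong (_* reduce v) (reduce-toℕ x) ⟨
        reduce (toℕ x) * reduce v    ≡⟨ reduce-* (toℕ x) v ⟨
        reduce (toℕ x ℕ.* v)         ≡⟨ cong reduce (trans (ℕₚ.*-comm (toℕ x) v) (sym eq)) ⟩
        reduce (1 ℕ.+ u ℕ.* p)       ≡⟨ reduce-cong (1 ℕ.+ u ℕ.* p) 1 ([m+kn]%n≡m%n 1 u p) ⟩
        reduce 1                     ∎)
      go (Bézout.+- u v eq) = - reduce v , (begin
        x * - w                      ≡⟨ +-identityʳ (x * - w) ⟨
        x * - w + reduce 0           ≡⟨ cong (x * - w +_) 1+xw≡0 ⟨
        x * - w + (reduce 1 + x * w) ≡⟨ cong (x * - w +_) (+-comm (reduce 1) (x * w)) ⟩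
        x * - w + (x * w + reduce 1) ≡⟨ +-assoc (x * - w) (x * w) (reduce 1) ⟨
        x * - w + x * w + reduce 1   ≡⟨ cong (_+ reduce 1) (trans (+-comm (x * - w) (x * w)) (sym (*-distribˡ-+ x w (- w)))) ⟩
        x * (w + - w) + reduce 1     ≡⟨ cong (λ z → x * z + reduce 1) (-‿inverseʳ w) ⟩
        x * reduce 0 + reduce 1      ≡⟨ cong (_+ reduce 1) (trans (cong (_* reduce 0) (sym (reduce-toℕ x))) (trans (sym (reduce-* (toℕ x) 0)) (cong reduce (ℕₚ.*-zeroʳ (toℕ x))))) ⟩
        reduce 0 + reduce 1          ≡⟨ trans (+-comm (reduce 0) (reduce 1)) (+-identityʳ (reduce 1)) ⟩
        reduce 1                     ∎)
        where
        w : Fin p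
        w = reduce v
        1+xw≡0 : reduce 1 + x * w ≡ reduce 0
        1+xw≡0 = begin
          reduce 1 + x * w                     ≡⟨ cong (λ z → reduce 1 + z * w) (reduce-toℕ x) ⟨
          reduce 1 + reduce (toℕ x) * reduce v ≡⟨ cong (reduce 1 +_) (reduce-* (toℕ x) v) ⟨
          reduce 1 + reduce (toℕ x ℕ.* v)      ≡⟨ reduce-+ 1 (toℕ x ℕ.* v) ⟨
          reduce (1 ℕ.+ toℕ x ℕ.* v)           ≡⟨ cong reduce (trans (cong suc (ℕₚ.*-comm (toℕ x) v)) eq) ⟩
          reduce (0 ℕ.+ u ℕ.* p)               ≡⟨ reduce-cong (0 ℕ.+ u ℕ.* p) 0 ([m+kn]%n≡m%n 0 u p) ⟩
          reduce 0                             ∎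

    inv : Fin p → Fin p
    inv x with x Finₚ.≟ reduce 0
    ... | yes _  = reduce 0
    ... | no x≢0 = proj₁ (inverse x x≢0)

    *-inv : ∀ x → x ≢ reduce 0 → x * inv x ≡ reduce 1
    *-inv x x≢0 with x Finₚ.≟ reduce 0
    ... | yes x≡0 = ⊥-elim (x≢0 x≡0)
    ... | no x≢0′ = proj₂ (inverse x x≢0′)

  field-𝔽ₚ : Field
  field-𝔽ₚ = record
    { Carrier = Fin p ; _+_ = _+_ ; _*_ = _*_ ; -_ = -_ ; 0# = reduce 0 ; 1# = reduce 1 ; _⁻¹ = inv
    ; isCommutativeRing = record
      { isRing = record
        { +-isAbelianGroup = record
          { isGroup = record
            { isMonoid = record
              { isSemigroup = record
                { isMagma = record { isEquivalence = isEquivalence ; ∙-cong = cong₂ _+_ }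
                ; assoc = +-assoc }
              ; identity = (λ x → trans (+-comm (reduce 0) x) (+-identityʳ x)) , +-identityʳ }
            ; inverse = (λ x → trans (+-comm (- x) x) (-‿inverseʳ x)) , -‿inverseʳ
            ; ⁻¹-cong = cong -_ }
          ; comm = +-comm }
        ; *-cong = cong₂ _*_
        ; *-assoc = *-assoc
        ; *-identity = (λ x → trans (*-comm (reduce 1) x) (*-identityʳ x)) , *-identityʳ
        ; distrib = *-distribˡ-+ , *-distribʳ-+ }
      ; *-comm = *-comm }
    ; *-inverseʳ = *-inv
    ; 1≢0 = λ eq → ℕₚ.1+n≢0 (reduce-injective 1<p eq)
    ; _≟_ = Finₚ._≟_ }

  open IntegerSolver (Field.commutativeRing field-𝔽ₚ) using (ι; ι-suc)

  ι≡reduce : ∀ m → ι m ≡ reduce m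
  ι≡reduce zero    = refl
  ι≡reduce (suc m) = trans (ι-suc m) (trans (cong (reduce 1 +_) (ι≡reduce m)) (sym (reduce-+ 1 m)))

  ι-≢0 : ∀ j → j < n → ι (suc j) ≢ reduce 0
  ι-≢0 j j<n eq = ℕₚ.1+n≢0 (reduce-injective (s≤s j<n) (trans (sym (ι≡reduce (suc j))) eq))

  ι-p : ι p ≡ reduce 0
  ι-p = trans (ι≡reduce p) (reduce-cong p 0 (n%n≡0 p))

elements : ∀ {n} → Subset n → List (Fin n)
elements []            = []
elements (outside ∷ S) = map suc (elements S)
elements (inside ∷ S)  = zero ∷ map suc (elements S)

length-elements : ∀ {n} (S : Subset n) → length (elements S) ≡ ∣ S ∣
length-elements []            = refl
length-elements (outside ∷ S) = trans (length-map suc (elements S)) (length-elements S)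
length-elements (inside ∷ S)  = cong suc (trans (length-map suc (elements S)) (length-elements S))

∈-elements⁺ : ∀ {n} {S : Subset n} {x} → x ∈ˢ S → x ∈ elements S
∈-elements⁺ {S = inside ∷ S}  _[_]=_.here       = here refl
∈-elements⁺ {S = inside ∷ S}  (_[_]=_.there x∈) = there (∈-map⁺ suc (∈-elements⁺ x∈))
∈-elements⁺ {S = outside ∷ S} (_[_]=_.there x∈) = ∈-map⁺ suc (∈-elements⁺ x∈)

∈-elements⁻ : ∀ {n} (S : Subset n) {x} → x ∈ elements S → x ∈ˢ S
∈-elements⁻ (inside ∷ S) (here refl) = _[_]=_.here
∈-elements⁻ (inside ∷ S) (there x∈) with ∈-map⁻ suc x∈
... | y , y∈ , refl = _[_]=_.there (∈-elements⁻ S y∈)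
∈-elements⁻ (outside ∷ S) x∈ with ∈-map⁻ suc x∈
... | y , y∈ , refl = _[_]=_.there (∈-elements⁻ S y∈)

elements-unique : ∀ {n} (S : Subset n) → Unique (elements S)
elements-unique []            = []
elements-unique (outside ∷ S) = Uniqueₚ.map⁺ Finₚ.suc-injective (elements-unique S)
elements-unique (inside ∷ S)  = All.tabulate (λ x∈ eq → zero-∉ (subst (_∈ map suc (elements S)) (sym eq) x∈))
  ∷ Uniqueₚ.map⁺ Finₚ.suc-injective (elements-unique S)
  where
  zero-∉ : ¬ (zero ∈ map suc (elements S))
  zero-∉ x∈ with ∈-map⁻ suc x∈
  ... | _ , _ , ()

-- Transfer to subsets of 𝔽_p

module TernaryDecomposition (n : ℕ) (prime : Prime (suc n))
  (G : Subset (suc n)) (subgroup : IsMulSubgroup G) (proper : IsProperInUnits G)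
  (l : Fin (suc n)) (l≢0 : NonZeroF l) where

  open Residues n using (p; reduce; toℕ-reduce; +-neg)
  open PrimeField n prime using (field-𝔽ₚ; ι-≢0; ι-p)
  open Theory field-𝔽ₚ using (module Finite)
  open Field field-𝔽ₚ using (_+_; _*_; -_; 0#)

  ≢0 : ∀ {x : Fin p} → NonZeroF x → x ≢ 0#
  ≢0 x≢0 x≡0 = x≢0 (trans (cong toℕ x≡0) (toℕ-reduce 0))

  nonzero : ∀ {x : Fin p} → x ≢ 0# → NonZeroF x
  nonzero {x} x≢0 eq = x≢0 (Finₚ.toℕ-injective (trans eq (sym (toℕ-reduce 0))))

  units : List (Fin p)
  units = map suc (allFin n)

  units≢0 : All (_≢ 0#) units
  units≢0 = All.tabulate (λ x∈ → go (∈-map⁻ suc x∈))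
    where
    go : ∀ {x} → (∃ λ i → i ∈ allFin n × x ≡ suc i) → x ≢ 0#
    go (i , _ , refl) = ≢0 (λ ())

  units-complete : ∀ {x : Fin p} → x ≢ 0# → x ∈ units
  units-complete {zero}  x≢0 = ⊥-elim (x≢0 (Finₚ.toℕ-injective (sym (toℕ-reduce 0))))
  units-complete {suc i} _   = ∈-map⁺ suc (∈-allFin i)

  gs : List (Fin p)
  gs = elements G

  all≢0 : ∀ {S : Subset p} → InUnits S → All (_≢ 0#) (elements S)
  all≢0 {S} S≢0 = All.tabulate (λ {x} x∈ → ≢0 (S≢0 x (∈-elements⁻ S x∈)))

  closed : ∀ {g h} → g ∈ gs → h ∈ gs → g * h ∈ gs
  closed {g} {h} g∈ h∈ = ∈-elements⁺ (proj₁ (proj₂ (proj₂ subgroup)) g h (∈-elements⁻ G g∈) (∈-elements⁻ G h∈))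

  outsider : ∃ λ x → x ≢ 0# × x ∉ gs
  outsider = let x , x≢0 , x∉ = proper in x , ≢0 x≢0 , λ x∈ → x∉ (∈-elements⁻ G x∈)

  impossible : 1024 ℕ.* 1024 < ∣ G ∣ → (A B C : Subset p) → InUnits A → InUnits B → InUnits C →
    2 ≤ ∣ A ∣ → 2 ≤ ∣ B ∣ → 2 ≤ ∣ C ∣ → ¬ ProdEqShift A B C G l
  -- 3 + 1048574 is 1024² + 1, so `large` yields |G| ≥ 3 and |G| can be written as 3 + N′.
  impossible large A B C A≢0 B≢0 C≢0 2≤A 2≤B 2≤C eq = go (ℕₚ.m≤n⇒∃[o]m+o≡n (ℕₚ.≤-trans (ℕₚ.m≤m+n 3 1048574) large))
    where
    go : (∃ λ N′ → 3 ℕ.+ N′ ≡ ∣ G ∣) → ⊥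
    go (N′ , N≡) = T.no-ternary-decomposition (subst (1024 ℕ.* 1024 <_) (sym N≡) large)
      (factor A A≢0 2≤A) (factor B B≢0 2≤B) (factor C C≢0 2≤C) triples-in triples-cover
      where
      module Fin′ = Finite n units (Uniqueₚ.map⁺ Finₚ.suc-injective (Uniqueₚ.allFin⁺ n)) units≢0 units-complete
                      (trans (length-map suc (allFin n)) (length-tabulate (λ i → i))) ι-≢0 ι-p
      module Sub = Fin′.Subgroup gs (elements-unique G) (all≢0 (proj₁ subgroup)) closed N′ (trans (length-elements G) (sym N≡)) outsider
      module Sh = Sub.Shifted l (≢0 l≢0)
      module T = Sh.Ternary p toℕ Finₚ.toℕ<n Finₚ.toℕ-injective

      factor : ∀ S → InUnits S → 2 ≤ ∣ S ∣ → T.Factor (elements S)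
      factor S S≢0 2≤S = elements-unique S , all≢0 S≢0 , subst (2 ≤_) (sym (length-elements S)) 2≤S

      triples-in : T.Triples-in (elements A) (elements B) (elements C)
      triples-in {a} {b} {c} a∈ b∈ c∈ =
        let (g , g∈ , e) , _ = Equivalence.to (eq ((a * b) * c))
              (a , b , c , ∈-elements⁻ A a∈ , ∈-elements⁻ B b∈ , ∈-elements⁻ C c∈ , refl)
        in g , ∈-elements⁺ g∈ , trans e (+-neg g l)

      triples-cover : T.Triples-cover (elements A) (elements B) (elements C)
      triples-cover {g} g∈ g-l≢0 =
        let a , b , c , a∈ , b∈ , c∈ , e = Equivalence.from (eq (g + - l)) ((g , ∈-elements⁻ G g∈ , sym (+-neg g l)) , nonzero g-l≢0)
        in a , b , c , ∈-elements⁺ a∈ , ∈-elements⁺ b∈ , ∈-elements⁺ c∈ , sym e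

theorem6p6 : ∃ λ (M : ℕ) → 0 < M ×
    ((p : ℕ) → Prime p → (G : Subset p) → IsMulSubgroup G → IsProperInUnits G →
    M < ∣ G ∣ → (l : Fin p) → NonZeroF l →
    (A B C : Subset p) → InUnits A → InUnits B → InUnits C →
    2 ≤ ∣ A ∣ → 2 ≤ ∣ B ∣ → 2 ≤ ∣ C ∣ →
    ¬ ProdEqShift A B C G l)
theorem6p6 = 1024 ℕ.* 1024 , s≤s z≤n , λ where
  zero    p-prime → ⊥-elim (¬prime[0] p-prime)
  (suc n) p-prime G subgroup proper large l l≢0 → TernaryDecomposition.impossible n p-prime G subgroup proper l l≢0 large
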